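{- Let $M$ be a finitely generated torsion $R$-module and let $n \geq 0$. For an exact sequence \[ 0 \to N \to P_1 \to \dots \to P_n \to M \to 0 \qquad (\ast) \] of finitely generated torsion $R$-modules with $\mathrm{pd}_R(P_i) \leq 1$ for $1 \leq i \leq n$, consider the fractional ideal \[ \mathcal{F}^{[n]}(M) = \left(\prod_{i=1}^n \mathrm{Fitt}_R(P_i)^{(-1)^i}\right) \mathrm{Fitt}_R(N) \] of $R$. Then $\mathcal{F}^{[n]}(M)$ is independent of the choice of the sequence $(\ast)$.
   Context: Let $p$ be an odd prime, $K$ a totally real number field, $K^{\mathrm{cyc}}$ its cyclotomic $\mathbb{Z}_p$-extension, $K'$ a totally real finite abelian $p$-extension of $K$ with $K' \cap K^{\mathrm{cyc}} = K$, $L = K'K^{\mathrm{cyc}}$, $G = \mathrm{Gal}(L/K)$, $\Delta = \mathrm{Gal}(L/K^{\mathrm{cyc}})$ (a finite abelian $p$-group), so that $G = \mathrm{Gal}(L/K') \times \Delta$ with $\mathrm{Gal}(L/K') \simeq \mathbb{Z}_p$. Put $R = \mathbb{Z}_p[[G]]$; choosing a topological generator $\gamma$ of $\mathrm{Gal}(L/K')$ gives $R \simeq \mathbb{Z}_p[[T]][\Delta]$, $\gamma \mapsto 1+T$. An $R$-module is called torsion if it is torsion as a $\mathbb{Z}_p[[T]]$-module. $\mathrm{pd}_R$ denotes projective dimension over $R$. $\mathrm{Fitt}_R(M)$ is the (initial) Fitting ideal: for a presentation $R^b \xrightarrow{h} R^a \to M \to 0$ with $h$ viewed as an $a\times b$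 matrix, it is the ideal generated by all $a \times a$ minors of $h$. Fractional ideals of $R$ are finitely generated $R$-submodules of the total ring of fractions $Q(R)$ of $R$. For a finitely generated torsion $R$-module $P$ with $\mathrm{pd}_R(P)\le 1$, the ideal $\mathrm{Fitt}_R(P)$ is invertible as a fractional ideal, so its negative powers make sense. -}

module Defs where

open import Algebra.Bundles using (AbelianGroup; CommutativeRing)
import Algebra.Construct.Pointwise as Pointwise
open import Algebra.Module.Bundles using (Module)
import Algebra.Module.Construct.TensorUnit as TensorUnit
open import Algebra.Module.Morphism.Structures using (IsModuleHomomorphism)
open import Algebra.Module.Structures using (IsLeftModule)
open import Algebra.Module.Structures.Biased using (IsModuleFromLeft)
import Algebra.Properties.AbelianGroup as AbelianGroupProperties
import Algebra.Properties.Ring as RingProperties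
import Algebra.Properties.Semiring.Exp as Exp
import Algebra.Properties.Semiring.Sum as Sum
import Algebra.Solver.Ring.NaturalCoefficients.Default as NaturalSolver
open import Algebra.Structures using (IsAbelianGroup)
open import Data.Fin.Base as Fin
  using (Fin; zero; suc; toℕ; fromℕ; inject₁; punchIn)
import Data.Fin.Properties as Fin
open import Data.Fin.Permutation as Perm using (Permutation′; permutation)
open import Data.Integer.Base as ℤ using (ℤ; +_; -[1+_]; -1ℤ)
open import Data.Integer.Divisibility.Signed as ℤ∣ using (_∣_; divides)
import Data.Integer.Properties as ℤ
import Data.Integer.Solver as ℤSolver
open import Data.Nat.Base as ℕ using (ℕ; zero; suc)
open import Data.Product.Base using (Σ-syntax; ∃-syntax; _×_; _,_)
open import Data.Vec.Functional using (Vector; _∷_; insertAt; foldr)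
open import Function.Base using (_∘_)
open import Function.Bundles using (Func; Inverse; _⇔_)
open import Function.Definitions using (Injective; Surjective)
open import Level using (Level; 0ℓ; _⊔_) renaming (suc to lsuc)
open import Relation.Binary.Core using (Rel; _Preserves_⟶_)
open import Relation.Binary.PropositionalEquality as ≡ using (_≡_; _≢_)
import Relation.Binary.Reasoning.Setoid as SetoidReasoning
open import Relation.Binary.Structures using (IsEquivalence)
open import Relation.Nullary using (¬_; Dec; yes; no; contradiction)
open import Relation.Unary using (Pred)

private
  variable
    m₁ m₂ ℓ₁ ℓ₂ : Level

module _
  {A : Set} {_≈_ : Rel A 0ℓ} {_+_ _*_ : A → A → A} {0# : A} { -_ : A → A} {1# : A}
  (+-isAbelianGroup : IsAbelianGroup _≈_ _+_ 0# -_)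
  (*-cong      : ∀ {x y u v} → x ≈ y → u ≈ v → (x * u) ≈ (y * v))
  (*-assoc     : ∀ x y z → ((x * y) * z) ≈ (x * (y * z)))
  (*-comm      : ∀ x y → (x * y) ≈ (y * x))
  (*-identityˡ : ∀ x → (1# * x) ≈ x)
  (distribʳ    : ∀ x y z → ((y + z) * x) ≈ ((y * x) + (z * x)))
  where

  private module G = IsAbelianGroup +-isAbelianGroup

  mkCommutativeRing : CommutativeRing 0ℓ 0ℓ
  mkCommutativeRing = record
    { Carrier = A ; _≈_ = _≈_ ; _+_ = _+_ ; _*_ = _*_ ; -_ = -_ ; 0# = 0# ; 1# = 1#
    ; isCommutativeRing = record
      { isRing = record
        { +-isAbelianGroup = +-isAbelianGroup
        ; *-cong     = *-cong
        ; *-assoc    = *-assoc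
        ; *-identity = *-identityˡ , λ x → G.trans (*-comm x 1#) (*-identityˡ x)
        ; distrib    =
            (λ x y z → G.trans (*-comm x (y + z))
                         (G.trans (distribʳ x y z) (G.∙-cong (*-comm y x) (*-comm z x))))
            , distribʳ
        }
      ; *-comm = *-comm
      }
    }

private
  module RingIdentities (A : CommutativeRing 0ℓ 0ℓ) where
    open CommutativeRing A using (_≈_; _+_; _*_; 0#; 1#; refl; commutativeSemiring)
    open NaturalSolver commutativeSemiring using (solve; con; _:+_; _:*_; _:=_)

    ⊛-distrib₀ : ∀ a b c → (a + b) * c + 0# ≈ (a * c + 0#) + (b * c + 0#)
    ⊛-distrib₀ = solve 3 (λ a b c →
      (a :+ b) :* c :+ con 0
        := (a :* c :+ con 0) :+ (b :* c :+ con 0)) refl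

    ⊛-distrib₊ : ∀ a b c x y → (a + b) * c + (x + y) ≈ (a * c + x) + (b * c + y)
    ⊛-distrib₊ = solve 5 (λ a b c x y →
      (a :+ b) :* c :+ (x :+ y)
        := (a :* c :+ x) :+ (b :* c :+ y)) refl

    ⊛-scale₀ : ∀ a b c → (a * b) * c + 0# ≈ a * (b * c + 0#)
    ⊛-scale₀ = solve 3 (λ a b c → (a :* b) :* c :+ con 0 := a :* (b :* c :+ con 0)) refl

    ⊛-scale₊ : ∀ a b c x → (a * b) * c + a * x ≈ a * (b * c + x)
    ⊛-scale₊ = solve 4 (λ a b c x → (a :* b) :* c :+ a :* x := a :* (b :* c :+ x)) refl

    ⊛-suc₀ : ∀ x y → x + (y + 0#) ≈ (x + 0#) + y
    ⊛-suc₀ = solve 2 (λ x y → x :+ (y :+ con 0) := (x :+ con 0) :+ y) refl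

    ⊛-assoc₀ : ∀ a b c → (a * b + 0#) * c + 0# ≈ a * (b * c + 0#) + 0#
    ⊛-assoc₀ = solve 3 (λ a b c →
      (a :* b :+ con 0) :* c :+ con 0
        := a :* (b :* c :+ con 0) :+ con 0) refl

    ⊛-assoc₊ : ∀ a b c x y → (a * b + 0#) * c + (a * x + y) ≈ a * (b * c + x) + y
    ⊛-assoc₊ = solve 5 (λ a b c x y →
      (a :* b :+ con 0) :* c :+ (a :* x :+ y)
        := a :* (b :* c :+ x) :+ y) refl

    swap : ∀ a b c → a * (b * c) ≈ (b * a) * c
    swap = solve 3 (λ a b c → a :* (b :* c) := (b :* a) :* c) refl

    swap′ : ∀ a b c → (a * b) * c ≈ (a * c) * b
    swap′ = solve 3 (λ a b c → (a :* b) :* c := (a :* c) :* b) refl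

    swap″ : ∀ a b c → (a * b) * c ≈ b * (a * c)
    swap″ = solve 3 (λ a b c → (a :* b) :* c := b :* (a :* c)) refl

    +-frac : ∀ a b c d e f → (a * b + c * d) * (e * f) ≈ (a * e) * (b * f) + (c * f) * (d * e)
    +-frac = solve 6 (λ a b c d e f →
      (a :* b :+ c :* d) :* (e :* f)
        := (a :* e) :* (b :* f) :+ (c :* f) :* (d :* e)) refl

    +-frac′ : ∀ a b c d e f → (a * b) * (c * d) + (e * c) * (b * f) ≈ (a * d + e * f) * (b * c)
    +-frac′ = solve 6 (λ a b c d e f →
      (a :* b) :* (c :* d) :+ (e :* c) :* (b :* f)
        := (a :* d :+ e :* f) :* (b :* c)) refl

    interchange : ∀ a b c d → (a * b) * (c * d) ≈ (a * c) * (b * d)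
    interchange = solve 4 (λ a b c d → (a :* b) :* (c :* d) := (a :* c) :* (b :* d)) refl

    +Q-assoc : ∀ a b c d e f →
      ((a * d + b * c) * f + e * (c * d)) * (c * (d * f))
        ≈ (a * (d * f) + (b * f + e * d) * c) * ((c * d) * f)
    +Q-assoc = solve 6 (λ a b c d e f →
      ((a :* d :+ b :* c) :* f :+ e :* (c :* d)) :* (c :* (d :* f))
        := (a :* (d :* f) :+ (b :* f :+ e :* d) :* c) :* ((c :* d) :* f)) refl

    +Q-identityˡ : ∀ a b → (0# * b + a * 1#) * b ≈ a * (1# * b)
    +Q-identityˡ = solve 2 (λ a b → (con 0 :* b :+ a :* con 1) :* b := a :* (con 1 :* b)) refl

    +Q-identityʳ : ∀ a b → (a * 1# + 0# * b) * b ≈ a * (b * 1#)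
    +Q-identityʳ = solve 2 (λ a b → (a :* con 1 :+ con 0 :* b) :* b := a :* (b :* con 1)) refl

    +Q-comm : ∀ a b c d → (a * d + b * c) * (d * c) ≈ (b * c + a * d) * (c * d)
    +Q-comm = solve 4 (λ a b c d →
      (a :* d :+ b :* c) :* (d :* c)
        := (b :* c :+ a :* d) :* (c :* d)) refl

    *Q-assoc : ∀ a b c d e f → ((a * b) * c) * (d * (e * f)) ≈ (a * (b * c)) * ((d * e) * f)
    *Q-assoc = solve 6 (λ a b c d e f →
      ((a :* b) :* c) :* (d :* (e :* f))
        := (a :* (b :* c)) :* ((d :* e) :* f)) refl

    *Q-comm : ∀ a b c d → (a * b) * (d * c) ≈ (b * a) * (c * d)
    *Q-comm = solve 4 (λ a b c d → (a :* b) :* (d :* c) := (b :* a) :* (c :* d)) refl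

    *Q-identityˡ : ∀ a b → (1# * a) * b ≈ a * (1# * b)
    *Q-identityˡ = solve 2 (λ a b → (con 1 :* a) :* b := a :* (con 1 :* b)) refl

    *Q-distribʳ : ∀ a b c d e f →
      ((b * f + c * e) * a) * ((e * d) * (f * d))
        ≈ ((b * a) * (f * d) + (c * a) * (e * d)) * ((e * f) * d)
    *Q-distribʳ = solve 6 (λ a b c d e f →
      ((b :* f :+ c :* e) :* a) :* ((e :* d) :* (f :* d))
        := ((b :* a) :* (f :* d) :+ (c :* a) :* (e :* d)) :* ((e :* f) :* d)) refl

    ι-+ : ∀ r s → (r + s) * (1# * 1#) ≈ (r * 1# + s * 1#) * 1#
    ι-+ = solve 2 (λ r s →
      (r :+ s) :* (con 1 :* con 1)
        := (r :* con 1 :+ s :* con 1) :* con 1) refl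

    ι-* : ∀ r s → (r * s) * (1# * 1#) ≈ (r * s) * 1#
    ι-* = solve 2 (λ r s → (r :* s) :* (con 1 :* con 1) := (r :* s) :* con 1) refl

-- The p-adic integers, as the inverse limit of the rings ℤ / pⁿ.
module PAdic (p : ℕ) where
  open ℤSolver.+-*-Solver using (solve; _:+_; _:*_; _:-_; :-_; _:=_)

  -- approx n represents the image in ℤ / pⁿ.
  record ℤₚ : Set where
    field
      approx   : ℕ → ℤ
      coherent : ∀ n → + (p ℕ.^ n) ∣ approx (suc n) ℤ.- approx n

  open ℤₚ public

  _≈ₚ_ : Rel ℤₚ 0ℓ
  x ≈ₚ y = ∀ n → + (p ℕ.^ n) ∣ approx x n ℤ.- approx y n

  private
    ∣-0 : ∀ {d a b} → a ≡ b → d ∣ a ℤ.- b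
    ∣-0 {d} {a} ≡.refl = divides (+ 0) (≡.trans (ℤ.+-inverseʳ a) (≡.sym (ℤ.*-zeroˡ d)))

    ∣-sym : ∀ {d} a b → d ∣ a ℤ.- b → d ∣ b ℤ.- a
    ∣-sym {d} a b q = ≡.subst (d ∣_) (lem a b) (ℤ∣.∣m⇒∣-m q)
      where lem : ∀ a b → ℤ.- (a ℤ.- b) ≡ b ℤ.- a
            lem = solve 2 (λ a b → :- (a :- b) := b :- a) ≡.refl

    ∣-trans′ : ∀ {d} a b c → d ∣ a ℤ.- b → d ∣ b ℤ.- c → d ∣ a ℤ.- c
    ∣-trans′ {d} a b c q r = ≡.subst (d ∣_) (lem a b c) (ℤ∣.∣m∣n⇒∣m+n q r)
      where lem : ∀ a b c → (a ℤ.- b) ℤ.+ (b ℤ.- c) ≡ a ℤ.- c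
            lem = solve 3 (λ a b c → (a :- b) :+ (b :- c) := a :- c) ≡.refl

    ∣-+ : ∀ {d} a b u v → d ∣ a ℤ.- b → d ∣ u ℤ.- v → d ∣ (a ℤ.+ u) ℤ.- (b ℤ.+ v)
    ∣-+ {d} a b u v q r = ≡.subst (d ∣_) (lem a b u v) (ℤ∣.∣m∣n⇒∣m+n q r)
      where lem : ∀ a b u v → (a ℤ.- b) ℤ.+ (u ℤ.- v) ≡ (a ℤ.+ u) ℤ.- (b ℤ.+ v)
            lem = solve 4 (λ a b u v → (a :- b) :+ (u :- v) := (a :+ u) :- (b :+ v)) ≡.refl

    ∣-neg : ∀ {d} a b → d ∣ a ℤ.- b → d ∣ (ℤ.- a) ℤ.- (ℤ.- b)
    ∣-neg {d} a b q = ≡.subst (d ∣_) (lem a b) (ℤ∣.∣m⇒∣-m q)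
      where lem : ∀ a b → ℤ.- (a ℤ.- b) ≡ (ℤ.- a) ℤ.- (ℤ.- b)
            lem = solve 2 (λ a b → :- (a :- b) := (:- a) :- (:- b)) ≡.refl

    ∣-* : ∀ {d} a b u v → d ∣ a ℤ.- b → d ∣ u ℤ.- v → d ∣ (a ℤ.* u) ℤ.- (b ℤ.* v)
    ∣-* {d} a b u v q r =
      ≡.subst (d ∣_) (lem a b u v) (ℤ∣.∣m∣n⇒∣m+n (ℤ∣.∣m⇒∣m*n u q) (ℤ∣.∣n⇒∣m*n b r))
      where lem : ∀ a b u v → (a ℤ.- b) ℤ.* u ℤ.+ b ℤ.* (u ℤ.- v) ≡ (a ℤ.* u) ℤ.- (b ℤ.* v)
            lem = solve 4 (λ a b u v → (a :- b) :* u :+ b :* (u :- v) := (a :* u) :- (b :* v)) ≡.refl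

  constₚ : ℤ → ℤₚ
  constₚ z = record { approx = λ _ → z ; coherent = λ _ → ∣-0 {a = z} ≡.refl }

  _+ₚ_ _*ₚ_ : ℤₚ → ℤₚ → ℤₚ
  x +ₚ y = record
    { approx   = λ n → approx x n ℤ.+ approx y n
    ; coherent = λ n → ∣-+ (approx x (suc n)) (approx x n) (approx y (suc n)) (approx y n)
                           (coherent x n) (coherent y n)
    }
  x *ₚ y = record
    { approx   = λ n → approx x n ℤ.* approx y n
    ; coherent = λ n → ∣-* (approx x (suc n)) (approx x n) (approx y (suc n)) (approx y n)
                           (coherent x n) (coherent y n)
    }

  -ₚ_ : ℤₚ → ℤₚ
  -ₚ x = record
    { approx   = λ n → ℤ.- approx x n
    ; coherent = λ n → ∣-neg (approx x (suc n)) (approx x n) (coherent x n)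
    }

  ℤₚ-ring : CommutativeRing 0ℓ 0ℓ
  ℤₚ-ring = mkCommutativeRing {_≈_ = _≈ₚ_} {_+ₚ_} {_*ₚ_} {constₚ (+ 0)} { -ₚ_} {constₚ (+ 1)}
    (record
      { isGroup = record
        { isMonoid = record
          { isSemigroup = record
            { isMagma = record
              { isEquivalence = record
                { refl  = λ {x} n → ∣-0 {a = approx x n} ≡.refl
                ; sym   = λ {x} {y} x≈y n → ∣-sym (approx x n) (approx y n) (x≈y n)
                ; trans = λ {x} {y} {z} x≈y y≈z n →
                    ∣-trans′ (approx x n) (approx y n) (approx z n) (x≈y n) (y≈z n)
                }
              ; ∙-cong = λ {x} {y} {u} {v} x≈y u≈v n →
                  ∣-+ (approx x n) (approx y n) (approx u n) (approx v n) (x≈y n) (u≈v n)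
              }
            ; assoc = λ x y z n → ∣-0 (ℤ.+-assoc (approx x n) (approx y n) (approx z n))
            }
          ; identity = (λ x n → ∣-0 (ℤ.+-identityˡ (approx x n)))
                     , (λ x n → ∣-0 (ℤ.+-identityʳ (approx x n)))
          }
        ; inverse = (λ x n → ∣-0 (ℤ.+-inverseˡ (approx x n)))
                  , (λ x n → ∣-0 (ℤ.+-inverseʳ (approx x n)))
        ; ⁻¹-cong = λ {x} {y} x≈y n → ∣-neg (approx x n) (approx y n) (x≈y n)
        }
      ; comm = λ x y n → ∣-0 (ℤ.+-comm (approx x n) (approx y n))
      })
    (λ {x} {y} {u} {v} x≈y u≈v n →
       ∣-* (approx x n) (approx y n) (approx u n) (approx v n) (x≈y n) (u≈v n))
    (λ x y z n → ∣-0 (ℤ.*-assoc (approx x n) (approx y n) (approx z n)))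
    (λ x y n → ∣-0 (ℤ.*-comm (approx x n) (approx y n)))
    (λ x n → ∣-0 (ℤ.*-identityˡ (approx x n)))
    (λ x y z n → ∣-0 (ℤ.*-distribʳ-+ (approx x n) (approx y n) (approx z n)))

open PAdic public using (ℤₚ-ring)

-- Formal power series f are given by coefficients: f n is the coefficient of Tⁿ.
module PowerSeries (A : CommutativeRing 0ℓ 0ℓ) where
  open CommutativeRing A hiding (zero)
  open Sum semiring using (sum; sum-cong-≋)
  open SetoidReasoning setoid

  private
    +-pointwise : AbelianGroup 0ℓ 0ℓ
    +-pointwise = Pointwise.abelianGroup ℕ +-abelianGroup

    module Id = RingIdentities A

  Series : Set
  Series = ℕ → Carrier

  infix 4 _≈ₛ_
  _≈ₛ_ : Rel Series 0ℓ
  f ≈ₛ g = ∀ n → f n ≈ g n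

  infixl 7 _⊛_
  _⊛_ : Series → Series → Series
  (f ⊛ g) n = sum {suc n} (λ i → f (toℕ i) * g (n ℕ.∸ toℕ i))

  1ₛ : Series
  1ₛ zero    = 1#
  1ₛ (suc n) = 0#

  private
    ⊛-cong : ∀ {f f′ g g′} → f ≈ₛ f′ → g ≈ₛ g′ → f ⊛ g ≈ₛ f′ ⊛ g′
    ⊛-cong f≈ g≈ n = sum-cong-≋ {suc n} (λ i → *-cong (f≈ (toℕ i)) (g≈ (n ℕ.∸ toℕ i)))

    ⊛-distribʳ : ∀ h f g n → ((λ k → f k + g k) ⊛ h) n ≈ (f ⊛ h) n + (g ⊛ h) n
    ⊛-distribʳ h f g zero    = Id.⊛-distrib₀ _ _ _
    ⊛-distribʳ h f g (suc n) =
      trans (+-congˡ (⊛-distribʳ h (f ∘ suc) (g ∘ suc) n)) (Id.⊛-distrib₊ _ _ _ _ _)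

    ⊛-scale : ∀ a f g n → ((λ k → a * f k) ⊛ g) n ≈ a * (f ⊛ g) n
    ⊛-scale a f g zero    = Id.⊛-scale₀ a (f 0) (g 0)
    ⊛-scale a f g (suc n) = trans (+-congˡ (⊛-scale a (f ∘ suc) g n)) (Id.⊛-scale₊ _ _ _ _)

    ⊛-sucʳ : ∀ f g n → (f ⊛ g) (suc n) ≈ (f ⊛ (g ∘ suc)) n + f (suc n) * g 0
    ⊛-sucʳ f g zero    = Id.⊛-suc₀ _ _
    ⊛-sucʳ f g (suc n) = trans (+-congˡ (⊛-sucʳ (f ∘ suc) g n)) (sym (+-assoc _ _ _))

    ⊛-comm : ∀ f g → f ⊛ g ≈ₛ g ⊛ f
    ⊛-comm f g zero    = +-congʳ (*-comm _ _)
    ⊛-comm f g (suc n) = begin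
      f 0 * g (suc n) + ((f ∘ suc) ⊛ g) n  ≈⟨ +-cong (*-comm _ _) (⊛-comm (f ∘ suc) g n) ⟩
      g (suc n) * f 0 + (g ⊛ (f ∘ suc)) n  ≈⟨ +-comm _ _ ⟩
      (g ⊛ (f ∘ suc)) n + g (suc n) * f 0  ≈⟨ ⊛-sucʳ g f n ⟨
      (g ⊛ f) (suc n)                      ∎

    ⊛-assoc : ∀ f g h → (f ⊛ g) ⊛ h ≈ₛ f ⊛ (g ⊛ h)
    ⊛-assoc f g h zero    = Id.⊛-assoc₀ _ _ _
    ⊛-assoc f g h (suc n) = begin
      (f 0 * g 0 + 0#) * h (suc n) + ((λ k → f 0 * g (suc k) + ((f ∘ suc) ⊛ g) k) ⊛ h) n
        ≈⟨ +-congˡ (⊛-distribʳ h (λ k → f 0 * g (suc k)) ((f ∘ suc) ⊛ g) n) ⟩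
      (f 0 * g 0 + 0#) * h (suc n)
        + (((λ k → f 0 * g (suc k)) ⊛ h) n + (((f ∘ suc) ⊛ g) ⊛ h) n)
        ≈⟨ +-congˡ (+-cong (⊛-scale (f 0) (g ∘ suc) h n) (⊛-assoc (f ∘ suc) g h n)) ⟩
      (f 0 * g 0 + 0#) * h (suc n)
        + (f 0 * ((g ∘ suc) ⊛ h) n + ((f ∘ suc) ⊛ (g ⊛ h)) n)
        ≈⟨ Id.⊛-assoc₊ _ _ _ _ _ ⟩
      f 0 * (g 0 * h (suc n) + ((g ∘ suc) ⊛ h) n) + ((f ∘ suc) ⊛ (g ⊛ h)) n  ∎

    ⊛-zeroˡ : ∀ f n → ((λ _ → 0#) ⊛ f) n ≈ 0#
    ⊛-zeroˡ f zero    = trans (+-identityʳ _) (zeroˡ _)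
    ⊛-zeroˡ f (suc n) = trans (+-cong (zeroˡ _) (⊛-zeroˡ f n)) (+-identityʳ _)

    ⊛-identityˡ : ∀ f → 1ₛ ⊛ f ≈ₛ f
    ⊛-identityˡ f zero    = trans (+-identityʳ _) (*-identityˡ _)
    ⊛-identityˡ f (suc n) = trans (+-cong (*-identityˡ _) (⊛-zeroˡ f n)) (+-identityʳ _)

  series-ring : CommutativeRing 0ℓ 0ℓ
  series-ring = mkCommutativeRing {1# = 1ₛ} (AbelianGroup.isAbelianGroup +-pointwise)
    ⊛-cong ⊛-assoc ⊛-comm ⊛-identityˡ ⊛-distribʳ

_⟦T⟧ : CommutativeRing 0ℓ 0ℓ → CommutativeRing 0ℓ 0ℓ
A ⟦T⟧ = PowerSeries.series-ring A

record FiniteAbelianPGroup (p : ℕ) : Set₁ where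
  field
    abelianGroup : AbelianGroup 0ℓ 0ℓ
    exponent     : ℕ

  open AbelianGroup abelianGroup public

  order : ℕ
  order = p ℕ.^ exponent

  field
    enumeration : Inverse setoid (≡.setoid (Fin order))

module GroupRing (A : CommutativeRing 0ℓ 0ℓ) {p : ℕ} (Δ : FiniteAbelianPGroup p) where
  open CommutativeRing A hiding (zero)
  open Sum semiring
    using (sum; sum-cong-≋; ∑-distrib-+; ∑-comm; ∑-permute; *-distribˡ-sum; *-distribʳ-sum)
  open SetoidReasoning setoid
  private
    module Δ = FiniteAbelianPGroup Δ
    module ΔP = AbelianGroupProperties Δ.abelianGroup
    open Δ using (_∙_; ε; _⁻¹; order)
    open Inverse Δ.enumeration using (to; from; to-cong; from-cong; strictlyInverseˡ; strictlyInverseʳ)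

  -- An element Σ_δ f(δ)[δ] is given by its coefficient function.
  Element : Set
  Element = Func Δ.setoid setoid

  open Func using (cong) renaming (to to infixl 20 _⟨_⟩)

  _≈ᴳ_ : Rel Element 0ℓ
  f ≈ᴳ g = ∀ δ → f ⟨ δ ⟩ ≈ g ⟨ δ ⟩

  0ᴳ : Element
  0ᴳ = record { to = λ _ → 0# ; cong = λ _ → refl }

  _+ᴳ_ _*ᴳ_ : Element → Element → Element
  f +ᴳ g = record
    { to   = λ δ → f ⟨ δ ⟩ + g ⟨ δ ⟩
    ; cong = λ δ≈ → +-cong (cong f δ≈) (cong g δ≈)
    }
  f *ᴳ g = record
    { to   = λ δ → sum {order} (λ i → f ⟨ from i ⟩ * g ⟨ from i ⁻¹ ∙ δ ⟩)
    ; cong = λ δ≈ → sum-cong-≋ {order} (λ i → *-congˡ (cong g (Δ.∙-congˡ δ≈)))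
    }

  -ᴳ_ : Element → Element
  -ᴳ f = record { to = λ δ → - f ⟨ δ ⟩ ; cong = λ δ≈ → -‿cong (cong f δ≈) }

  private
    indicator : Carrier → ∀ {i j : Fin order} → Dec (i ≡ j) → Carrier
    indicator a (yes _) = a
    indicator a (no _)  = 0#

    indicator-cong : ∀ a {i i′ j} (d : Dec (i ≡ j)) (d′ : Dec (i′ ≡ j)) →
                     i ≡ i′ → indicator a d ≈ indicator a d′
    indicator-cong a (yes _) (yes _)  _     = refl
    indicator-cong a (no _)  (no _)   _     = refl
    indicator-cong a (yes q) (no ¬q)  i≡i′  = contradiction (≡.trans (≡.sym i≡i′) q) ¬q
    indicator-cong a (no ¬q) (yes q)  i≡i′  = contradiction (≡.trans i≡i′ q) ¬q

  -- The inclusion A → A[Δ], a ↦ a·[ε].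
  scalar : Carrier → Element
  scalar a = record
    { to   = λ δ → indicator a (to δ Fin.≟ to ε)
    ; cong = λ {δ} {δ′} δ≈ →
        indicator-cong a (to δ Fin.≟ to ε) (to δ′ Fin.≟ to ε) (to-cong δ≈)
    }

  private
    reindex : (φ ψ : Δ.Carrier → Δ.Carrier) →
              (∀ {x y} → x Δ.≈ y → φ x Δ.≈ φ y) → (∀ {x y} → x Δ.≈ y → ψ x Δ.≈ ψ y) →
              (∀ x → φ (ψ x) Δ.≈ x) → (∀ x → ψ (φ x) Δ.≈ x) →
              (F : Δ.Carrier → Carrier) → (∀ {x y} → x Δ.≈ y → F x ≈ F y) →
              sum {order} (F ∘ from) ≈ sum {order} (F ∘ φ ∘ from)
    reindex φ ψ φ-cong ψ-cong φψ ψφ F F-cong =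
      trans (∑-permute (F ∘ from) π)
            (sum-cong-≋ {order} (λ i → F-cong (strictlyInverseʳ (φ (from i)))))
      where
      round : ∀ (α β : Δ.Carrier → Δ.Carrier) → (∀ {x y} → x Δ.≈ y → α x Δ.≈ α y) →
              (∀ x → α (β x) Δ.≈ x) → ∀ i → to (α (from (to (β (from i))))) ≡ i
      round α β α-cong αβ i =
        ≡.trans (to-cong (Δ.trans (α-cong (strictlyInverseʳ (β (from i)))) (αβ (from i))))
                (strictlyInverseˡ i)

      π : Permutation′ order
      π = permutation (to ∘ φ ∘ from) (to ∘ ψ ∘ from) (round φ ψ φ-cong φψ) (round ψ φ ψ-cong ψφ)

    ⁻¹-cancelˡ : ∀ x y → x ⁻¹ ∙ (x ∙ y) Δ.≈ y
    ⁻¹-cancelˡ x y = Δ.trans (Δ.sym (Δ.assoc _ _ _))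
                       (Δ.trans (Δ.∙-congʳ (Δ.inverseˡ x)) (Δ.identityˡ y))

    cancelˡ-⁻¹ : ∀ x y → x ∙ (x ⁻¹ ∙ y) Δ.≈ y
    cancelˡ-⁻¹ x y = Δ.trans (Δ.sym (Δ.assoc _ _ _))
                       (Δ.trans (Δ.∙-congʳ (Δ.inverseʳ x)) (Δ.identityˡ y))

    flip⁻¹ : ∀ x y → (x ⁻¹ ∙ y) ⁻¹ ∙ y Δ.≈ x
    flip⁻¹ x y = Δ.trans (Δ.∙-congʳ (ΔP.⁻¹-anti-homo-\\ x y))
                   (Δ.trans (Δ.comm _ _) (cancelˡ-⁻¹ y x))

    *ᴳ-comm : ∀ f g → (f *ᴳ g) ≈ᴳ (g *ᴳ f)
    *ᴳ-comm f g δ = begin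
      sum {order} (λ i → f ⟨ from i ⟩ * g ⟨ from i ⁻¹ ∙ δ ⟩)
        ≈⟨ reindex φ φ φ-cong φ-cong (λ x → flip⁻¹ x δ) (λ x → flip⁻¹ x δ)
                   (λ x → f ⟨ x ⟩ * g ⟨ x ⁻¹ ∙ δ ⟩)
                   (λ x≈ → *-cong (cong f x≈) (cong g (φ-cong x≈))) ⟩
      sum {order} (λ i → f ⟨ φ (from i) ⟩ * g ⟨ φ (from i) ⁻¹ ∙ δ ⟩)
        ≈⟨ sum-cong-≋ {order} (λ i → trans (*-congˡ (cong g (flip⁻¹ (from i) δ))) (*-comm _ _)) ⟩
      sum {order} (λ i → g ⟨ from i ⟩ * f ⟨ from i ⁻¹ ∙ δ ⟩)  ∎
      where
      φ : Δ.Carrier → Δ.Carrier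
      φ x = x ⁻¹ ∙ δ
      φ-cong : ∀ {x y} → x Δ.≈ y → φ x Δ.≈ φ y
      φ-cong x≈ = Δ.∙-congʳ (Δ.⁻¹-cong x≈)

    *ᴳ-assoc : ∀ f g h → ((f *ᴳ g) *ᴳ h) ≈ᴳ (f *ᴳ (g *ᴳ h))
    *ᴳ-assoc f g h δ = begin
      sum {order} (λ i → sum {order} (λ j → f ⟨ from j ⟩ * g ⟨ from j ⁻¹ ∙ from i ⟩) * h ⟨ from i ⁻¹ ∙ δ ⟩)
        ≈⟨ sum-cong-≋ {order} (λ i → trans
             (*-distribʳ-sum {order} _ _) (sum-cong-≋ {order} (λ j → *-assoc _ _ _))) ⟩
      sum {order} (λ i → sum {order} (λ j → f ⟨ from j ⟩ * (g ⟨ from j ⁻¹ ∙ from i ⟩ * h ⟨ from i ⁻¹ ∙ δ ⟩)))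
        ≈⟨ ∑-comm {order} {order} _ ⟩
      sum {order} (λ j → sum {order} (λ i → f ⟨ from j ⟩ * (g ⟨ from j ⁻¹ ∙ from i ⟩ * h ⟨ from i ⁻¹ ∙ δ ⟩)))
        ≈⟨ sum-cong-≋ {order} (λ j → sym (*-distribˡ-sum {order} _ _)) ⟩
      sum {order} (λ j → f ⟨ from j ⟩ * sum {order} (λ i → g ⟨ from j ⁻¹ ∙ from i ⟩ * h ⟨ from i ⁻¹ ∙ δ ⟩))
        ≈⟨ sum-cong-≋ {order} (λ j → *-congˡ (inner (from j))) ⟩
      sum {order} (λ j → f ⟨ from j ⟩ * sum {order} (λ i → g ⟨ from i ⟩ * h ⟨ from i ⁻¹ ∙ (from j ⁻¹ ∙ δ) ⟩))  ∎
      where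
      regroup : ∀ y x → (y ∙ x) ⁻¹ ∙ δ Δ.≈ x ⁻¹ ∙ (y ⁻¹ ∙ δ)
      regroup y x = Δ.trans (Δ.∙-congʳ (ΔP.⁻¹-anti-homo-∙ y x)) (Δ.assoc _ _ _)

      inner : ∀ y → sum {order} (λ i → g ⟨ y ⁻¹ ∙ from i ⟩ * h ⟨ from i ⁻¹ ∙ δ ⟩)
                  ≈ sum {order} (λ i → g ⟨ from i ⟩ * h ⟨ from i ⁻¹ ∙ (y ⁻¹ ∙ δ) ⟩)
      inner y = trans
        (reindex (y ∙_) (y ⁻¹ ∙_) Δ.∙-congˡ Δ.∙-congˡ (cancelˡ-⁻¹ y) (⁻¹-cancelˡ y)
                 (λ x → g ⟨ y ⁻¹ ∙ x ⟩ * h ⟨ x ⁻¹ ∙ δ ⟩)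
                 (λ x≈ → *-cong (cong g (Δ.∙-congˡ x≈)) (cong h (Δ.∙-congʳ (Δ.⁻¹-cong x≈)))))
        (sum-cong-≋ {order} (λ i → *-cong (cong g (⁻¹-cancelˡ y (from i))) (cong h (regroup y (from i)))))

    sum-zero : ∀ {n} (t : Vector Carrier n) → (∀ i → t i ≈ 0#) → sum t ≈ 0#
    sum-zero {zero}  t t≈0 = refl
    sum-zero {suc n} t t≈0 =
      trans (+-cong (t≈0 zero) (sum-zero (t ∘ suc) (t≈0 ∘ suc))) (+-identityʳ 0#)

    sum-single : ∀ {n} (t : Vector Carrier n) k → (∀ i → i ≢ k → t i ≈ 0#) → sum t ≈ t k
    sum-single {suc n} t zero    z =
      trans (+-congˡ (sum-zero (t ∘ suc) (λ i → z (suc i) λ ()))) (+-identityʳ _)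
    sum-single {suc n} t (suc k) z =
      trans (+-cong (z zero λ ()) (sum-single (t ∘ suc) k (λ i i≢k → z (suc i) (i≢k ∘ Fin.suc-injective))))
            (+-identityˡ _)

    indicator-yes : ∀ a {i j} (d : Dec (i ≡ j)) → i ≡ j → indicator a d ≈ a
    indicator-yes a (yes _) _ = refl
    indicator-yes a (no ¬q) q = contradiction q ¬q

    indicator-no : ∀ a {i j} (d : Dec (i ≡ j)) → i ≢ j → indicator a d ≈ 0#
    indicator-no a (yes q) ¬q = contradiction q ¬q
    indicator-no a (no _)  _  = refl

    *ᴳ-identityˡ : ∀ f → (scalar 1# *ᴳ f) ≈ᴳ f
    *ᴳ-identityˡ f δ = begin
      sum {order} (λ i → scalar 1# ⟨ from i ⟩ * f ⟨ from i ⁻¹ ∙ δ ⟩)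
        ≈⟨ sum-single {order} (λ i → scalar 1# ⟨ from i ⟩ * f ⟨ from i ⁻¹ ∙ δ ⟩) (to ε)
             (λ i i≢ → trans (*-congʳ (indicator-no 1# (to (from i) Fin.≟ to ε)
                                          (i≢ ∘ ≡.trans (≡.sym (strictlyInverseˡ i)))))
                             (zeroˡ _)) ⟩
      scalar 1# ⟨ from (to ε) ⟩ * f ⟨ from (to ε) ⁻¹ ∙ δ ⟩
        ≈⟨ *-cong (indicator-yes 1# (to (from (to ε)) Fin.≟ to ε) (strictlyInverseˡ (to ε)))
                  (cong f (Δ.trans (Δ.∙-congʳ (Δ.trans (Δ.⁻¹-cong (strictlyInverseʳ ε)) ΔP.ε⁻¹≈ε))
                                   (Δ.identityˡ δ))) ⟩
      1# * f ⟨ δ ⟩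
        ≈⟨ *-identityˡ _ ⟩
      f ⟨ δ ⟩  ∎

  groupRing : CommutativeRing 0ℓ 0ℓ
  groupRing = mkCommutativeRing {_≈_ = _≈ᴳ_} {_+ᴳ_} {_*ᴳ_} {0ᴳ} { -ᴳ_} {scalar 1#}
    (record
      { isGroup = record
        { isMonoid = record
          { isSemigroup = record
            { isMagma = record
              { isEquivalence = record
                { refl  = λ _ → refl
                ; sym   = λ f≈g δ → sym (f≈g δ)
                ; trans = λ f≈g g≈h δ → trans (f≈g δ) (g≈h δ)
                }
              ; ∙-cong = λ f≈ g≈ δ → +-cong (f≈ δ) (g≈ δ)
              }
            ; assoc = λ f g h δ → +-assoc _ _ _
            }
          ; identity = (λ f δ → +-identityˡ _) , (λ f δ → +-identityʳ _)
          }
        ; inverse = (λ f δ → -‿inverseˡ _) , (λ f δ → -‿inverseʳ _)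
        ; ⁻¹-cong = λ f≈ δ → -‿cong (f≈ δ)
        }
      ; comm = λ f g δ → +-comm _ _
      })
    (λ f≈ g≈ δ → sum-cong-≋ {order} (λ i → *-cong (f≈ (from i)) (g≈ (from i ⁻¹ ∙ δ))))
    *ᴳ-assoc
    *ᴳ-comm
    *ᴳ-identityˡ
    (λ h f g δ → trans (sum-cong-≋ {order} (λ i → distribʳ _ _ _)) (∑-distrib-+ {order} _ _))

_[_] : CommutativeRing 0ℓ 0ℓ → {p : ℕ} → FiniteAbelianPGroup p → CommutativeRing 0ℓ 0ℓ
A [ Δ ] = GroupRing.groupRing A Δ

module _ {R : CommutativeRing 0ℓ 0ℓ} where
  open CommutativeRing R using (Carrier; _≈_; 0#; 1#)

  record Hom (A : Module R m₁ ℓ₁) (B : Module R m₂ ℓ₂) : Set (m₁ ⊔ m₂ ⊔ ℓ₁ ⊔ ℓ₂) where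
    private
      module A = Module A
      module B = Module B
    field
      ⟦_⟧            : A.Carrierᴹ → B.Carrierᴹ
      isHomomorphism : IsModuleHomomorphism A.rawModule B.rawModule ⟦_⟧

  open Hom public using (⟦_⟧)

  module _ {A : Module R m₁ ℓ₁} {B : Module R m₂ ℓ₂} where
    private
      module A = Module A
      module B = Module B

    IsInjective : Hom A B → Set (m₁ ⊔ ℓ₁ ⊔ ℓ₂)
    IsInjective f = Injective A._≈ᴹ_ B._≈ᴹ_ ⟦ f ⟧

    IsSurjective : Hom A B → Set (m₁ ⊔ m₂ ⊔ ℓ₁ ⊔ ℓ₂)
    IsSurjective f = Surjective A._≈ᴹ_ B._≈ᴹ_ ⟦ f ⟧

    IsExact : ∀ {m₃ ℓ₃} {C : Module R m₃ ℓ₃} → Hom A B → Hom B C → Set (m₁ ⊔ m₂ ⊔ ℓ₂ ⊔ ℓ₃)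
    IsExact {C = C} f g = ∀ y → (⟦ g ⟧ y C.≈ᴹ C.0ᴹ) ⇔ (∃[ x ] ⟦ f ⟧ x B.≈ᴹ y)
      where module C = Module C

  -- chain N P M is the family N, P₁, …, Pₙ, M.
  chain : ∀ {a} {A : Set a} {n} → A → Vector A n → A → Vector A (2 ℕ.+ n)
  chain {n = n} N P M = N ∷ insertAt P (fromℕ n) M

  -- 0 → N → P₁ → ⋯ → Pₙ → M → 0.  Exactness at Pᵢ₊₁ is exact i; for n = 0 the
  -- single map N → M is both injective and surjective.
  record ExactSequence {ℓ n} (N : Module R ℓ ℓ) (P : Vector (Module R ℓ ℓ) n) (M : Module R ℓ ℓ)
         : Set ℓ where
    field
      d          : (i : Fin (suc n)) → Hom (chain N P M (inject₁ i)) (chain N P M (suc i))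
      injective  : IsInjective (d zero)
      exact      : (i : Fin n) → IsExact (d (inject₁ i)) (d (suc i))
      surjective : IsSurjective (d (fromℕ n))

  IsProjective : ∀ {ℓ} → Module R ℓ ℓ → Set (lsuc ℓ)
  IsProjective {ℓ} P =
    {A B : Module R ℓ ℓ} (g : Hom A B) → IsSurjective g → (f : Hom P B) →
    Σ[ f̂ ∈ Hom P A ] (∀ x → Module._≈ᴹ_ B (⟦ g ⟧ (⟦ f̂ ⟧ x)) (⟦ f ⟧ x))

  -- pd M ≤ d: there is a resolution 0 → Q_d → Q_{d-1} → ⋯ → Q₀ → M → 0 by
  -- projectives, with Q_d = K here.
  ProjectiveDimension≤ : ∀ {ℓ} → ℕ → Module R ℓ ℓ → Set (lsuc ℓ)
  ProjectiveDimension≤ {ℓ} d M =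
    Σ[ K ∈ Module R ℓ ℓ ] Σ[ Q ∈ Vector (Module R ℓ ℓ) d ]
      IsProjective K × (∀ i → IsProjective (Q i)) × ExactSequence K Q M

  Matrix : ℕ → ℕ → Set
  Matrix a b = Fin a → Fin b → Carrier

  -- Laplace expansion along the first row.
  det : ∀ {n} → Matrix n n → Carrier
  det {zero}  A = 1#
  det {suc n} A = sum (λ j → (sign j * A zero j) * det (λ i k → A (suc i) (punchIn j k)))
    where
    open CommutativeRing R using (_*_; -_; semiring)
    open Sum semiring using (sum)
    open Exp semiring using (_^_)
    sign : Fin (suc n) → Carrier
    sign j = (- 1#) ^ toℕ j

infixl 10 _^ᴹ_
_^ᴹ_ : (R : CommutativeRing 0ℓ 0ℓ) → ℕ → Module R 0ℓ 0ℓ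
R ^ᴹ a = record
  { Carrierᴹ = Vector Carrier a
  ; _*ₗ_ = λ r v i → r * v i
  ; isModule = IsModuleFromLeft.isModule (record { isLeftModule = isLeftModule })
  }
  where
  open CommutativeRing R hiding (zero)
  module V = AbelianGroup (Pointwise.abelianGroup (Fin a) +-abelianGroup)

  isLeftModule : IsLeftModule ring V._≈_ V._∙_ V.ε V._⁻¹ (λ r v i → r * v i)
  isLeftModule = record
    { isLeftSemimodule = record
      { +ᴹ-isCommutativeMonoid = V.isCommutativeMonoid
      ; isPreleftSemimodule = record
        { *ₗ-cong      = λ r≈ v≈ i → *-cong r≈ (v≈ i)
        ; *ₗ-zeroˡ     = λ v i → zeroˡ (v i)
        ; *ₗ-distribʳ  = λ v r s i → distribʳ (v i) r s
        ; *ₗ-identityˡ = λ v i → *-identityˡ (v i)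
        ; *ₗ-assoc     = λ r s v i → *-assoc r s (v i)
        ; *ₗ-zeroʳ     = λ r i → zeroʳ r
        ; *ₗ-distribˡ  = λ r v w i → distribˡ r (v i) (w i)
        }
      }
    ; -ᴹ‿cong    = V.⁻¹-cong
    ; -ᴹ‿inverse = V.inverse
    }

module _ {R : CommutativeRing 0ℓ 0ℓ} where
  open CommutativeRing R using (Carrier; 0#; 1#)

  basis : ∀ {a} → Fin a → Vector Carrier a
  basis i j with i Fin.≟ j
  ... | yes _ = 1#
  ... | no _  = 0#

  toMatrix : ∀ {a b} → Hom (R ^ᴹ b) (R ^ᴹ a) → Matrix {R = R} a b
  toMatrix h i j = ⟦ h ⟧ (basis j) i

  IsFinitelyGenerated : ∀ {ℓ} → Module R ℓ ℓ → Set ℓ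
  IsFinitelyGenerated M = ∃[ a ] Σ[ π ∈ Hom (R ^ᴹ a) M ] IsSurjective π

  record Presentation {ℓ} (M : Module R ℓ ℓ) : Set ℓ where
    field
      {a b}      : ℕ
      h          : Hom (R ^ᴹ b) (R ^ᴹ a)
      π          : Hom (R ^ᴹ a) M
      exact      : IsExact h π
      surjective : IsSurjective π

module _ {R : CommutativeRing 0ℓ 0ℓ} (M : Module R 0ℓ 0ℓ) where
  open Module M

  record Submodule : Set₁ where
    field
      Member    : Pred Carrierᴹ 0ℓ
      resp      : ∀ {x y} → x ≈ᴹ y → Member x → Member y
      0-closed  : Member 0ᴹ
      +-closed  : ∀ {x y} → Member x → Member y → Member (x +ᴹ y)
      *ₗ-closed : ∀ r {x} → Member x → Member (r *ₗ x)

  data Span (S : Pred Carrierᴹ 0ℓ) : Pred Carrierᴹ 0ℓ where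
    span-gen   : ∀ {x} → S x → Span S x
    span-resp  : ∀ {x y} → x ≈ᴹ y → Span S x → Span S y
    span-0     : Span S 0ᴹ
    span-+     : ∀ {x y} → Span S x → Span S y → Span S (x +ᴹ y)
    span-*ₗ    : ∀ r {x} → Span S x → Span S (r *ₗ x)

  span : Pred Carrierᴹ 0ℓ → Submodule
  span S = record
    { Member    = Span S
    ; resp      = span-resp
    ; 0-closed  = span-0
    ; +-closed  = span-+
    ; *ₗ-closed = span-*ₗ
    }

infix 4 _∈ₛ_ _≐ₛ_

_∈ₛ_ : {R : CommutativeRing 0ℓ 0ℓ} {M : Module R 0ℓ 0ℓ} → Module.Carrierᴹ M → Submodule M → Set
x ∈ₛ I = Submodule.Member I x

_≐ₛ_ : {R : CommutativeRing 0ℓ 0ℓ} {M : Module R 0ℓ 0ℓ} → Rel (Submodule M) 0ℓ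
I ≐ₛ J = ∀ x → (x ∈ₛ I) ⇔ (x ∈ₛ J)

Ideal : CommutativeRing 0ℓ 0ℓ → Set₁
Ideal R = Submodule (TensorUnit.⟨module⟩ {R = R})

-- The ideal of maximal minors of h; a minor is a choice of a of the b columns.
FittingIdeal : {R : CommutativeRing 0ℓ 0ℓ} {ℓ : Level} {M : Module R ℓ ℓ} →
               Presentation M → Ideal R
FittingIdeal {R} pres = span _ IsMinor
  where
  open Presentation pres
  open CommutativeRing R using (Carrier; _≈_)
  IsMinor : Pred Carrier 0ℓ
  IsMinor r = Σ[ c ∈ (Fin a → Fin b) ] c Preserves Fin._<_ ⟶ Fin._<_
                × r ≈ det {R = R} (λ i j → toMatrix h i (c j))

module Fractions (R : CommutativeRing 0ℓ 0ℓ) where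
  open CommutativeRing R hiding (zero)
  open RingProperties ring using (-‿distribˡ-*; -‿distribʳ-*)
  open SetoidReasoning setoid
  private
    module Id = RingIdentities R

  IsRegular : Carrier → Set
  IsRegular s = ∀ r → s * r ≈ 0# → r ≈ 0#

  private
    *-regular : ∀ {s t} → IsRegular s → IsRegular t → IsRegular (s * t)
    *-regular s-reg t-reg r str≈0 =
      t-reg r (s-reg _ (trans (sym (*-assoc _ _ _)) str≈0))

    1-regular : IsRegular 1#
    1-regular r 1r≈0 = trans (sym (*-identityˡ r)) 1r≈0

    cancel : ∀ {s} → IsRegular s → ∀ x y → s * x ≈ s * y → x ≈ y
    cancel {s} s-reg x y sx≈sy = begin
      x              ≈⟨ lem₁ x y ⟩
      (x + - y) + y  ≈⟨ +-congʳ (s-reg (x + - y) s[x-y]≈0) ⟩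
      0# + y         ≈⟨ +-identityˡ y ⟩
      y              ∎
      where
      lem₁ : ∀ x y → x ≈ (x + - y) + y
      lem₁ x y = sym (trans (+-assoc x (- y) y) (trans (+-congˡ (-‿inverseˡ y)) (+-identityʳ x)))
      s[x-y]≈0 : s * (x + - y) ≈ 0#
      s[x-y]≈0 = begin
        s * (x + - y)        ≈⟨ distribˡ s x (- y) ⟩
        s * x + s * (- y)    ≈⟨ +-cong sx≈sy (sym (-‿distribʳ-* s y)) ⟩
        s * y + - (s * y)    ≈⟨ -‿inverseʳ (s * y) ⟩
        0#                   ∎

  record Fraction : Set where
    constructor fraction
    field
      num     : Carrier
      den     : Carrier
      regular : IsRegular den

  open Fraction public

  _≈Q_ : Rel Fraction 0ℓ
  x ≈Q y = num x * den y ≈ num y * den x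

  _+Q_ _*Q_ : Fraction → Fraction → Fraction
  x +Q y = fraction (num x * den y + num y * den x) (den x * den y) (*-regular (regular x) (regular y))
  x *Q y = fraction (num x * num y) (den x * den y) (*-regular (regular x) (regular y))

  -Q_ : Fraction → Fraction
  -Q x = fraction (- num x) (den x) (regular x)

  ι : Carrier → Fraction
  ι r = fraction r 1# 1-regular

  private
    ≈Q-isEquivalence : IsEquivalence _≈Q_
    ≈Q-isEquivalence = record
      { refl  = refl
      ; sym   = sym
      ; trans = λ {x} {y} {z} x≈y y≈z → cancel (regular y) _ _ (begin
          den y * (num x * den z)  ≈⟨ Id.swap _ _ _ ⟩
          (num x * den y) * den z  ≈⟨ *-congʳ x≈y ⟩
          (num y * den x) * den z  ≈⟨ Id.swap′ _ _ _ ⟩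
          (num y * den z) * den x  ≈⟨ *-congʳ y≈z ⟩
          (num z * den y) * den x  ≈⟨ Id.swap″ _ _ _ ⟩
          den y * (num z * den x)  ∎)
      }

    +Q-cong : ∀ {x y u v} → x ≈Q y → u ≈Q v → (x +Q u) ≈Q (y +Q v)
    +Q-cong {x} {y} {u} {v} x≈y u≈v = begin
      (num x * den u + num u * den x) * (den y * den v)
        ≈⟨ Id.+-frac _ _ _ _ _ _ ⟩
      (num x * den y) * (den u * den v) + (num u * den v) * (den x * den y)
        ≈⟨ +-cong (*-congʳ x≈y) (*-congʳ u≈v) ⟩
      (num y * den x) * (den u * den v) + (num v * den u) * (den x * den y)
        ≈⟨ Id.+-frac′ _ _ _ _ _ _ ⟩
      (num y * den v + num v * den y) * (den x * den u)  ∎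

    *Q-cong : ∀ {x y u v} → x ≈Q y → u ≈Q v → (x *Q u) ≈Q (y *Q v)
    *Q-cong {x} {y} {u} {v} x≈y u≈v =
      trans (Id.interchange _ _ _ _) (trans (*-cong x≈y u≈v) (Id.interchange _ _ _ _))

    -Q-cong : ∀ {x y} → x ≈Q y → (-Q x) ≈Q (-Q y)
    -Q-cong x≈y = trans (sym (-‿distribˡ-* _ _)) (trans (-‿cong x≈y) (-‿distribˡ-* _ _))

    +Q-inverseˡ : ∀ a b → ((- a) * b + a * b) * 1# ≈ 0# * (b * b)
    +Q-inverseˡ a b = trans (*-identityʳ _) (trans (sym (distribʳ b (- a) a))
      (trans (*-congʳ (-‿inverseˡ a)) (trans (zeroˡ b) (sym (zeroˡ (b * b))))))

    +Q-inverseʳ : ∀ a b → (a * b + (- a) * b) * 1# ≈ 0# * (b * b)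
    +Q-inverseʳ a b = trans (*-congʳ (+-comm _ _)) (+Q-inverseˡ a b)

  Q : CommutativeRing 0ℓ 0ℓ
  Q = mkCommutativeRing {_≈_ = _≈Q_} {_+Q_} {_*Q_} {ι 0#} { -Q_} {ι 1#}
    (record
      { isGroup = record
        { isMonoid = record
          { isSemigroup = record
            { isMagma = record
              { isEquivalence = ≈Q-isEquivalence
              ; ∙-cong = λ {x} {y} {u} {v} → +Q-cong {x} {y} {u} {v}
              }
            ; assoc = λ x y z → Id.+Q-assoc (num x) (num y) (den x) (den y) (num z) (den z)
            }
          ; identity = (λ x → Id.+Q-identityˡ (num x) (den x))
                     , (λ x → Id.+Q-identityʳ (num x) (den x))
          }
        ; inverse = (λ x → +Q-inverseˡ (num x) (den x)) , (λ x → +Q-inverseʳ (num x) (den x))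
        ; ⁻¹-cong = λ {x} {y} → -Q-cong {x} {y}
        }
      ; comm = λ x y → Id.+Q-comm (num x) (num y) (den x) (den y)
      })
    (λ {x} {y} {u} {v} → *Q-cong {x} {y} {u} {v})
    (λ x y z → Id.*Q-assoc (num x) (num y) (num z) (den x) (den y) (den z))
    (λ x y → Id.*Q-comm (num x) (num y) (den x) (den y))
    (λ x → Id.*Q-identityˡ (num x) (den x))
    (λ x y z → Id.*Q-distribʳ (num x) (num y) (num z) (den x) (den y) (den z))

  private
    module Q = CommutativeRing Q

    ι-+ : ∀ r s → ι (r + s) Q.≈ ι r Q.+ ι s
    ι-+ = Id.ι-+

    ι-* : ∀ r s → ι (r * s) Q.≈ ι r Q.* ι s
    ι-* = Id.ι-*

    isLeftModule : IsLeftModule ring Q._≈_ Q._+_ Q.0# Q.-_ (λ r x → ι r Q.* x)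
    isLeftModule = record
      { isLeftSemimodule = record
        { +ᴹ-isCommutativeMonoid = Q.+-isCommutativeMonoid
        ; isPreleftSemimodule = record
          { *ₗ-cong      = λ {r} {s} {x} {y} r≈s x≈y →
                             Q.*-cong {ι r} {ι s} {x} {y} (*-congʳ r≈s) x≈y
          ; *ₗ-zeroˡ     = λ x → Q.zeroˡ x
          ; *ₗ-distribʳ  = λ x r s →
              Q.trans {ι (r + s) Q.* x} {(ι r Q.+ ι s) Q.* x} {(ι r Q.* x) Q.+ (ι s Q.* x)}
                (Q.*-congʳ {x} {ι (r + s)} {ι r Q.+ ι s} (ι-+ r s)) (Q.distribʳ x (ι r) (ι s))
          ; *ₗ-identityˡ = λ x → Q.*-identityˡ x
          ; *ₗ-assoc     = λ r s x →
              Q.trans {ι (r * s) Q.* x} {(ι r Q.* ι s) Q.* x} {ι r Q.* (ι s Q.* x)}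
                (Q.*-congʳ {x} {ι (r * s)} {ι r Q.* ι s} (ι-* r s)) (Q.*-assoc (ι r) (ι s) x)
          ; *ₗ-zeroʳ     = λ r → Q.zeroʳ (ι r)
          ; *ₗ-distribˡ  = λ r x y → Q.distribˡ (ι r) x y
          }
        }
      ; -ᴹ‿cong    = λ {x} {y} → Q.-‿cong {x} {y}
      ; -ᴹ‿inverse = Q.-‿inverse
      }

  Q-module : Module R 0ℓ 0ℓ
  Q-module = record
    { isModule = IsModuleFromLeft.isModule (record { isLeftModule = isLeftModule }) }

  -- R-submodules of Q(R), with the operations of fractional ideals.  Finite
  -- generation is not recorded: the inverse I⁻¹ = (R : I) is finitely generated
  -- when I is invertible.
  FractionalIdeal : Set₁
  FractionalIdeal = Submodule Q-module

  infixl 7 _·_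
  infixr 8 _^_

  extend : Ideal R → FractionalIdeal
  extend I = span Q-module (λ x → ∃[ r ] (r ∈ₛ I) × x Q.≈ ι r)

  𝟙 : FractionalIdeal
  𝟙 = span Q-module (λ x → x Q.≈ Q.1#)

  _·_ : FractionalIdeal → FractionalIdeal → FractionalIdeal
  I · J = span Q-module (λ z → ∃[ x ] ∃[ y ] (x ∈ₛ I) × (y ∈ₛ J) × z Q.≈ x Q.* y)

  -- For invertible I this is the unique J with I · J ≐ₛ 𝟙.
  _⁻¹ : FractionalIdeal → FractionalIdeal
  I ⁻¹ = record
    { Member    = λ x → ∀ y → y ∈ₛ I → (x Q.* y) ∈ₛ 𝟙
    ; resp      = λ {x} {x′} x≈x′ x∈ y y∈ →
        𝟙.resp {x Q.* y} {x′ Q.* y} (Q.*-congʳ {y} {x} {x′} x≈x′) (x∈ y y∈)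
    ; 0-closed  = λ y _ → 𝟙.resp {Q.0#} {Q.0# Q.* y} (Q.sym {Q.0# Q.* y} {Q.0#} (Q.zeroˡ y)) 𝟙.0-closed
    ; +-closed  = λ {x} {x′} x∈ x′∈ y y∈ →
        𝟙.resp {(x Q.* y) Q.+ (x′ Q.* y)} {(x Q.+ x′) Q.* y}
          (Q.sym {(x Q.+ x′) Q.* y} {(x Q.* y) Q.+ (x′ Q.* y)} (Q.distribʳ y x x′))
          (𝟙.+-closed (x∈ y y∈) (x′∈ y y∈))
    ; *ₗ-closed = λ r {x} x∈ y y∈ →
        𝟙.resp {ι r Q.* (x Q.* y)} {(ι r Q.* x) Q.* y}
          (Q.sym {(ι r Q.* x) Q.* y} {ι r Q.* (x Q.* y)} (Q.*-assoc (ι r) x y))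
          (𝟙.*ₗ-closed r (x∈ y y∈))
    }
    where module 𝟙 = Submodule 𝟙

  _^ⁿ_ : FractionalIdeal → ℕ → FractionalIdeal
  I ^ⁿ zero  = 𝟙
  I ^ⁿ suc k = I · (I ^ⁿ k)

  _^_ : FractionalIdeal → ℤ → FractionalIdeal
  I ^ (+ k)      = I ^ⁿ k
  I ^ (-[1+ k ]) = (I ⁻¹) ^ⁿ suc k

  ∏ : ∀ {n} → Vector FractionalIdeal n → FractionalIdeal
  ∏ = foldr _·_ 𝟙

module _ {R : CommutativeRing 0ℓ 0ℓ} where

  -- Torsion over A, for an R-module M regarded as an A-module along ι : A → R.
  IsTorsionAlong : ∀ {ℓ} (A : CommutativeRing 0ℓ 0ℓ) →
                   (CommutativeRing.Carrier A → CommutativeRing.Carrier R) →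
                   Module R ℓ ℓ → Set ℓ
  IsTorsionAlong A ι M = ∀ x → ∃[ a ] ¬ (a ≈ 0#) × (ι a *ₗ x ≈ᴹ 0ᴹ)
    where
    open CommutativeRing A using (_≈_; 0#)
    open Module M using (_*ₗ_; _≈ᴹ_; 0ᴹ)

  record Resolution {ℓ} (IsTorsion : Module R ℓ ℓ → Set ℓ) (n : ℕ) (M : Module R ℓ ℓ)
         : Set (lsuc ℓ) where
    field
      N         : Module R ℓ ℓ
      P         : Vector (Module R ℓ ℓ) n
      sequence  : ExactSequence N P M
      N-fg      : IsFinitelyGenerated N
      N-torsion : IsTorsion N
      P-fg      : ∀ i → IsFinitelyGenerated (P i)
      P-torsion : ∀ i → IsTorsion (P i)
      P-pd≤1    : ∀ i → ProjectiveDimension≤ 1 (P i)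

  module _ {ℓ : Level} {IsTorsion : Module R ℓ ℓ → Set ℓ} {n : ℕ} {M : Module R ℓ ℓ} where

    -- The presentations from which the Fitting ideals are computed.  Over a
    -- Noetherian R they exist classically for finitely generated modules, but
    -- constructively they are data.
    record Presentations (S : Resolution IsTorsion n M) : Set ℓ where
      open Resolution S
      field
        presN : Presentation N
        presP : ∀ i → Presentation (P i)

    open Fractions R

    -- Vectors are indexed from 0, so P i is the module P_{i+1}.
    𝓕 : (S : Resolution IsTorsion n M) → Presentations S → FractionalIdeal
    𝓕 S pres =
      ∏ (λ i → extend (FittingIdeal (presP i)) ^ (-1ℤ ℤ.^ suc (toℕ i)))
        · extend (FittingIdeal presN)
      where open Presentations pres

-- The Iwasawa algebra ℤₚ⟦G⟧ for G ≅ ℤₚ × Δ, in its description as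
-- ℤₚ⟦T⟧[Δ] by the choice of a topological generator γ = 1 + T of ℤₚ.
module Iwasawa {p : ℕ} (Δ : FiniteAbelianPGroup p) where

  Λ R : CommutativeRing 0ℓ 0ℓ
  Λ = ℤₚ-ring p ⟦T⟧
  R = Λ [ Δ ]

  IsTorsion : ∀ {ℓ} → Module R ℓ ℓ → Set ℓ
  IsTorsion = IsTorsionAlong {R = R} Λ (GroupRing.scalar Λ Δ)

{-# OPTIONS --safe #-}
-- Over an arbitrary commutative ring R, a torsion module P with pd P ≤ 1 that is
-- killed by a regular d is coker h for a matrix factorisation h S = d, S h ∈ (d).
--
-- If 0 → M′ → M → P → 0 is exact with such a P, then Fitt(M) = Fitt(M′) Fitt(P): as
-- the relation module of P is projective, its elements u lift linearly to relations
-- (β u , u) of M, and β is given by a matrix with denominator d, so a row operation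
-- over Q(R) turns the maximal minors of M into those of M′ ⊕ P.  The case
-- 0 → Z → (R/d)ᵃ → P → 0 shows that Fitt(P) is invertible.
--
-- Now fix d killing all terms of both sequences, a generating map Rᶜ → M, and let
-- Z be the kernel of (R/d)ᶜ → M.  A sequence … → Pₙ₋₁ → Pₙ → M of length n yields
-- a sequence … → P̃ → Z of length n − 1 with P̃ = ker (Pₙ₋₁ ⊕ (R/d)ᶜ → Pₙ), and the
-- two fractional ideals differ by Fitt((R/d)ᶜ)^±¹.  Since Z and this factor do not
-- depend on the sequence, induction on n reduces the theorem to n = 0, that is, to
-- Fitt being independent of the presentation.
--
-- Determinants are handled as alternating forms F : (Rⁿ)ᵐ → R, all of which, for
-- m = n, are multiples of det.
module Submission where

open import Defs hiding (det)
open import Algebra.Bundles using (CommutativeRing; CommutativeMonoid; AbelianGroup; RawRing)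
import Algebra.Module.Morphism.ModuleMonomorphism as ModuleMonomorphism
open import Algebra.Module.Bundles using (Module)
open import Algebra.Module.Bundles.Raw using (RawModule)
open import Algebra.Module.Morphism.Structures using (IsModuleHomomorphism; IsModuleMonomorphism)
open import Algebra.Module.Structures using (IsModule)
import Algebra.Properties.AbelianGroup as AbelianGroupProperties
import Algebra.Properties.CommutativeSemigroup as CommutativeSemigroupProperties
import Algebra.Properties.Ring as RingProperties
import Algebra.Properties.Semiring.Exp as Exp
import Algebra.Properties.Semiring.Mult as Mult
import Algebra.Properties.Semiring.Sum as Sum
import Algebra.Solver.CommutativeMonoid as CommutativeMonoidSolver
import Algebra.Solver.Ring as RingSolver
open import Algebra.Solver.Ring.AlmostCommutativeRing
  using (AlmostCommutativeRing; _-Raw-AlmostCommutative⟶_)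
import Algebra.Solver.Ring.NaturalCoefficients.Default as NaturalSolver
open import Data.Fin.Base as Fin
  using (Fin; zero; suc; toℕ; fromℕ<; punchIn; _↑ˡ_; _↑ʳ_; splitAt)
import Data.Fin.Properties as Fin
open import Data.Integer.Base as ℤ using (ℤ; +_; -[1+_]; -1ℤ; 1ℤ)
open import Data.Integer.Divisibility.Signed as ℤ∣ using (_∣_; divides)
import Data.Integer.Properties as ℤ
import Data.Integer.Solver as ℤSolver
open import Data.Maybe.Base using (Maybe; just; nothing)
open import Data.Nat.Base as ℕ using (ℕ; zero; suc; z≤n; s≤s; NonZero)
import Data.Nat.Divisibility as ℕ∣
open import Data.Nat.Induction using (<-rec)
open import Data.Nat.Primality using (Prime; euclidsLemma; prime⇒nonZero)
import Data.Nat.Properties as ℕ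
import Data.Nat.Solver as ℕSolver
open import Data.Product.Base using (Σ-syntax; ∃-syntax; _×_; _,_; proj₁; proj₂)
open import Data.Sum.Base using (_⊎_; inj₁; inj₂; [_,_]′)
open import Data.Unit.Base using (⊤)
open import Data.Vec.Base as Vec using (Vec; []; _∷_; map; lookup; tabulate; _++_; cast)
import Data.Vec.Properties as Vec
open import Data.Vec.Functional using (Vector; foldr)
open import Data.Vec.Relation.Binary.Pointwise.Inductive as Pointwise using (Pointwise; []; _∷_)
open import Data.Vec.Relation.Unary.All as All using (All; []; _∷_)
open import Function.Base using (_∘_)
open import Function.Bundles using (Func; Inverse; Equivalence; mk⇔)
open import Level using (Level; 0ℓ; _⊔_; Lift; lift; lower) renaming (suc to lsuc)
open import Relation.Binary.Core using (_Preserves_⟶_)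
open import Relation.Binary.Definitions using (tri<; tri≈; tri>)
open import Relation.Binary.PropositionalEquality as ≡ using (_≡_; _≢_)
import Relation.Binary.Reasoning.Setoid as SetoidReasoning
open import Relation.Nullary using (¬_; yes; no; contradiction)
open import Relation.Nullary.Decidable using (decidable-stable)

-- Fitting ideals are not multiplicative in general short exact sequences; the condition pd P ≤ 1 on
-- the quotient is what saves the formula. The images inside a sequence (∗) satisfy no such bound,
-- so (∗) cannot be cut into short exact pieces whose Fitting ideals multiply. Only its right end is
-- accessible: for n ≥ 1 the module M is a quotient of Pₙ, hence killed by d, so (R/d)ᶜ → M is one
-- surjection from a module with pd ≤ 1 against which every sequence can be compared. The kernel P̃
-- is again killed by d and of pd ≤ 1, because the relations of Pₙ are projective; this keeps the
-- induction inside one class of modules.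
--
-- A projective relation module need not be free, so P comes without a square matrix whose
-- determinant generates Fitt(P). The matrix factorisation replaces it: it is finite data, it
-- records projectivity as an explicit section S / d, and explicit formulas carry it over to P̃.
-- Regularity of d makes S / d well defined and lets determinants be compared after multiplication
-- by powers of d.

-- A solver for arbitrary commutative rings: the coefficient (a , b) stands for a − b.
module Solver (R : CommutativeRing 0ℓ 0ℓ) where
  open CommutativeRing R
  open RingProperties ring
  open Mult semiring using (×-homo-+; ×1-homo-*) renaming (_×_ to _×ₙ_)
  open SetoidReasoning setoid

  private
    almostCommutativeRing : AlmostCommutativeRing 0ℓ 0ℓ
    almostCommutativeRing = record
      { isAlmostCommutativeRing = record
        { isCommutativeSemiring = isCommutativeSemiring
        ; -‿cong      = -‿cong
        ; -‿*-distribˡ = λ x y → sym (-‿distribˡ-* x y)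
        ; -‿+-comm    = -‿+-comm
        }
      }

    differences : RawRing 0ℓ 0ℓ
    differences = record
      { Carrier = ℕ × ℕ
      ; _≈_ = _≡_
      ; _+_ = λ (a , b) (c , d) → a ℕ.+ c , b ℕ.+ d
      ; _*_ = λ (a , b) (c , d) → a ℕ.* c ℕ.+ b ℕ.* d , a ℕ.* d ℕ.+ b ℕ.* c
      ; -_  = λ (a , b) → b , a
      ; 0#  = 0 , 0
      ; 1#  = 1 , 0
      }

    open RawRing differences using () renaming (_+_ to _+ᵈ_; _*_ to _*ᵈ_)

    ν : ℕ → Carrier
    ν n = n ×ₙ 1#

    ⟦_⟧ᵈ : ℕ × ℕ → Carrier
    ⟦ a , b ⟧ᵈ = ν a + - ν b

    -- Zero and one are read as 0# and 1# on the nose, so that they can occur in goals.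
    ⟦_⟧ᶜ : ℕ × ℕ → Carrier
    ⟦ 0 , 0 ⟧ᶜ = 0#
    ⟦ 1 , 0 ⟧ᶜ = 1#
    ⟦ x     ⟧ᶜ = ⟦ x ⟧ᵈ

    canonical : ∀ x → ⟦ x ⟧ᶜ ≈ ⟦ x ⟧ᵈ
    canonical (0 , 0)           = sym (-‿inverseʳ 0#)
    canonical (1 , 0)           = sym (trans (+-cong (+-identityʳ 1#) -0#≈0#) (+-identityʳ 1#))
    canonical (suc (suc _) , 0) = refl
    canonical (0 , suc _)       = refl
    canonical (1 , suc _)       = refl
    canonical (suc (suc _) , suc _) = refl

    open NaturalSolver commutativeSemiring using (solve; _:+_; _:*_; _:=_)

    regroup : ∀ a b c d → (a + b) + (c + d) ≈ (a + c) + (b + d)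
    regroup = solve 4 (λ a b c d → (a :+ b) :+ (c :+ d) := (a :+ c) :+ (b :+ d)) refl

    regroup′ : ∀ a b c d → (a + b) + (c + d) ≈ (a + d) + (b + c)
    regroup′ = solve 4 (λ a b c d → (a :+ b) :+ (c :+ d) := (a :+ d) :+ (b :+ c)) refl

    +-homo : ∀ x y → ⟦ x +ᵈ y ⟧ᵈ ≈ ⟦ x ⟧ᵈ + ⟦ y ⟧ᵈ
    +-homo (a , b) (c , d) = begin
      ν (a ℕ.+ c) + - ν (b ℕ.+ d)      ≈⟨ +-cong (×-homo-+ 1# a c) (-‿cong (×-homo-+ 1# b d)) ⟩
      (ν a + ν c) + - (ν b + ν d)      ≈⟨ +-congˡ (sym (-‿+-comm _ _)) ⟩
      (ν a + ν c) + (- ν b + - ν d)    ≈⟨ regroup _ _ _ _ ⟩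
      ⟦ a , b ⟧ᵈ + ⟦ c , d ⟧ᵈ          ∎

    ν-** : ∀ a b c d → ν (a ℕ.* b ℕ.+ c ℕ.* d) ≈ ν a * ν b + ν c * ν d
    ν-** a b c d = trans (×-homo-+ 1# (a ℕ.* b) (c ℕ.* d)) (+-cong (×1-homo-* a b) (×1-homo-* c d))

    *-homo : ∀ x y → ⟦ x *ᵈ y ⟧ᵈ ≈ ⟦ x ⟧ᵈ * ⟦ y ⟧ᵈ
    *-homo (a , b) (c , d) = sym (begin
      (ν a + - ν b) * (ν c + - ν d)
        ≈⟨ trans (distribʳ _ _ _) (+-cong (distribˡ _ _ _) (distribˡ _ _ _)) ⟩
      (ν a * ν c + ν a * - ν d) + (- ν b * ν c + - ν b * - ν d)
        ≈⟨ +-cong (+-congˡ (sym (-‿distribʳ-* _ _))) (+-cong (sym (-‿distribˡ-* _ _)) (-x*-y≈x*y _ _)) ⟩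
      (ν a * ν c + - (ν a * ν d)) + (- (ν b * ν c) + ν b * ν d)
        ≈⟨ regroup′ _ _ _ _ ⟩
      (ν a * ν c + ν b * ν d) + (- (ν a * ν d) + - (ν b * ν c))
        ≈⟨ +-cong (sym (ν-** a c b d)) (trans (-‿+-comm _ _) (-‿cong (sym (ν-** a d b c)))) ⟩
      ν (a ℕ.* c ℕ.+ b ℕ.* d) + - ν (a ℕ.* d ℕ.+ b ℕ.* c) ∎)
      where
      -x*-y≈x*y : ∀ x y → - x * - y ≈ x * y
      -x*-y≈x*y x y = begin
        - x * - y      ≈⟨ sym (-‿distribˡ-* _ _) ⟩
        - (x * - y)    ≈⟨ -‿cong (sym (-‿distribʳ-* _ _)) ⟩
        - - (x * y)    ≈⟨ -‿involutive _ ⟩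
        x * y          ∎

    morphism : differences -Raw-AlmostCommutative⟶ almostCommutativeRing
    morphism = record
      { ⟦_⟧    = ⟦_⟧ᶜ
      ; +-homo = λ x y → trans (canonical (x +ᵈ y))
          (trans (+-homo x y) (sym (+-cong (canonical x) (canonical y))))
      ; *-homo = λ x y → trans (canonical (x *ᵈ y))
          (trans (*-homo x y) (sym (*-cong (canonical x) (canonical y))))
      ; -‿homo = λ x@(a , b) → begin
          ⟦ b , a ⟧ᶜ        ≈⟨ canonical (b , a) ⟩
          ν b + - ν a       ≈⟨ +-comm _ _ ⟩
          - ν a + ν b       ≈⟨ +-congˡ (sym (-‿involutive _)) ⟩
          - ν a + - - ν b   ≈⟨ -‿+-comm _ _ ⟩
          - (ν a + - ν b)   ≈⟨ -‿cong (sym (canonical x)) ⟩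
          - ⟦ a , b ⟧ᶜ      ∎
      ; 0-homo = refl
      ; 1-homo = refl
      }

    difference≟ : ∀ x y → Maybe (⟦ x ⟧ᶜ ≈ ⟦ y ⟧ᶜ)
    difference≟ (a , b) (c , d) with a ℕ.+ d ℕ.≟ c ℕ.+ b
    ... | no _  = nothing
    ... | yes q = just (begin
      ⟦ a , b ⟧ᶜ                       ≈⟨ canonical (a , b) ⟩
      ν a + - ν b                      ≈⟨ lem (ν a) (ν b) (ν d) ⟩
      (ν a + ν d) + (- ν b + - ν d)    ≈⟨ +-congʳ (trans (sym (×-homo-+ 1# a d))
                                            (trans (reflexive (≡.cong ν q)) (×-homo-+ 1# c b))) ⟩
      (ν c + ν b) + (- ν b + - ν d)    ≈⟨ lem′ (ν c) (ν b) (ν d) ⟩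
      ν c + - ν d                      ≈⟨ sym (canonical (c , d)) ⟩
      ⟦ c , d ⟧ᶜ                       ∎)
      where
      lem : ∀ x y z → x + - y ≈ (x + z) + (- y + - z)
      lem x y z = trans (trans (sym (+-identityʳ _)) (+-congˡ (sym (-‿inverseʳ z)))) (regroup _ _ _ _)
      lem′ : ∀ x y z → (x + y) + (- y + - z) ≈ x + - z
      lem′ x y z = trans (regroup′ _ _ _ _) (trans (+-congˡ (-‿inverseʳ y)) (+-identityʳ _))

  open RingSolver differences almostCommutativeRing morphism difference≟ public
    using (solve; Polynomial; con; _:+_; _:*_; _:-_; :-_; _:=_)

  :0 :1 : ∀ {n} → Polynomial n
  :0 = con (0 , 0)
  :1 = con (1 , 0)

-- Linear algebra over Rⁿ

module Linear (R : CommutativeRing 0ℓ 0ℓ) where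
  open CommutativeRing R hiding (zero)
  open Sum semiring using (sum; sum-cong-≋; ∑-distrib-+; *-distribˡ-sum; *-distribʳ-sum)

  private
    variable
      a b c k m n : ℕ

  V : ℕ → Set
  V = Vector Carrier

  infix 4 _≋_
  _≋_ : V n → V n → Set
  u ≋ v = ∀ i → u i ≈ v i

  infixl 6 _⊹_
  _⊹_ : V n → V n → V n
  (u ⊹ v) i = u i + v i

  infixr 7 _⊡_
  _⊡_ : Carrier → V n → V n
  (r ⊡ v) i = r * v i

  𝟎 : V n
  𝟎 i = 0#

  e : Fin n → V n
  e = Defs.basis {R = R}

  e-suc : ∀ (i : Fin n) j → e (suc i) (suc j) ≡ e i j
  e-suc i j with i Fin.≟ j
  ... | yes _ = ≡.refl
  ... | no _  = ≡.refl

  record Lin (a b : ℕ) : Set where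
    infix 8 _▹_
    field
      _▹_    : V a → V b
      ▹-cong : ∀ {u v} → u ≋ v → _▹_ u ≋ _▹_ v
      ▹-+    : ∀ u v → _▹_ (u ⊹ v) ≋ _▹_ u ⊹ _▹_ v
      ▹-*    : ∀ r v → _▹_ (r ⊡ v) ≋ r ⊡ _▹_ v
  open Lin public

  combine : (Fin a → V b) → V a → V b
  combine f v i = sum (λ j → v j * f j i)

  fromBasis : (Fin a → V b) → Lin a b
  fromBasis f = record
    { _▹_    = combine f
    ; ▹-cong = λ u≋v i → sum-cong-≋ (λ j → *-congʳ (u≋v j))
    ; ▹-+    = λ u v i → trans (sum-cong-≋ (λ j → distribʳ (f j i) (u j) (v j)))
                               (∑-distrib-+ (λ j → u j * f j i) (λ j → v j * f j i))
    ; ▹-*    = λ r v i → trans (sum-cong-≋ (λ j → *-assoc r (v j) (f j i)))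
                               (sym (*-distribˡ-sum r (λ j → v j * f j i)))
    }

  infixr 9 _∘ᴸ_
  _∘ᴸ_ : Lin b c → Lin a b → Lin a c
  f ∘ᴸ g = record
    { _▹_    = λ v → f ▹ (g ▹ v)
    ; ▹-cong = ▹-cong f ∘ ▹-cong g
    ; ▹-+    = λ u v i → trans (▹-cong f (▹-+ g u v) i) (▹-+ f _ _ i)
    ; ▹-*    = λ r v i → trans (▹-cong f (▹-* g r v) i) (▹-* f _ _ i)
    }

  ▹-𝟎 : (f : Lin a b) → f ▹ 𝟎 ≋ 𝟎
  ▹-𝟎 f i = trans (▹-cong f {𝟎} {0# ⊡ 𝟎} (λ _ → sym (zeroˡ 0#)) i) (trans (▹-* f 0# 𝟎 i) (zeroˡ _))

  tail : Lin (suc n) n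
  tail = record
    { _▹_ = λ v i → v (suc i) ; ▹-cong = λ u≋v i → u≋v (suc i)
    ; ▹-+ = λ _ _ _ → refl ; ▹-* = λ _ _ _ → refl }

  shift : Lin n (suc n)
  shift = record
    { _▹_ = λ { v zero → 0# ; v (suc i) → v i }
    ; ▹-cong = λ { u≋v zero → refl ; u≋v (suc i) → u≋v i }
    ; ▹-+ = λ { u v zero → sym (+-identityʳ 0#) ; u v (suc i) → refl }
    ; ▹-* = λ { r v zero → sym (zeroʳ r) ; r v (suc i) → refl } }

  head-tail : (v : V (suc n)) → v ≋ v zero ⊡ e zero ⊹ shift ▹ (tail ▹ v)
  head-tail v zero    = sym (trans (+-identityʳ _) (*-identityʳ _))
  head-tail v (suc i) = sym (trans (+-congʳ (zeroʳ _)) (+-identityˡ _))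

  shift-e : (i : Fin n) → e (suc i) ≋ shift ▹ e i
  shift-e i zero    = refl
  shift-e i (suc j) = reflexive (e-suc i j)

  combine-e : (f : Fin a → V b) (j : Fin a) → combine f (e j) ≋ f j
  combine-e {suc a} f zero i = trans (+-cong (*-identityˡ _) (lem {a} (λ j → f (suc j) i))) (+-identityʳ _)
    where
    lem : ∀ {a} (g : V a) → sum (λ j → 0# * g j) ≈ 0#
    lem {a} g = trans (sym (*-distribˡ-sum {a} 0# g)) (zeroˡ _)
  combine-e {suc a} f (suc j) i =
    trans (+-cong (zeroˡ _) (trans (sum-cong-≋ (λ l → *-congʳ (reflexive (e-suc j l)))) (combine-e (f ∘ suc) j i)))
          (+-identityˡ _)

  ▹-combine : (f : Lin b c) (g : Fin a → V b) (v : V a) → f ▹ combine g v ≋ combine (λ j → f ▹ g j) v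
  ▹-combine {a = zero}  f g v i = ▹-𝟎 f i
  ▹-combine {a = suc a} f g v i = trans (▹-+ f (v zero ⊡ g zero) _ i)
    (+-cong (▹-* f _ _ i) (▹-combine f (g ∘ suc) (v ∘ suc) i))

  combine-cong : {f g : Fin a → V b} → (∀ j → f j ≋ g j) → ∀ v → combine f v ≋ combine g v
  combine-cong f≋g v i = sum-cong-≋ (λ j → *-congˡ (f≋g j i))

  combine-basis : (v : V a) → combine e v ≋ v
  combine-basis {suc a} v zero    = trans (+-cong (*-identityʳ _)
    (trans (sum-cong-≋ (λ j → zeroʳ (v (suc j)))) (lem a))) (+-identityʳ _)
    where
    lem : ∀ a → sum {a} (λ j → 0#) ≈ 0#
    lem zero    = refl
    lem (suc a) = trans (+-identityˡ _) (lem a)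
  combine-basis {suc a} v (suc i) = trans (+-cong (zeroʳ _)
    (trans (sum-cong-≋ (λ j → *-congˡ (reflexive (e-suc j i)))) (combine-basis (v ∘ suc) i))) (+-identityˡ _)

  ▹-basis : (f : Lin a b) (v : V a) → f ▹ v ≋ combine (λ j → f ▹ e j) v
  ▹-basis f v i = trans (▹-cong f (λ j → sym (combine-basis v j)) i) (▹-combine f e v i)

-- Alternating forms and the determinant

module Alternating (R : CommutativeRing 0ℓ 0ℓ) where
  open CommutativeRing R hiding (zero)
  open RingProperties ring
  open Solver R using (solve; :0; _:+_; _:*_; _:-_; :-_; _:=_)
  open Linear R
  open SetoidReasoning setoid

  private
    variable
      a b k m n : ℕ

  Form : ℕ → ℕ → Set
  Form n m = Vec (V n) m → Carrier

  record LinearFirst (F : Form n (suc m)) : Set where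
    field
      first-cong : ∀ {u v} Y → u ≋ v → F (u ∷ Y) ≈ F (v ∷ Y)
      first-+    : ∀ u v Y → F (u ⊹ v ∷ Y) ≈ F (u ∷ Y) + F (v ∷ Y)
      first-*    : ∀ r v Y → F (r ⊡ v ∷ Y) ≈ r * F (v ∷ Y)
  open LinearFirst public

  VanishesOnDouble : Form n (suc m) → Set
  VanishesOnDouble {m = zero}  F = ⊤
  VanishesOnDouble {m = suc _} F = ∀ v Y → F (v ∷ v ∷ Y) ≈ 0#

  -- Multilinear, and zero when two adjacent arguments agree.
  Alt : Form n m → Set
  Alt {m = zero}  F = ⊤
  Alt {m = suc _} F = LinearFirst F × VanishesOnDouble F × (∀ v → Alt (λ Y → F (v ∷ Y)))

  Alt-cong : {F : Form n m} → Alt F → ∀ {X Y} → Pointwise _≋_ X Y → F X ≈ F Y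
  Alt-cong _ [] = refl
  Alt-cong (lin , _ , rest) (x≋y ∷ X≋Y) =
    trans (first-cong lin _ x≋y) (Alt-cong (rest _) X≋Y)

  Alt-resp : {F G : Form n m} → (∀ X → F X ≈ G X) → Alt F → Alt G
  Alt-resp {m = zero} _ _ = _
  Alt-resp {m = suc m} {F} {G} F≈G (lin , dbl , rest) =
      record
        { first-cong = λ Y u≋v → trans (sym (F≈G _)) (trans (first-cong lin Y u≋v) (F≈G _))
        ; first-+    = λ u v Y → trans (sym (F≈G _)) (trans (first-+ lin u v Y) (+-cong (F≈G _) (F≈G _)))
        ; first-*    = λ r v Y → trans (sym (F≈G _)) (trans (first-* lin r v Y) (*-congˡ (F≈G _)))
        }
    , double m F≈G dbl
    , λ v → Alt-resp (λ Y → F≈G (v ∷ Y)) (rest v)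
    where
    double : ∀ m {F G : Form n (suc m)} → (∀ X → F X ≈ G X) → VanishesOnDouble F → VanishesOnDouble G
    double zero    _   _ = _
    double (suc m) F≈G d v Y = trans (sym (F≈G _)) (d v Y)

  Alt-combination : ∀ r s {F G : Form n m} → Alt F → Alt G → Alt (λ X → r * F X + s * G X)
  Alt-combination {m = zero} _ _ _ _ = _
  Alt-combination {m = suc m} r s {F} {G} (linF , dblF , restF) (linG , dblG , restG) =
      record
        { first-cong = λ Y u≋v → +-cong (*-congˡ (first-cong linF Y u≋v)) (*-congˡ (first-cong linG Y u≋v))
        ; first-+    = λ u v Y → trans (+-cong (*-congˡ (first-+ linF u v Y)) (*-congˡ (first-+ linG u v Y)))
            (solve 6 (λ r s a b c d → r :* (a :+ b) :+ s :* (c :+ d)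
                := (r :* a :+ s :* c) :+ (r :* b :+ s :* d)) refl r s _ _ _ _)
        ; first-*    = λ t v Y → trans (+-cong (*-congˡ (first-* linF t v Y)) (*-congˡ (first-* linG t v Y)))
            (solve 5 (λ r s t a b → r :* (t :* a) :+ s :* (t :* b)
                := t :* (r :* a :+ s :* b)) refl r s t _ _)
        }
    , double m dblF dblG
    , λ v → Alt-combination r s (restF v) (restG v)
    where
    double : ∀ m {F G : Form n (suc m)} → VanishesOnDouble F → VanishesOnDouble G →
             VanishesOnDouble (λ X → r * F X + s * G X)
    double zero    _  _ = _
    double (suc m) dF dG v Y = trans (+-cong (trans (*-congˡ (dF v Y)) (zeroʳ r))
      (trans (*-congˡ (dG v Y)) (zeroʳ s))) (+-identityʳ 0#)

  Alt-pull : (T : Lin a b) {F : Form b m} → Alt F → Alt (λ X → F (map (T ▹_) X))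
  Alt-pull {m = zero} _ _ = _
  Alt-pull {m = suc m} T (lin , dbl , rest) =
      record
        { first-cong = λ Y u≋v → first-cong lin _ (▹-cong T u≋v)
        ; first-+    = λ u v Y → trans (first-cong lin _ (▹-+ T u v)) (first-+ lin _ _ _)
        ; first-*    = λ r v Y → trans (first-cong lin _ (▹-* T r v)) (first-* lin r _ _)
        }
    , double m dbl
    , λ v → Alt-pull T (rest (T ▹ v))
    where
    double : ∀ m {F : Form _ (suc m)} → VanishesOnDouble F → VanishesOnDouble (λ X → F (map (T ▹_) X))
    double zero    _ = _
    double (suc m) d v Y = d _ _

  Alt-zero : {F : Form n (suc m)} → Alt F → ∀ Y {v} → v ≋ 𝟎 → F (v ∷ Y) ≈ 0#
  Alt-zero {F = F} (lin , _) Y {v} v≋𝟎 = begin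
    F (v ∷ Y)        ≈⟨ first-cong lin Y (λ i → trans (v≋𝟎 i) (sym (zeroˡ _))) ⟩
    F (0# ⊡ v ∷ Y)   ≈⟨ first-* lin 0# v Y ⟩
    0# * F (v ∷ Y)   ≈⟨ zeroˡ _ ⟩
    0#               ∎

  -- Polarisation: expand the vanishing value of F at (u + v, u + v, Y).
  Alt-swap : {F : Form n (suc (suc m))} → Alt F → ∀ u v Y → F (u ∷ v ∷ Y) ≈ - F (v ∷ u ∷ Y)
  Alt-swap {F = F} (lin , dbl , rest) u v Y = begin
    F (u ∷ v ∷ Y)
      ≈⟨ solve 2 (λ p q → p := ((:0 :+ p) :+ (q :+ :0)) :- q) refl _ (F (v ∷ u ∷ Y)) ⟩
    ((0# + F (u ∷ v ∷ Y)) + (F (v ∷ u ∷ Y) + 0#)) - F (v ∷ u ∷ Y)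
      ≈⟨ +-congʳ (+-cong (+-congʳ (sym (dbl u Y))) (+-congˡ (sym (dbl v Y)))) ⟩
    ((F (u ∷ u ∷ Y) + F (u ∷ v ∷ Y)) + (F (v ∷ u ∷ Y) + F (v ∷ v ∷ Y))) - F (v ∷ u ∷ Y)
      ≈⟨ +-congʳ (sym (trans (first-+ lin u v _)
           (+-cong (first-+ (proj₁ (rest u)) u v Y) (first-+ (proj₁ (rest v)) u v Y)))) ⟩
    F (u ⊹ v ∷ u ⊹ v ∷ Y) - F (v ∷ u ∷ Y)
      ≈⟨ trans (+-congʳ (dbl _ Y)) (+-identityˡ _) ⟩
    - F (v ∷ u ∷ Y)  ∎

  -- The alternating product f ∧ F, with value Σⱼ (-1)ʲ f(vⱼ) F(..., vⱼ omitted, ...), written as a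
  -- recursion on the arguments.
  wedge : (V n → Carrier) → Form n m → Form n (suc m)
  wedge {m = zero}  f F (v ∷ [])    = f v * F []
  wedge {m = suc _} f F (v ∷ Y)     = f v * F Y - wedge f (λ Z → F (v ∷ Z)) Y

  wedge-scale : ∀ f r {F G : Form n m} → (∀ X → F X ≈ r * G X) → ∀ X → wedge f F X ≈ r * wedge f G X
  wedge-scale {m = zero}  f r {F} {G} F≈rG (v ∷ []) = trans (*-congˡ (F≈rG []))
    (solve 3 (λ x r g → x :* (r :* g) := r :* (x :* g)) refl (f v) r (G []))
  wedge-scale {m = suc _} f r {F} {G} F≈rG (v ∷ Y) =
    trans (+-cong (*-congˡ (F≈rG Y)) (-‿cong (wedge-scale f r (λ Z → F≈rG (v ∷ Z)) Y)))
    (solve 4 (λ x r g w → x :* (r :* g) :- r :* w := r :* (x :* g :- w)) refl (f v) r (G Y) _)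

  wedge-cong : ∀ f {F G : Form n m} → (∀ X → F X ≈ G X) → ∀ X → wedge f F X ≈ wedge f G X
  wedge-cong f F≈G X = trans (wedge-scale f 1# (λ Y → trans (F≈G Y) (sym (*-identityˡ _))) X) (*-identityˡ _)

  wedge-neg : ∀ f {F G : Form n m} → (∀ X → F X ≈ - G X) → ∀ X → wedge f F X ≈ - wedge f G X
  wedge-neg f F≈-G X =
    trans (wedge-scale f (- 1#) (λ Y → trans (F≈-G Y) (sym (-1*x≈-x _))) X) (-1*x≈-x _)

  wedge-zero : ∀ f {F : Form n m} → (∀ X → F X ≈ 0#) → ∀ X → wedge f F X ≈ 0#
  wedge-zero f {F} F≈0 X =
    trans (wedge-scale f 0# {G = F} (λ Y → trans (F≈0 Y) (sym (zeroˡ _))) X) (zeroˡ _)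

  wedge-+ : ∀ f {F G H : Form n m} → (∀ X → F X ≈ G X + H X) → ∀ X → wedge f F X ≈ wedge f G X + wedge f H X
  wedge-+ {m = zero}  f F≈ (v ∷ []) = trans (*-congˡ (F≈ [])) (distribˡ _ _ _)
  wedge-+ {m = suc _} f F≈ (v ∷ Y) =
    trans (+-cong (*-congˡ (F≈ Y)) (-‿cong (wedge-+ f (λ Z → F≈ (v ∷ Z)) Y)))
    (solve 5 (λ x g h w w′ → x :* (g :+ h) :- (w :+ w′) := (x :* g :- w) :+ (x :* h :- w′)) refl (f v) _ _ _ _)

  module _ (f : V n → Carrier) (f-cong : ∀ {u v} → u ≋ v → f u ≈ f v)
           (f-+ : ∀ u v → f (u ⊹ v) ≈ f u + f v) (f-* : ∀ r v → f (r ⊡ v) ≈ r * f v) where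

    wedge-Alt : {F : Form n m} → Alt F → Alt (wedge f F)
    wedge-Alt {m = zero} {F} _ =
        record
          { first-cong = λ { [] u≋v → *-congʳ (f-cong u≋v) }
          ; first-+    = λ { u v [] → trans (*-congʳ (f-+ u v)) (distribʳ _ _ _) }
          ; first-*    = λ { r v [] → trans (*-congʳ (f-* r v)) (*-assoc _ _ _) }
          }
      , _ , _
    wedge-Alt {m = suc m} {F} (lin , dbl , rest) =
        record
          { first-cong = λ Y u≋v → +-cong (*-congʳ (f-cong u≋v))
              (-‿cong (wedge-cong f (λ Z → first-cong lin Z u≋v) Y))
          ; first-+    = λ u v Y →
              trans (+-cong (*-congʳ (f-+ u v)) (-‿cong (wedge-+ f (λ Z → first-+ lin u v Z) Y)))
              (solve 5 (λ x y g w w′ → (x :+ y) :* g :- (w :+ w′) := (x :* g :- w) :+ (y :* g :- w′))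
                refl _ _ _ _ _)
          ; first-*    = λ r v Y →
              trans (+-cong (*-congʳ (f-* r v)) (-‿cong (wedge-scale f r (λ Z → first-* lin r v Z) Y)))
              (solve 4 (λ r x g w → (r :* x) :* g :- r :* w := r :* (x :* g :- w)) refl _ _ _ _)
          }
      , double m dbl
      , λ v → Alt-resp (λ Y → +-congˡ (-1*x≈-x _)) (Alt-combination (f v) (- 1#) (lin , dbl , rest) (wedge-Alt (rest v)))
      where
      double : ∀ m {F : Form n (suc m)} → VanishesOnDouble F → VanishesOnDouble (wedge f F)
      double zero    {F} _ v [] = -‿inverseʳ _
      -- The two terms that single out one copy of v cancel; every other term keeps both copies
      -- inside F.
      double (suc m) {F} dbl v Y = trans
        (+-congˡ (-‿cong (+-congˡ (-‿cong (wedge-zero f (λ Z → dbl v Z) Y)))))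
        (solve 1 (λ p → p :- (p :- :0) := :0) refl _)

  head : V (suc n) → Carrier
  head v = v zero

  wedge-head-Alt : {F : Form (suc n) m} → Alt F → Alt (wedge head F)
  wedge-head-Alt = wedge-Alt head (λ u≋v → u≋v zero) (λ _ _ → refl) (λ _ _ → refl)

  drop₀ : V (suc n) → V (suc n)
  drop₀ v = shift ▹ (tail ▹ v)

  -- Split every argument as v₀ e₀ + `drop₀ v`. By alternation at most one argument contributes e₀,
  -- and moving it to the front produces the signs of `wedge`.
  Alt-expand : (F : Form (suc n) (suc m)) → Alt F → ∀ X →
               F X ≈ F (map drop₀ X) + wedge head (λ Y → F (e zero ∷ map drop₀ Y)) X
  Alt-expand {m = zero} F (lin , _) (v ∷ []) = begin
    F (v ∷ [])                                   ≈⟨ first-cong lin [] (head-tail v) ⟩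
    F (v zero ⊡ e zero ⊹ drop₀ v ∷ [])           ≈⟨ first-+ lin _ _ [] ⟩
    F (v zero ⊡ e zero ∷ []) + F (drop₀ v ∷ [])  ≈⟨ +-comm _ _ ⟩
    F (drop₀ v ∷ []) + F (v zero ⊡ e zero ∷ [])  ≈⟨ +-congˡ (first-* lin _ _ []) ⟩
    F (drop₀ v ∷ []) + v zero * F (e zero ∷ [])  ∎
  Alt-expand {m = suc m} F altF@(lin , dbl , rest) (v ∷ Y) = begin
    F (v ∷ Y)
      ≈⟨ first-cong lin Y (head-tail v) ⟩
    F (v zero ⊡ e zero ⊹ drop₀ v ∷ Y)
      ≈⟨ trans (first-+ lin _ _ Y) (+-congʳ (first-* lin _ _ Y)) ⟩
    v zero * F (e zero ∷ Y) + F (drop₀ v ∷ Y)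
      ≈⟨ +-cong (*-congˡ (Alt-expand _ (rest (e zero)) Y)) (Alt-expand _ (rest (drop₀ v)) Y) ⟩
    v zero * (F (e zero ∷ map drop₀ Y) + wedge head (λ Z → F (e zero ∷ e zero ∷ map drop₀ Z)) Y)
      + (F (drop₀ v ∷ map drop₀ Y) + wedge head (λ Z → F (drop₀ v ∷ e zero ∷ map drop₀ Z)) Y)
      -- Terms with e₀ twice vanish; in the others e₀ is moved in front of `drop₀ v` at the cost of
      -- a sign.
      ≈⟨ +-cong (*-congˡ (+-congˡ (wedge-zero head (λ Z → dbl (e zero) _) Y)))
                (+-congˡ (wedge-neg head (λ Z → Alt-swap altF _ _ _) Y)) ⟩
    v zero * (F (e zero ∷ map drop₀ Y) + 0#)
      + (F (drop₀ v ∷ map drop₀ Y) + - wedge head (λ Z → F (e zero ∷ drop₀ v ∷ map drop₀ Z)) Y)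
      ≈⟨ solve 4 (λ x p q w → x :* (p :+ :0) :+ (q :+ :- w) := q :+ (x :* p :- w)) refl _ _ _ _ ⟩
    F (drop₀ v ∷ map drop₀ Y)
      + (v zero * F (e zero ∷ map drop₀ Y) - wedge head (λ Z → F (e zero ∷ drop₀ v ∷ map drop₀ Z)) Y)  ∎

  -- Both parts of `Alt-expand` are pulled back from forms on a space of rank one less, with m and
  -- with m - 1 arguments, so the inequality survives the induction.
  Alt-vanish : (F : Form n m) → Alt F → n ℕ.< m → ∀ X → F X ≈ 0#
  Alt-vanish {n = zero}  F altF n<m (v ∷ Y) = Alt-zero altF Y (λ ())
  Alt-vanish {n = suc n} F altF@(_ , _ , rest) (s≤s n<m) X = begin
    F X                                                                 ≈⟨ Alt-expand F altF X ⟩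
    F (map drop₀ X) + wedge head (λ Y → F (e zero ∷ map drop₀ Y)) X
      ≈⟨ +-cong (trans (reflexive (≡.cong F (Vec.map-∘ (shift ▹_) (tail ▹_) X)))
                       (Alt-vanish (F ∘ map (shift ▹_)) (Alt-pull shift altF) (ℕ.m<n⇒m<1+n n<m) (map (tail ▹_) X)))
                (wedge-zero head (λ Y → trans (reflexive (≡.cong (F ∘ (e zero ∷_)) (Vec.map-∘ (shift ▹_) (tail ▹_) Y)))
                       (Alt-vanish (λ Z → F (e zero ∷ map (shift ▹_) Z)) (Alt-pull shift (rest (e zero))) n<m (map (tail ▹_) Y))) X) ⟩
    0# + 0#                                                             ≈⟨ +-identityʳ 0# ⟩
    0#                                                                  ∎

  -- The arguments are the columns, and `wedge head` is Laplace expansion along the first row.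
  det : Form n n
  det {zero}  _ = 1#
  det {suc n}   = wedge head (λ Y → det (map (tail ▹_) Y))

  det-Alt : ∀ n → Alt (det {n})
  det-Alt zero    = _
  det-Alt (suc n) = wedge-head-Alt (Alt-pull tail (det-Alt n))

  basisVec : ∀ n → Vec (V n) n
  basisVec zero    = []
  basisVec (suc n) = e zero ∷ map (shift ▹_) (basisVec n)

  -- In `Alt-expand` the first part has more arguments than its rank and vanishes; the second is, by
  -- induction, a multiple of the smaller determinant.
  det-unique : (F : Form n n) → Alt F → ∀ X → F X ≈ F (basisVec n) * det X
  det-unique {zero}  F _ [] = sym (*-identityʳ _)
  det-unique {suc n} F altF@(_ , _ , rest) X = begin
    F X
      ≈⟨ Alt-expand F altF X ⟩
    F (map drop₀ X) + wedge head (λ Y → F (e zero ∷ map drop₀ Y)) X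
      ≈⟨ +-cong (trans (reflexive (≡.cong F (Vec.map-∘ (shift ▹_) (tail ▹_) X)))
                       (Alt-vanish (F ∘ map (shift ▹_)) (Alt-pull shift altF) (ℕ.n<1+n n) (map (tail ▹_) X)))
                (wedge-scale head (F (basisVec (suc n)))
                  (λ Y → trans (reflexive (≡.cong (F ∘ (e zero ∷_)) (Vec.map-∘ (shift ▹_) (tail ▹_) Y)))
                     (det-unique (λ Z → F (e zero ∷ map (shift ▹_) Z)) (Alt-pull shift (rest (e zero))) (map (tail ▹_) Y))) X) ⟩
    0# + F (basisVec (suc n)) * det X
      ≈⟨ +-identityˡ _ ⟩
    F (basisVec (suc n)) * det X  ∎

  wedge-kernel : ∀ f (F : Form n m) {X} → All (λ v → f v ≈ 0#) X → wedge f F X ≈ 0#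
  wedge-kernel {m = zero}  f F {v ∷ []} (fv≈0 ∷ []) = trans (*-congʳ fv≈0) (zeroˡ _)
  wedge-kernel {m = suc _} f F {v ∷ Y} (fv≈0 ∷ fY≈0) =
    trans (+-cong (trans (*-congʳ fv≈0) (zeroˡ _)) (-‿cong (wedge-kernel f _ fY≈0)))
          (-‿inverseʳ 0#)

  wedge-head-kernel : (F : Form (suc n) (suc m)) (v : V (suc n)) (Y : Vec (V n) (suc m)) →
                      wedge head F (v ∷ map (shift ▹_) Y) ≈ v zero * F (map (shift ▹_) Y)
  wedge-head-kernel F v Y = trans
    (+-congˡ (-‿cong (wedge-kernel head _ (go Y)))) (solve 1 (λ p → p :- :0 := p) refl _)
    where
    go : ∀ {n l} (Y : Vec (V n) l) → All (λ u → u zero ≈ 0#) (map (shift ▹_) Y)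
    go []      = []
    go (_ ∷ Y) = refl ∷ go Y

  det-basis : ∀ n → det (basisVec n) ≈ 1#
  det-basis zero          = refl
  det-basis (suc zero)    = *-identityˡ 1#
  det-basis (suc (suc n)) = begin
    det (basisVec (suc (suc n)))
      ≈⟨ wedge-head-kernel (λ Y → det (map (tail ▹_) Y)) (e zero) (basisVec (suc n)) ⟩
    1# * det (map (tail ▹_) (map (shift ▹_) (basisVec (suc n))))
      ≈⟨ *-identityˡ _ ⟩
    det (map (tail ▹_) (map (shift ▹_) (basisVec (suc n))))
      ≈⟨ reflexive (≡.cong (det {suc n}) (≡.trans (≡.sym (Vec.map-∘ (tail ▹_) (shift ▹_) (basisVec (suc n))))
                                                  (Vec.map-id (basisVec (suc n))))) ⟩
    det (basisVec (suc n))
      ≈⟨ det-basis (suc n) ⟩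
    1#  ∎

  -- Multiplicativity of the determinant: det ∘ T is an alternating form, so `det-unique` applies.
  det-* : (T : Lin n n) → ∀ X → det (map (T ▹_) X) ≈ det (map (T ▹_) (basisVec n)) * det X
  det-* T = det-unique _ (Alt-pull T (det-Alt _))

-- Laplace expansion and maximal minors

module Minors (R : CommutativeRing 0ℓ 0ℓ) where
  open CommutativeRing R hiding (zero)
  open RingProperties ring
  open Solver R using (solve; :0; _:+_; _:*_; _:-_; :-_; _:=_)
  open Linear R
  open Alternating R
  open Sum semiring using (sum; sum-cong-≋; *-distribˡ-sum)
  open Exp semiring using (_^_)
  open SetoidReasoning setoid

  private
    variable
      a b k m n : ℕ

  wedge-sum : ∀ f (F : Form n m) X →
    wedge f F X ≈ sum (λ j → ((- 1#) ^ toℕ j * f (lookup X j)) * F (tabulate (λ i → lookup X (punchIn j i))))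
  wedge-sum {m = zero}  f F (v ∷ []) = sym (trans (+-identityʳ _) (*-congʳ (*-identityˡ _)))
  wedge-sum {m = suc m} f F (v ∷ Y) = +-cong
    (*-cong (sym (*-identityˡ _)) (reflexive (≡.cong F (≡.sym (Vec.tabulate∘lookup Y)))))
    (begin
      - wedge f (λ Z → F (v ∷ Z)) Y  ≈⟨ -‿cong (wedge-sum f (λ Z → F (v ∷ Z)) Y) ⟩
      - sum term                     ≈⟨ sym (-1*x≈-x _) ⟩
      - 1# * sum term                ≈⟨ *-distribˡ-sum {suc m} (- 1#) term ⟩
      sum (λ j → - 1# * term j)      ≈⟨ sum-cong-≋ {suc m} {λ j → - 1# * term j} {λ j → ((- 1# * sgn j) * f (lookup Y j)) * minor j}
                                          (λ j → lemma (- 1#) (sgn j) (f (lookup Y j)) (minor j)) ⟩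
      sum (λ j → ((- 1# * sgn j) * f (lookup Y j)) * minor j)  ∎)
    where
    sgn minor term : Fin (suc m) → Carrier
    sgn j   = (- 1#) ^ toℕ j
    minor j = F (v ∷ tabulate (λ i → lookup Y (punchIn j i)))
    term j  = (sgn j * f (lookup Y j)) * minor j

    lemma : ∀ a b c d → a * ((b * c) * d) ≈ ((a * b) * c) * d
    lemma = solve 4 (λ a b c d → a :* ((b :* c) :* d) := ((a :* b) :* c) :* d) refl

  -- Both recursions expand along the first row; A is transposed because `det` takes columns.
  det-Laplace : (A : Fin n → Fin n → Carrier) → Defs.det {R = R} A ≈ det (tabulate (λ j i → A i j))
  det-Laplace {zero}  A = refl
  det-Laplace {suc n} A = sym (begin
    wedge head (λ Y → det (map (tail ▹_) Y)) X
      ≈⟨ wedge-sum head _ X ⟩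
    sum (λ j → ((- 1#) ^ toℕ j * lookup X j zero) * det (map (tail ▹_) (tabulate (λ i → lookup X (punchIn j i)))))
      ≈⟨ sum-cong-≋ {suc n} (λ j → *-cong
           (*-congˡ {(- 1#) ^ toℕ j} (reflexive (≡.cong (λ v → v zero) (Vec.lookup∘tabulate columns j))))
           (begin
             det (map (tail ▹_) (tabulate (λ i → lookup X (punchIn j i))))
               ≈⟨ reflexive (≡.cong det (≡.trans (≡.sym (Vec.tabulate-∘ (tail ▹_) (λ i → lookup X (punchIn j i))))
                    (Vec.tabulate-cong (λ i → ≡.cong (tail ▹_) (Vec.lookup∘tabulate columns (punchIn j i)))))) ⟩
             det (tabulate (λ k i → A (suc i) (punchIn j k)))
               ≈⟨ sym (det-Laplace (λ i k → A (suc i) (punchIn j k))) ⟩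
             Defs.det {R = R} (λ i k → A (suc i) (punchIn j k)) ∎)) ⟩
    Defs.det {R = R} A ∎)
    where
    columns : Fin (suc n) → V (suc n)
    columns j i = A i j

    X : Vec (V (suc n)) (suc n)
    X = tabulate columns

  record IsIdeal (J : Carrier → Set) : Set where
    field
      J-resp : ∀ {r s} → r ≈ s → J r → J s
      J-0    : J 0#
      J-+    : ∀ {r s} → J r → J s → J (r + s)
      J-*    : ∀ r {s} → J s → J (r * s)

  module _ {J : Carrier → Set} (isIdeal : IsIdeal J) where
    open IsIdeal isIdeal

    J-neg : ∀ {r} → J r → J (- r)
    J-neg Jr = J-resp (-1*x≈-x _) (J-* (- 1#) Jr)

    wedge-J : ∀ f {F : Form n m} → (∀ Y → J (F Y)) → ∀ X → J (wedge f F X)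
    wedge-J {m = zero}  f JF (v ∷ []) = J-* _ (JF [])
    wedge-J {m = suc _} f JF (v ∷ Y)  = J-+ (J-* _ (JF Y)) (J-neg (wedge-J f (λ Z → JF (v ∷ Z)) Y))

    -- Plays the role of the Cauchy-Binet sum. `Alt-expand` separates the column choices that avoid
    -- the first basis vector (`suc ∘ c`) from those that start with it (`0∷ c`), and both kinds are
    -- increasing.
    increasing-minors : (F : Form n m) → Alt F →
      (∀ (c : Fin m → Fin n) → c Preserves Fin._<_ ⟶ Fin._<_ → J (F (tabulate (e ∘ c)))) → ∀ X → J (F X)
    increasing-minors {m = zero} F altF JF [] = JF (λ ()) (λ { {()} })
    increasing-minors {n = zero} {m = suc m} F altF JF (v ∷ Y) = J-resp (sym (Alt-zero altF Y (λ ()))) J-0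
    increasing-minors {n = suc n} {m = suc m} F altF@(_ , _ , rest) JF X =
      J-resp (sym (Alt-expand F altF X)) (J-+
        (J-resp (reflexive (≡.cong F (≡.sym (Vec.map-∘ (shift ▹_) (tail ▹_) X))))
          (increasing-minors (F ∘ map (shift ▹_)) (Alt-pull shift altF)
            (λ c c↗ → J-resp (Alt-cong altF (shift-tabulate c)) (JF (suc ∘ c) (s≤s ∘ c↗)))
            (map (tail ▹_) X)))
        (wedge-J head
          (λ Y → J-resp (reflexive (≡.cong (F ∘ (e zero ∷_)) (≡.sym (Vec.map-∘ (shift ▹_) (tail ▹_) Y))))
            (increasing-minors (λ Z → F (e zero ∷ map (shift ▹_) Z)) (Alt-pull shift (rest (e zero)))
              (λ c c↗ → J-resp (Alt-cong (rest (e zero)) (shift-tabulate c)) (JF (0∷ c) (0∷-↗ c c↗)))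
              (map (tail ▹_) Y))) X))
      where
      shift-tabulate : ∀ {m} (c : Fin m → Fin n) →
        Pointwise _≋_ (tabulate (e ∘ suc ∘ c)) (map (shift ▹_) (tabulate (e ∘ c)))
      shift-tabulate {zero}  c = []
      shift-tabulate {suc m} c = shift-e (c zero) ∷ shift-tabulate (c ∘ suc)

      0∷ : ∀ {m} → (Fin m → Fin n) → Fin (suc m) → Fin (suc n)
      0∷ c zero    = zero
      0∷ c (suc i) = suc (c i)

      0∷-↗ : ∀ {m} (c : Fin m → Fin n) → c Preserves Fin._<_ ⟶ Fin._<_ → 0∷ c Preserves Fin._<_ ⟶ Fin._<_
      0∷-↗ c c↗ {zero}  {suc j} _         = s≤s z≤n
      0∷-↗ c c↗ {suc i} {suc j} (s≤s i<j) = s≤s (c↗ i<j)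

-- Submodules of an R-algebra, and their products and inverses

-- An abstract stand-in for Q(R). The module structure is a field in exactly the shape of
-- `Q-module`, so that at A = Q(R) the submodules below are the fractional ideals of the statement
-- definitionally.
record RAlgebra (R : CommutativeRing 0ℓ 0ℓ) : Set₁ where
  field
    A : CommutativeRing 0ℓ 0ℓ
  open CommutativeRing A
  field
    ι        : CommutativeRing.Carrier R → Carrier
    _·ᵣ_     : Carrier → CommutativeRing.Carrier R → Carrier
    isModule : IsModule R _≈_ _+_ 0# (-_) (λ r x → ι r * x) _·ᵣ_

  InvertsRegular : Set
  InvertsRegular = ∀ {r} → Fractions.IsRegular R r → ∃[ s ] ι r * s ≈ 1#

module Submodules (R : CommutativeRing 0ℓ 0ℓ) (𝓐 : RAlgebra R) where
  open RAlgebra 𝓐 using (A; ι; isModule)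
  open CommutativeRing A hiding (zero)
  open SetoidReasoning setoid
  open Solver A using (solve; :0; _:+_; _:*_; _:-_; :-_; _:=_)
  private
    module R = CommutativeRing R
    module I = IsModule isModule

  M : Module R 0ℓ 0ℓ
  M = record { isModule = isModule }

  FI : Set₁
  FI = Submodule M

  open Submodule

  ι-cong : ∀ {r s} → r R.≈ s → ι r ≈ ι s
  ι-cong r≈s = trans (sym (*-identityʳ _)) (trans (I.*ₗ-cong r≈s refl) (*-identityʳ _))

  ι-+ : ∀ r s → ι (r R.+ s) ≈ ι r + ι s
  ι-+ r s = trans (sym (*-identityʳ _)) (trans (I.*ₗ-distribʳ 1# r s) (+-cong (*-identityʳ _) (*-identityʳ _)))

  ι-* : ∀ r s → ι (r R.* s) ≈ ι r * ι s
  ι-* r s = trans (sym (*-identityʳ _)) (trans (I.*ₗ-assoc r s 1#) (*-congˡ (*-identityʳ _)))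

  ι-0 : ι R.0# ≈ 0#
  ι-0 = trans (sym (*-identityʳ _)) (I.*ₗ-zeroˡ 1#)

  ι-1 : ι R.1# ≈ 1#
  ι-1 = trans (sym (*-identityʳ _)) (I.*ₗ-identityˡ 1#)

  infix 4 _⊆_
  _⊆_ : FI → FI → Set
  I ⊆ J = ∀ {x} → x ∈ₛ I → x ∈ₛ J

  span-⊆ : ∀ {S} {I : FI} → (∀ {x} → S x → x ∈ₛ I) → span M S ⊆ I
  span-⊆ {I = I} S⊆I (span-gen s)       = S⊆I s
  span-⊆ {I = I} S⊆I (span-resp x≈y p)  = resp I x≈y (span-⊆ {I = I} S⊆I p)
  span-⊆ {I = I} S⊆I span-0             = 0-closed I
  span-⊆ {I = I} S⊆I (span-+ p q)       = +-closed I (span-⊆ {I = I} S⊆I p) (span-⊆ {I = I} S⊆I q)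
  span-⊆ {I = I} S⊆I (span-*ₗ r p)      = *ₗ-closed I r (span-⊆ {I = I} S⊆I p)

  -- The colon submodule of I by y. It reduces inclusions of products to `span-⊆` in one factor at a
  -- time.
  _∶_ : FI → Carrier → FI
  I ∶ y = record
    { Member    = λ x → x * y ∈ₛ I
    ; resp      = λ x≈x′ → resp I (*-congʳ x≈x′)
    ; 0-closed  = resp I (sym (zeroˡ y)) (0-closed I)
    ; +-closed  = λ p q → resp I (sym (distribʳ y _ _)) (+-closed I p q)
    ; *ₗ-closed = λ r p → resp I (sym (*-assoc _ _ y)) (*ₗ-closed I r p)
    }

  infixl 7 _·_
  _·_ : FI → FI → FI
  I · J = span M (λ z → ∃[ x ] ∃[ y ] (x ∈ₛ I) × (y ∈ₛ J) × z ≈ x * y)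

  𝟙 : FI
  𝟙 = span M (λ x → x ≈ 1#)

  infix 4 _≐_
  record _≐_ (I J : FI) : Set where
    constructor mk≐
    field
      ⊆⃗ : I ⊆ J
      ⊆⃖ : J ⊆ I
  open _≐_ public

  ≐⇒≐ₛ : ∀ {I J} → I ≐ J → I ≐ₛ J
  ≐⇒≐ₛ p x = mk⇔ (⊆⃗ p) (⊆⃖ p)

  ·-gen : ∀ I J {x y} → x ∈ₛ I → y ∈ₛ J → x * y ∈ₛ I · J
  ·-gen I J p q = span-gen (_ , _ , p , q , refl)

  ·-mono : ∀ {I I′ J J′} → I ⊆ I′ → J ⊆ J′ → I · J ⊆ I′ · J′
  ·-mono {I′ = I′} {J′ = J′} I⊆ J⊆ = span-⊆ {I = I′ · J′} λ (x , y , p , q , z≈) → span-gen (x , y , I⊆ p , J⊆ q , z≈)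

  ·-comm-⊆ : ∀ I J → I · J ⊆ J · I
  ·-comm-⊆ I J = span-⊆ {I = J · I} λ (x , y , p , q , z≈) → span-gen (y , x , q , p , trans z≈ (*-comm x y))

  ·-assoc-⊆ : ∀ I J K → (I · J) · K ⊆ I · (J · K)
  ·-assoc-⊆ I J K = span-⊆ {I = L} λ (x , y , p , q , z≈) →
      resp L (sym z≈) (span-⊆ {I = L ∶ y} (λ (a , b , a∈ , b∈ , x≈) →
        resp L (trans (sym (*-assoc a b y)) (*-congʳ (sym x≈))) (·-gen I (J · K) a∈ (·-gen J K b∈ q))) p)
    where
    L : FI
    L = I · (J · K)

  ·-identity-⊆ : ∀ I → 𝟙 · I ⊆ I
  ·-identity-⊆ I = span-⊆ {I = I} λ (x , y , p , q , z≈) →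
    resp I (sym z≈) (span-⊆ {I = I ∶ y} (λ x≈1 → resp I (sym (trans (*-congʳ x≈1) (*-identityˡ y))) q) p)

  commutativeMonoid : CommutativeMonoid (lsuc 0ℓ) 0ℓ
  commutativeMonoid = record
    { Carrier = FI ; _≈_ = _≐_ ; _∙_ = _·_ ; ε = 𝟙
    ; isCommutativeMonoid = record
      { isMonoid = record
        { isSemigroup = record
          { isMagma = record
            { isEquivalence = record
              { refl  = mk≐ (λ p → p) (λ p → p)
              ; sym   = λ p → mk≐ (⊆⃖ p) (⊆⃗ p)
              ; trans = λ p q → mk≐ (λ x → ⊆⃗ q (⊆⃗ p x)) (λ x → ⊆⃖ p (⊆⃖ q x))
              }
            ; ∙-cong = λ {I} {I′} {J} {J′} p q → mk≐
                (·-mono {I} {I′} {J} {J′} (⊆⃗ p) (⊆⃗ q)) (·-mono {I′} {I} {J′} {J} (⊆⃖ p) (⊆⃖ q))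
            }
          -- The reverse inclusion is the first one conjugated by commutativity.
          ; assoc = λ I J K → mk≐ (·-assoc-⊆ I J K) (λ x →
              ·-comm-⊆ K (I · J) (·-mono {K} {K} {J · I} {I · J} (λ y → y) (·-comm-⊆ J I)
                (·-assoc-⊆ K J I (·-comm-⊆ I (K · J) (·-mono {I} {I} {J · K} {K · J} (λ y → y) (·-comm-⊆ J K) x)))))
          }
        ; identity = (λ I → mk≐ (·-identity-⊆ I) (one I))
                   , (λ I → mk≐ (λ x → ·-identity-⊆ I (·-comm-⊆ I 𝟙 x)) (λ x → ·-comm-⊆ 𝟙 I (one I x)))
        }
      ; comm = λ I J → mk≐ (·-comm-⊆ I J) (·-comm-⊆ J I)
      }
    }
    where
    one : ∀ I → I ⊆ 𝟙 · I
    one I {x} x∈ = span-resp (*-identityˡ x) (·-gen 𝟙 I (span-gen refl) x∈)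

  _⁻ : FI → FI
  I ⁻ = record
    { Member    = λ x → ∀ y → y ∈ₛ I → x * y ∈ₛ 𝟙
    ; resp      = λ x≈x′ p y y∈ → span-resp (*-congʳ x≈x′) (p y y∈)
    ; 0-closed  = λ y _ → span-resp (sym (zeroˡ y)) span-0
    ; +-closed  = λ p q y y∈ → span-resp (sym (distribʳ y _ _)) (span-+ (p y y∈) (q y y∈))
    ; *ₗ-closed = λ r p y y∈ → span-resp (sym (*-assoc _ _ y)) (span-*ₗ r (p y y∈))
    }

  -- If δ = Σ xᵢ yᵢ with yᵢ I ⊆ (δ), then 1 = Σ xᵢ (yᵢ / δ) with yᵢ / δ ∈ I⁻¹.
  invertible : ∀ I J {δ δ⁻} → δ * δ⁻ ≈ 1# → I · J ≐ span M (λ x → x ≈ δ) → I · I ⁻ ≐ 𝟙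
  invertible I J {δ} {δ⁻} δδ⁻≈1 IJ≐δ = mk≐
    (span-⊆ {I = 𝟙} λ (x , y , x∈ , y∈ , z≈) → span-resp (trans (*-comm y x) (sym z≈)) (y∈ x x∈))
    (span-⊆ {I = I · I ⁻} λ x≈1 → resp (I · I ⁻) (trans δδ⁻≈1 (sym x≈1))
      (span-⊆ {I = (I · I ⁻) ∶ δ⁻}
        (λ (x , y , x∈ , y∈ , z≈) → resp (I · I ⁻) (trans (sym (*-assoc x y δ⁻)) (*-congʳ (sym z≈)))
          (·-gen I (I ⁻) x∈ λ w w∈ → resp 𝟙 (trans (*-assoc _ _ _)
              (solve 3 (λ a b c → a :* (b :* c) := (b :* c) :* a) refl w y δ⁻))
            (span-⊆ {I = 𝟙 ∶ δ⁻} (λ z≈δ → span-gen (trans (*-congʳ z≈δ) δδ⁻≈1))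
              (⊆⃗ IJ≐δ (·-gen I J w∈ y∈)))))
        (⊆⃖ IJ≐δ (span-gen refl))))

-- Block vectors and submodules of Rⁿ

module Blocks (R : CommutativeRing 0ℓ 0ℓ) where
  open CommutativeRing R hiding (zero)
  open RingProperties ring
  open Linear R
  open Solver R using (solve; :0; _:+_; _:*_; _:-_; :-_; _:=_)
  private
    variable
      a b c k m n : ℕ

  idᴸ : Lin n n
  idᴸ = record { _▹_ = λ v → v ; ▹-cong = λ u≋v → u≋v ; ▹-+ = λ _ _ _ → refl ; ▹-* = λ _ _ _ → refl }

  scaleᴸ : Carrier → Lin n n
  scaleᴸ d = record
    { _▹_    = d ⊡_
    ; ▹-cong = λ u≋v i → *-congˡ (u≋v i)
    ; ▹-+    = λ u v i → distribˡ d _ _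
    ; ▹-*    = λ r v i → solve 3 (λ d r x → d :* (r :* x) := r :* (d :* x)) refl d r (v i)
    }

  infixl 6 _+ᴸ_
  _+ᴸ_ : Lin a b → Lin a b → Lin a b
  f +ᴸ g = record
    { _▹_    = λ v → f ▹ v ⊹ g ▹ v
    ; ▹-cong = λ u≋v i → +-cong (▹-cong f u≋v i) (▹-cong g u≋v i)
    ; ▹-+    = λ u v i → trans (+-cong (▹-+ f u v i) (▹-+ g u v i))
                 (solve 4 (λ x y z w → (x :+ y) :+ (z :+ w) := (x :+ z) :+ (y :+ w)) refl _ _ _ _)
    ; ▹-*    = λ r v i → trans (+-cong (▹-* f r v i) (▹-* g r v i)) (sym (distribˡ _ _ _))
    }

  infix 8 -ᴸ_
  -ᴸ_ : Lin a b → Lin a b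
  -ᴸ f = record
    { _▹_    = λ v i → - (f ▹ v) i
    ; ▹-cong = λ u≋v i → -‿cong (▹-cong f u≋v i)
    ; ▹-+    = λ u v i → trans (-‿cong (▹-+ f u v i)) (sym (-‿+-comm _ _))
    ; ▹-*    = λ r v i → trans (-‿cong (▹-* f r v i)) (-‿distribʳ-* _ _)
    }

  ▹-neg : (f : Lin a b) (v : V a) → f ▹ (λ i → - v i) ≋ (λ i → - (f ▹ v) i)
  ▹-neg f v i = trans (▹-cong f (λ j → sym (-1*x≈-x _)) i) (trans (▹-* f (- 1#) v i) (-1*x≈-x _))

  infixr 5 _⊕_
  _⊕_ : V k → V c → V (k ℕ.+ c)
  _⊕_ {k} x y i = [ x , y ]′ (splitAt k i)

  pr₁ : ∀ k {c} → Lin (k ℕ.+ c) k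
  pr₁ k {c} = record
    { _▹_ = λ z i → z (i ↑ˡ c) ; ▹-cong = λ u≋v i → u≋v (i ↑ˡ c)
    ; ▹-+ = λ _ _ _ → refl ; ▹-* = λ _ _ _ → refl }

  pr₂ : ∀ k {c} → Lin (k ℕ.+ c) c
  pr₂ k = record
    { _▹_ = λ z i → z (k ↑ʳ i) ; ▹-cong = λ u≋v i → u≋v (k ↑ʳ i)
    ; ▹-+ = λ _ _ _ → refl ; ▹-* = λ _ _ _ → refl }

  pr₁-⊕ : (x : V k) (y : V c) → pr₁ k ▹ (x ⊕ y) ≋ x
  pr₁-⊕ {k} {c} x y i = reflexive (≡.cong [ x , y ]′ (Fin.splitAt-↑ˡ k i c))

  pr₂-⊕ : (x : V k) (y : V c) → pr₂ k ▹ (x ⊕ y) ≋ y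
  pr₂-⊕ {k} {c} x y i = reflexive (≡.cong [ x , y ]′ (Fin.splitAt-↑ʳ k c i))

  ⊕-ext : ∀ k {c} {u v : V (k ℕ.+ c)} → pr₁ k ▹ u ≋ pr₁ k ▹ v → pr₂ k ▹ u ≋ pr₂ k ▹ v → u ≋ v
  ⊕-ext k {c} {u} {v} p q i with splitAt k i in eq
  ... | inj₁ j = ≡.subst (λ i → u i ≈ v i) (Fin.splitAt⁻¹-↑ˡ eq) (p j)
  ... | inj₂ j = ≡.subst (λ i → u i ≈ v i) (Fin.splitAt⁻¹-↑ʳ eq) (q j)

  ⊕-cong : {x x′ : V k} {y y′ : V c} → x ≋ x′ → y ≋ y′ → x ⊕ y ≋ x′ ⊕ y′
  ⊕-cong {k} p q i with splitAt k i
  ... | inj₁ j = p j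
  ... | inj₂ j = q j

  ⊕-+ : (x x′ : V k) (y y′ : V c) → (x ⊹ x′) ⊕ (y ⊹ y′) ≋ (x ⊕ y) ⊹ (x′ ⊕ y′)
  ⊕-+ {k} x x′ y y′ i with splitAt k i
  ... | inj₁ j = refl
  ... | inj₂ j = refl

  ⊕-* : ∀ r (x : V k) (y : V c) → (r ⊡ x) ⊕ (r ⊡ y) ≋ r ⊡ (x ⊕ y)
  ⊕-* {k} r x y i with splitAt k i
  ... | inj₁ j = refl
  ... | inj₂ j = refl

  ⊕-η : ∀ k {c} (z : V (k ℕ.+ c)) → (pr₁ k ▹ z) ⊕ (pr₂ k ▹ z) ≋ z
  ⊕-η k z = ⊕-ext k (pr₁-⊕ _ _) (pr₂-⊕ {k} _ _)

  infixr 5 _⊕ᴸ_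
  _⊕ᴸ_ : Lin a k → Lin a c → Lin a (k ℕ.+ c)
  f ⊕ᴸ g = record
    { _▹_    = λ v → (f ▹ v) ⊕ (g ▹ v)
    ; ▹-cong = λ u≋v → ⊕-cong (▹-cong f u≋v) (▹-cong g u≋v)
    ; ▹-+    = λ u v i → trans (⊕-cong (▹-+ f u v) (▹-+ g u v) i) (⊕-+ (f ▹ u) (f ▹ v) (g ▹ u) (g ▹ v) i)
    ; ▹-*    = λ r v i → trans (⊕-cong (▹-* f r v) (▹-* g r v) i) (⊕-* r (f ▹ v) (g ▹ v) i)
    }

  0ᴸ : Lin a b
  0ᴸ = record
    { _▹_ = λ _ → 𝟎 ; ▹-cong = λ _ _ → refl
    ; ▹-+ = λ _ _ _ → sym (+-identityʳ 0#) ; ▹-* = λ r _ _ → sym (zeroʳ r) }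

  inl : Lin k (k ℕ.+ c)
  inl = idᴸ ⊕ᴸ 0ᴸ

  inr : ∀ k {c} → Lin c (k ℕ.+ c)
  inr k = 0ᴸ ⊕ᴸ idᴸ

  inl-inr : ∀ k {c} (z : V (k ℕ.+ c)) → z ≋ inl ▹ (pr₁ k ▹ z) ⊹ inr k ▹ (pr₂ k ▹ z)
  inl-inr k z = ⊕-ext k
    (λ i → sym (trans (+-cong (pr₁-⊕ {k} _ 𝟎 i) (pr₁-⊕ {k} 𝟎 _ i)) (+-identityʳ _)))
    (λ i → sym (trans (+-cong (pr₂-⊕ {k} _ 𝟎 i) (pr₂-⊕ {k} 𝟎 _ i)) (+-identityˡ _)))

  map-≋ : ∀ {l} {f g : V a → V b} → (∀ v → f v ≋ g v) → (Z : Vec (V a) l) → Pointwise _≋_ (map f Z) (map g Z)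
  map-≋ f≋g []      = []
  map-≋ f≋g (z ∷ Z) = f≋g z ∷ map-≋ f≋g Z

  Sub : ℕ → Set₁
  Sub n = Submodule (R ^ᴹ n)

  open Submodule public using (resp; 0-closed; +-closed; *ₗ-closed)

  combine-closed : ∀ (U : Sub n) (f : Fin a → V n) v → (∀ j → f j ∈ₛ U) → combine f v ∈ₛ U
  combine-closed {a = zero}  U f v f∈U = 0-closed U
  combine-closed {a = suc a} U f v f∈U =
    +-closed U (*ₗ-closed U _ (f∈U zero)) (combine-closed U (f ∘ suc) (v ∘ suc) (f∈U ∘ suc))

  -closed : ∀ (U : Sub n) {u v} → u ∈ₛ U → v ∈ₛ U → (λ i → u i - v i) ∈ₛ U
  -closed U u∈ v∈ = resp U (λ i → +-congˡ (-1*x≈-x _)) (+-closed U u∈ (*ₗ-closed U (- 1#) v∈))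

  full : ∀ n → Sub n
  full n = record
    { Member = λ _ → Data.Unit.Base.⊤ ; resp = λ _ _ → _ ; 0-closed = _ ; +-closed = λ _ _ → _ ; *ₗ-closed = λ _ _ → _ }
    where import Data.Unit.Base

  im : Lin a b → Sub b
  im f = record
    { Member    = λ v → ∃[ w ] f ▹ w ≋ v
    ; resp      = λ { u≋v (w , p) → w , λ i → trans (p i) (u≋v i) }
    ; 0-closed  = 𝟎 , ▹-𝟎 f
    ; +-closed  = λ { (w , p) (w′ , p′) → w ⊹ w′ , λ i → trans (▹-+ f w w′ i) (+-cong (p i) (p′ i)) }
    ; *ₗ-closed = λ { r (w , p) → r ⊡ w , λ i → trans (▹-* f r w i) (*-congˡ (p i)) }
    }

  infixr 6 _⊠_
  _⊠_ : Sub k → Sub c → Sub (k ℕ.+ c)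
  _⊠_ {k} U U′ = record
    { Member    = λ z → (pr₁ k ▹ z ∈ₛ U) × (pr₂ k ▹ z ∈ₛ U′)
    ; resp      = λ z≋ (p , q) → resp U (λ i → z≋ _) p , resp U′ (λ i → z≋ _) q
    ; 0-closed  = 0-closed U , 0-closed U′
    ; +-closed  = λ (p , q) (p′ , q′) → +-closed U p p′ , +-closed U′ q q′
    ; *ₗ-closed = λ r (p , q) → *ₗ-closed U r p , *ₗ-closed U′ r q
    }

  preimage : Lin a b → Sub b → Sub a
  preimage f U = record
    { Member    = λ v → f ▹ v ∈ₛ U
    ; resp      = λ u≋v → resp U (▹-cong f u≋v)
    ; 0-closed  = resp U (λ i → sym (▹-𝟎 f i)) (0-closed U)
    ; +-closed  = λ p q → resp U (λ i → sym (▹-+ f _ _ i)) (+-closed U p q)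
    ; *ₗ-closed = λ r p → resp U (λ i → sym (▹-* f _ _ i)) (*ₗ-closed U r p)
    }

  -- The source Rᵇ is free: lifts chosen over the basis vectors combine linearly and stay inside W.
  lift-linear : ∀ (W : Sub (k ℕ.+ a)) (h : Lin b a) → (∀ j → ∃[ x ] x ⊕ (h ▹ e j) ∈ₛ W) →
         Σ[ f ∈ Lin b k ] (∀ w → (f ▹ w) ⊕ (h ▹ w) ∈ₛ W)
  lift-linear {k} W h lifts = fromBasis (proj₁ ∘ lifts) , λ w →
    resp W (⊕-ext k
      (λ i → trans (▹-combine (pr₁ k) z w i) (trans (combine-cong (λ j → pr₁-⊕ _ _) w i) (sym (pr₁-⊕ _ _ i))))
      (λ i → trans (▹-combine (pr₂ k) z w i) (trans (combine-cong (λ j → pr₂-⊕ {k} _ _) w i)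
               (trans (sym (▹-basis h w i)) (sym (pr₂-⊕ {k} _ _ i))))))
    (combine-closed W z w (proj₂ ∘ lifts))
    where
    z : ∀ j → V _
    z j = proj₁ (lifts j) ⊕ (h ▹ e j)

  -- The relation module of (R/d)ⁿ.
  scaled : Carrier → ∀ n → Sub n
  scaled d n = im (scaleᴸ {n} d)

-- Determinants on direct sums

module Products (R : CommutativeRing 0ℓ 0ℓ) where
  open CommutativeRing R hiding (zero)
  open Linear R
  open Alternating R
  open Minors R
  open Blocks R
  private
    variable
      a b c k m n p q r : ℕ

  -- The lengths are tied to r only by an equation, so that the sorted terms of `expand-sums`, whose
  -- p and q vary, can all be fed to the same form.
  Alt-fix-last : {F : Form n r} → Alt F → (Y : Vec (V n) q) (eq : p ℕ.+ q ≡ r) →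
                 Alt {m = p} (λ X → F (cast eq (X ++ Y)))
  Alt-fix-last {p = zero}  _ _ _ = _
  Alt-fix-last {r = suc r} {p = suc p} (lin , dbl , rest) Y eq =
      record
        { first-cong = λ X → first-cong lin (cast _ (X ++ Y))
        ; first-+    = λ u v X → first-+ lin u v (cast _ (X ++ Y))
        ; first-*    = λ t v X → first-* lin t v (cast _ (X ++ Y)) }
    , double p dbl eq
    , λ v → Alt-fix-last (rest v) Y (ℕ.suc-injective eq)
    where
    double : ∀ p {r q} {F : Form n (suc r)} {Y : Vec (V n) q} → VanishesOnDouble F → (eq : suc p ℕ.+ q ≡ suc r) →
             VanishesOnDouble {m = p} (λ X → F (cast eq (X ++ Y)))
    double zero    _ _ = _
    double (suc p) {suc r} {Y = Y} d eq v X = d v (cast _ (X ++ Y))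

  Alt-fix-first : {F : Form n r} → Alt F → (X : Vec (V n) p) (eq : p ℕ.+ q ≡ r) →
                  Alt {m = q} (λ Y → F (cast eq (X ++ Y)))
  Alt-fix-first {F = F} altF [] ≡.refl = Alt-resp (λ Y → reflexive (≡.cong F (≡.sym (Vec.cast-is-id ≡.refl Y)))) altF
  Alt-fix-first {r = suc r} (_ , _ , rest) (v ∷ X) eq = Alt-fix-first (rest v) X (ℕ.suc-injective eq)

  module _ {J : Carrier → Set} (isIdeal : IsIdeal J) where
    open IsIdeal isIdeal

    -- Each transposition changes only the sign, which an ideal does not see.
    move-to-front : {F : Form n (suc r)} → Alt F → ∀ (X : Vec (V n) p) y (Y : Vec (V n) q)
      (eq : p ℕ.+ q ≡ r) (eq′ : p ℕ.+ suc q ≡ suc r) →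
      J (F (cast eq′ (X ++ y ∷ Y))) → J (F (y ∷ cast eq (X ++ Y)))
    move-to-front altF [] y Y eq eq′ JF = JF
    move-to-front {r = suc r} altF@(_ , _ , rest) (x ∷ X) y Y eq eq′ JF =
      J-resp (sym (Alt-swap altF y x _)) (J-neg isIdeal
        (move-to-front (rest x) X y Y (ℕ.suc-injective eq) (ℕ.suc-injective eq′) JF))

    -- Multilinear expansion along zᵢ = f uᵢ + g u′ᵢ, with each term sorted by alternation.
    expand-sums : (U : Sub k) (U′ : Sub c) (f : Lin k n) (g : Lin c n) {F : Form n r} → Alt F →
      (∀ {p q} (eq : p ℕ.+ q ≡ r) {X : Vec (V k) p} {Y : Vec (V c) q} → All (_∈ₛ U) X → All (_∈ₛ U′) Y →
        J (F (cast eq (map (f ▹_) X ++ map (g ▹_) Y)))) →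
      ∀ {Z} → All (λ z → ∃[ u ] ∃[ u′ ] (u ∈ₛ U) × (u′ ∈ₛ U′) × z ≋ f ▹ u ⊹ g ▹ u′) Z → J (F Z)
    expand-sums U U′ f g {F} altF JF [] = JF ≡.refl [] []
    expand-sums U U′ f g {F} altF@(lin , _ , rest) JF {z ∷ Z} ((u , u′ , u∈ , u′∈ , z≋) ∷ Z∈) =
      J-resp (sym (trans (first-cong lin Z z≋) (first-+ lin _ _ Z))) (J-+
        (expand-sums U U′ f g (rest _) (λ eq X∈ Y∈ → JF (≡.cong suc eq) (u∈ ∷ X∈) Y∈) Z∈)
        (expand-sums U U′ f g (rest _) (λ {p} {q} eq {X} {Y} X∈ Y∈ →
          move-to-front altF (map (f ▹_) X) (g ▹ u′) (map (g ▹_) Y) eq (≡.trans (ℕ.+-suc p q) (≡.cong suc eq))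
            (JF (≡.trans (ℕ.+-suc p q) (≡.cong suc eq)) X∈ (u′∈ ∷ Y∈))) Z∈))

  -- The left side is alternating in X and in Y separately, so two uses of `det-unique` reduce it to
  -- its value at the identity matrix.
  det-block : (X : Vec (V k) k) (Y : Vec (V c) c) →
    det (map (inl ▹_) X ++ map (inr k ▹_) Y) ≈ det X * det Y
  det-block {k} {c} X Y = begin
    det (map (inl ▹_) X ++ map (inr k ▹_) Y)
      ≈⟨ block-form (det {k ℕ.+ c}) (det-Alt (k ℕ.+ c)) X Y ⟩
    (det (map (inl ▹_) (basisVec k) ++ map (inr k ▹_) (basisVec c)) * det Y) * det X
      ≈⟨ *-congʳ (*-congʳ (trans (Alt-cong (det-Alt (k ℕ.+ c)) (blocks-basis k)) (det-basis (k ℕ.+ c)))) ⟩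
    (1# * det Y) * det X  ≈⟨ trans (*-congʳ (*-identityˡ _)) (*-comm _ _) ⟩
    det X * det Y         ∎
    where
    open SetoidReasoning setoid
    uncast : ∀ {l m} (F : Form l m) Z → F (cast ≡.refl Z) ≈ F Z
    uncast F Z = reflexive (≡.cong F (Vec.cast-is-id ≡.refl Z))

    block-form : ∀ {k c} (F : Form (k ℕ.+ c) (k ℕ.+ c)) → Alt F → ∀ X Y → F (map (inl ▹_) X ++ map (inr k ▹_) Y)
        ≈ (F (map (inl ▹_) (basisVec k) ++ map (inr k ▹_) (basisVec c)) * det Y) * det X
    block-form {k} {c} F altF X Y = trans
      (det-unique _ (Alt-resp (λ X → uncast F _) (Alt-pull inl (Alt-fix-last altF (map (inr k ▹_) Y) ≡.refl))) X)
      (*-congʳ (det-unique _ (Alt-resp (λ Y → uncast F _)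
        (Alt-pull (inr k) (Alt-fix-first altF (map (inl ▹_) (basisVec k)) ≡.refl))) Y))

    blocks-basis : ∀ k → Pointwise _≋_ (map (inl ▹_) (basisVec k) ++ map (inr k ▹_) (basisVec c)) (basisVec (k ℕ.+ c))
    blocks-basis zero    = ≡.subst (Pointwise _≋_ _) (Vec.map-id (basisVec c)) (map-≋ (λ v i → refl) (basisVec c))
    blocks-basis (suc k) = inl-e0 ∷ ≡.subst₂ (Pointwise _≋_)
        (≡.cong₂ _++_ (Vec.map-∘ (inl ▹_) (shift ▹_) (basisVec k)) ≡.refl)
        ≡.refl
        (trPW (≡.subst (λ Z → Pointwise _≋_ (map (λ v → inl ▹ (shift ▹ v)) (basisVec k) ++ map (inr (suc k) ▹_) (basisVec c)) Z)
                 (≡.sym (≡.trans (Vec.map-++ (shift ▹_) (map (inl ▹_) (basisVec k)) _)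
                          (≡.cong₂ _++_ (≡.sym (Vec.map-∘ (shift ▹_) (inl ▹_) (basisVec k)))
                                        (≡.sym (Vec.map-∘ (shift ▹_) (inr k ▹_) (basisVec c))))))
                 (Pointwise.++⁺ (map-≋ inl-shift (basisVec k)) (map-≋ inr-shift (basisVec c))))
              (map-shift (blocks-basis k)))
      where
      inl-e0 : inl {suc k} {c} ▹ e zero ≋ e zero
      inl-e0 zero    = refl
      inl-e0 (suc i) with splitAt k i
      ... | inj₁ j = refl
      ... | inj₂ j = refl

      inl-shift : ∀ v → inl {suc k} {c} ▹ (shift ▹ v) ≋ shift ▹ (inl {k} {c} ▹ v)
      inl-shift v zero    = refl
      inl-shift v (suc i) with splitAt k i
      ... | inj₁ j = refl
      ... | inj₂ j = refl

      inr-shift : ∀ v → inr (suc k) {c} ▹ v ≋ shift ▹ (inr k {c} ▹ v)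
      inr-shift v zero    = refl
      inr-shift v (suc i) with splitAt k i
      ... | inj₁ j = refl
      ... | inj₂ j = refl

      trPW : ∀ {n l} {X Y Z : Vec (V n) l} → Pointwise _≋_ X Y → Pointwise _≋_ Y Z → Pointwise _≋_ X Z
      trPW = Pointwise.trans (λ p q i → trans (p i) (q i))

      map-shift : ∀ {n l} {X Y : Vec (V n) l} → Pointwise _≋_ X Y → Pointwise _≋_ (map (shift ▹_) X) (map (shift ▹_) Y)
      map-shift []       = []
      map-shift (p ∷ ps) = ▹-cong shift p ∷ map-shift ps

-- Fitting ideals of extensions

module Regular (R : CommutativeRing 0ℓ 0ℓ) where
  open CommutativeRing R hiding (zero)
  open RingProperties ring
  open Fractions R using (IsRegular) public
  open Exp semiring using (_^_)
  open Linear R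
  open Alternating R
  open Blocks R
  open Solver R using (solve; :0; _:+_; _:*_; _:-_; :-_; _:=_)
  open SetoidReasoning setoid
  private
    variable
      a k m n : ℕ

  regular-cancel : ∀ {s} → IsRegular s → ∀ x y → s * x ≈ s * y → x ≈ y
  regular-cancel {s} s-reg x y sx≈sy = begin
    x            ≈⟨ solve 2 (λ x y → x := (x :- y) :+ y) refl x y ⟩
    (x - y) + y  ≈⟨ +-congʳ (s-reg (x - y) (begin
        s * (x - y)    ≈⟨ solve 3 (λ s x y → s :* (x :- y) := s :* x :- s :* y) refl s x y ⟩
        s * x - s * y  ≈⟨ +-congʳ sx≈sy ⟩
        s * y - s * y  ≈⟨ -‿inverseʳ _ ⟩
        0#             ∎)) ⟩
    0# + y       ≈⟨ +-identityˡ y ⟩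
    y            ∎

  regular-1 : IsRegular 1#
  regular-1 r p = trans (sym (*-identityˡ r)) p

  regular-* : ∀ {s t} → IsRegular s → IsRegular t → IsRegular (s * t)
  regular-* s-reg t-reg r p = t-reg r (s-reg _ (trans (sym (*-assoc _ _ _)) p))

  regular-^ : ∀ {s} → IsRegular s → ∀ n → IsRegular (s ^ n)
  regular-^ s-reg zero    = regular-1
  regular-^ s-reg (suc n) = regular-* s-reg (regular-^ s-reg n)

  regular-resp : ∀ {s t} → s ≈ t → IsRegular s → IsRegular t
  regular-resp s≈t s-reg r p = s-reg r (trans (*-congʳ s≈t) p)

  regular-factor : ∀ s t → IsRegular (s * t) → IsRegular s
  regular-factor s t st-reg r p = st-reg r (trans (solve 3 (λ s t r → (s :* t) :* r := t :* (s :* r)) refl s t r)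
    (trans (*-congˡ p) (zeroʳ t)))

  ⊡-cancel : ∀ {d} → IsRegular d → {u v : V n} → d ⊡ u ≋ d ⊡ v → u ≋ v
  ⊡-cancel d-reg p i = regular-cancel d-reg _ _ (p i)

  form-scale : ∀ d {F : Form n m} → Alt F → ∀ X → F (map (d ⊡_) X) ≈ d ^ m * F X
  form-scale d altF [] = sym (*-identityˡ _)
  form-scale d (lin , _ , rest) (v ∷ X) = trans (first-* lin d v _)
    (trans (*-congˡ (form-scale d (rest v) X)) (sym (*-assoc _ _ _)))

  RowRelated : Carrier → Lin a k → V (k ℕ.+ a) → V (k ℕ.+ a) → Set
  RowRelated {k = k} d L z z′ =
    (pr₂ k ▹ z ≋ pr₂ k ▹ z′) × (d ⊡ (pr₁ k ▹ z) ≋ d ⊡ (pr₁ k ▹ z′) ⊹ L ▹ (pr₂ k ▹ z′))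

  -- The row operation x = x′ + d⁻¹ L u over the total ring of fractions.
  det-row-operation : ∀ {d} → IsRegular d → (L : Lin a k) {Z Z′ : Vec (V (k ℕ.+ a)) (k ℕ.+ a)} →
    Pointwise (RowRelated d L) Z Z′ →
    ∃[ c ] det Z ≈ c * det Z′
  det-row-operation {a} {k} {d} d-reg L {Z} {Z′} Z~Z′ = t , regular-cancel s-reg _ _ (begin
      s * det Z                          ≈⟨ det-* S Z ⟨
      det (map (S ▹_) Z)                 ≈⟨ Alt-cong (det-Alt _) (related Z~Z′) ⟩
      det (map (T ▹_) (map (S ▹_) Z′))   ≈⟨ trans (det-* T _) (*-congˡ (det-* S _)) ⟩
      t * (s * det Z′)                   ≈⟨ solve 3 (λ t s x → t :* (s :* x) := s :* (t :* x)) refl t s _ ⟩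
      s * (t * det Z′)                   ∎)
    where
    -- `S` clears the denominator, so that S z = T (S z′) with T unipotent over R. Since S S′ = d,
    -- the determinant of S divides a power of d and is therefore regular.
    S S′ T : Lin (k ℕ.+ a) (k ℕ.+ a)
    S  = (scaleᴸ d ∘ᴸ pr₁ k) ⊕ᴸ pr₂ k
    S′ = pr₁ k ⊕ᴸ (scaleᴸ d ∘ᴸ pr₂ k)
    T  = (pr₁ k +ᴸ L ∘ᴸ pr₂ k) ⊕ᴸ pr₂ k

    s s′ t : Carrier
    s  = det (map (S ▹_) (basisVec _))
    s′ = det (map (S′ ▹_) (basisVec _))
    t  = det (map (T ▹_) (basisVec _))

    SS′ : ∀ z → S ▹ (S′ ▹ z) ≋ d ⊡ z
    SS′ z = ⊕-ext k
      (λ i → trans (pr₁-⊕ {k} _ _ i) (*-congˡ (pr₁-⊕ {k} _ _ i)))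
      (λ i → trans (pr₂-⊕ {k} _ _ i) (pr₂-⊕ {k} _ _ i))

    s-reg : IsRegular s
    s-reg = regular-factor s s′ (regular-resp (begin
      d ^ (k ℕ.+ a) * 1#                                 ≈⟨ *-congˡ (det-basis (k ℕ.+ a)) ⟨
      d ^ (k ℕ.+ a) * det (basisVec (k ℕ.+ a))           ≈⟨ form-scale d {det {k ℕ.+ a}} (det-Alt _) (basisVec (k ℕ.+ a)) ⟨
      det (map (d ⊡_) (basisVec (k ℕ.+ a)))              ≈⟨ Alt-cong {F = det {k ℕ.+ a}} (det-Alt _) (map-≋ SS′ (basisVec (k ℕ.+ a))) ⟨
      det (map (λ z → S ▹ (S′ ▹ z)) (basisVec (k ℕ.+ a)))
        ≈⟨ reflexive (≡.cong det (Vec.map-∘ (S ▹_) (S′ ▹_) (basisVec (k ℕ.+ a)))) ⟩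
      det (map (S ▹_) (map (S′ ▹_) (basisVec (k ℕ.+ a)))) ≈⟨ det-* S _ ⟩
      s * s′                                              ∎)
      (regular-* (regular-^ d-reg (k ℕ.+ a)) regular-1))

    related : ∀ {l} {Z Z′ : Vec (V (k ℕ.+ a)) l} →
      Pointwise (RowRelated d L) Z Z′ →
      Pointwise _≋_ (map (S ▹_) Z) (map (T ▹_) (map (S ▹_) Z′))
    related [] = []
    related {Z = z ∷ _} {Z′ = z′ ∷ _} ((p , q) ∷ ps) = ⊕-ext k
        (λ i → trans (pr₁-⊕ {k} _ _ i) (trans (q i) (sym (trans (pr₁-⊕ {k} _ _ i)
          (+-cong (pr₁-⊕ {k} _ _ i) (▹-cong L (pr₂-⊕ {k} _ _) i))))))
        (λ i → trans (pr₂-⊕ {k} _ _ i) (trans (p i) (sym (trans (pr₂-⊕ {k} _ _ i) (pr₂-⊕ {k} _ _ i)))))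
      ∷ related ps

-- A matrix factorisation h S = d with S h divisible by d.  It exhibits coker h as
-- a module killed by d whose relation module im h is projective: S / d is a
-- section of h over im h.
module Factorisations (R : CommutativeRing 0ℓ 0ℓ) where
  open CommutativeRing R hiding (zero)
  open Linear R
  open Blocks R
  open Regular R

  record Good (d : Carrier) (n : ℕ) : Set where
    field
      {cols} : ℕ
      h  : Lin cols n
      S  : Lin n cols
      hS : ∀ v → h ▹ (S ▹ v) ≋ d ⊡ v
      Sh : ∀ w → ∃[ w′ ] S ▹ (h ▹ w) ≋ d ⊡ w′
  open Good public

  relations : ∀ {d n} → Good d n → Sub n
  relations G = im (h G)

  -- If u = h w′, then S u = S h w′ = d w for some w, and d (h w) = h S u = d u; now cancel d. The
  -- element w = S u / d is determined by u.
  section : ∀ {d n} → IsRegular d → (G : Good d n) → ∀ {u} → u ∈ₛ relations G →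
            ∃[ w ] (S G ▹ u ≋ d ⊡ w) × (h G ▹ w ≋ u)
  section {d} d-reg G {u} (w′ , p) with Sh G w′
  ... | w , q = w , Su≋dw , ⊡-cancel d-reg
          (λ i → trans (sym (▹-* (h G) d w i)) (trans (sym (▹-cong (h G) Su≋dw i)) (hS G u i)))
    where
    Su≋dw : S G ▹ u ≋ d ⊡ w
    Su≋dw i = trans (▹-cong (S G) (λ j → sym (p j)) i) (q i)

module Fitting (R : CommutativeRing 0ℓ 0ℓ) (𝓐 : RAlgebra R) where
  open RAlgebra 𝓐 using (A; ι)
  open CommutativeRing A hiding (zero)

  private
    module R = CommutativeRing R
    variable
      a b c k m n p q : ℕ
  open Linear R
  open Alternating R
  open Minors R
  open Blocks R
  open Products R
  open Regular R
  open Factorisations R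
  open Submodules R 𝓐 public
  open Exp R.semiring using (_^_)
  private
    module 𝓜 = CommutativeMonoid commutativeMonoid

  Fit : Sub n → FI
  Fit U = span M (λ x → ∃[ X ] All (_∈ₛ U) X × x ≈ ι (det X))

  Fit-gen : (U : Sub n) → ∀ {X} → All (_∈ₛ U) X → ι (det X) ∈ₛ Fit U
  Fit-gen U X∈ = span-gen (_ , X∈ , refl)

  Fit-⊆ : (U : Sub n) (I : FI) → (∀ {X} → All (_∈ₛ U) X → ι (det X) ∈ₛ I) → Fit U ⊆ I
  Fit-⊆ U I gen = span-⊆ {I = I} λ (X , X∈ , x≈) → resp I (sym x≈) (gen X∈)

  ι-ideal : (I : FI) → IsIdeal (λ r → ι r ∈ₛ I)
  ι-ideal I = record
    { J-resp = λ r≈s → resp I (ι-cong r≈s)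
    ; J-0    = resp I (sym ι-0) (0-closed I)
    ; J-+    = λ p q → resp I (sym (ι-+ _ _)) (+-closed I p q)
    ; J-*    = λ r p → resp I (sym (ι-* _ _)) (*ₗ-closed I r p)
    }

  Fit-multiple : (U : Sub n) → ∀ {X} → All (_∈ₛ U) X → ∀ {r s} → r R.≈ s R.* det X → ι r ∈ₛ Fit U
  Fit-multiple U X∈ r≈ = J-resp (R.sym r≈) (J-* _ (Fit-gen U X∈))
    where open IsIdeal (ι-ideal (Fit U))

  All-map : (T : Lin a b) {U : Sub a} {U′ : Sub b} → (∀ {u} → u ∈ₛ U → T ▹ u ∈ₛ U′) →
            ∀ {l} {X : Vec (V a) l} → All (_∈ₛ U) X → All (_∈ₛ U′) (map (T ▹_) X)
  All-map T T∈ []       = []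
  All-map T {U} {U′} T∈ {X = u ∷ _} (p ∷ ps) = T∈ {u} p ∷ All-map T {U} {U′} T∈ ps

  Fit-cong-⊆ : {U U′ : Sub n} → (∀ {v} → v ∈ₛ U → v ∈ₛ U′) → Fit U ⊆ Fit U′
  Fit-cong-⊆ {U = U} {U′} U⊆U′ = Fit-⊆ U (Fit U′) (λ X∈ → Fit-gen U′ (All.map U⊆U′ X∈))

  Fit-iso-⊆ : {U : Sub n} {U′ : Sub m} → n ≡ m → (T : Lin n m) (T′ : Lin m n) →
              (∀ v → T′ ▹ (T ▹ v) ≋ v) → (∀ {u} → u ∈ₛ U → T ▹ u ∈ₛ U′) → Fit U ⊆ Fit U′
  Fit-iso-⊆ {U = U} {U′} ≡.refl T T′ T′T T∈ = Fit-⊆ U (Fit U′) λ {X} X∈ →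
    Fit-multiple U′ (All-map T {U} {U′} T∈ X∈) (begin
      det X                                  ≈⟨ Alt-cong (det-Alt _) (identity X) ⟨
      det (map (λ v → T′ ▹ (T ▹ v)) X)       ≡⟨ ≡.cong det (Vec.map-∘ (T′ ▹_) (T ▹_) X) ⟩
      det (map (T′ ▹_) (map (T ▹_) X))       ≈⟨ det-* T′ _ ⟩
      det (map (T′ ▹_) (basisVec _)) R.* det (map (T ▹_) X) ∎)
    where
    open SetoidReasoning R.setoid
    identity : ∀ {l} (X : Vec (V _) l) → Pointwise _≋_ (map (λ v → T′ ▹ (T ▹ v)) X) X
    identity []      = []
    identity (v ∷ X) = T′T v ∷ identity X

  Fit-iso : {U : Sub n} {U′ : Sub m} → n ≡ m → (T : Lin n m) (T′ : Lin m n) →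
            (∀ v → T′ ▹ (T ▹ v) ≋ v) → (∀ v → T ▹ (T′ ▹ v) ≋ v) →
            (∀ {u} → u ∈ₛ U → T ▹ u ∈ₛ U′) → (∀ {u} → u ∈ₛ U′ → T′ ▹ u ∈ₛ U) → Fit U ≐ Fit U′
  Fit-iso {U = U} {U′} n≡m T T′ T′T TT′ T∈ T′∈ = mk≐
    (Fit-iso-⊆ {U = U} {U′} n≡m T T′ T′T T∈) (Fit-iso-⊆ {U = U′} {U} (≡.sym n≡m) T′ T TT′ T′∈)

  Fit-cong : {U U′ : Sub n} → (∀ {v} → v ∈ₛ U → v ∈ₛ U′) → (∀ {v} → v ∈ₛ U′ → v ∈ₛ U) → Fit U ≐ Fit U′
  Fit-cong {U = U} {U′} p q = mk≐ (Fit-cong-⊆ {U = U} {U′} p) (Fit-cong-⊆ {U = U′} {U} q)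

  -- After multilinear expansion a term has p vectors from U and q from U′. If p ≠ k, one block has
  -- more vectors than its rank and the term vanishes; if p = k, it is a product of two minors.
  Fit-⊠ : (U : Sub k) (U′ : Sub c) → Fit (U ⊠ U′) ≐ Fit U · Fit U′
  Fit-⊠ {k} {c} U U′ = mk≐
    (Fit-⊆ (U ⊠ U′) UU′ λ Z∈ → expand-sums ideal U U′ inl (inr k) (det-Alt (k ℕ.+ c)) sorted
      (All.map (λ {z} (p , q) → _ , _ , p , q , inl-inr k z) Z∈))
    (span-⊆ {I = L} λ (x , y , x∈ , y∈ , z≈) → resp L (sym z≈)
      (Fit-⊆ U (L ∶ y) (λ {X} X∈ → resp L (*-comm _ _) (Fit-⊆ U′ (L ∶ ι (det X)) (λ {Y} Y∈ →
        resp L (trans (ι-* _ _) (*-comm _ _)) (resp L (ι-cong (det-block X Y))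
          (Fit-gen (U ⊠ U′) (All-++ (All-map inl {U} {U ⊠ U′} left X∈) (All-map (inr k) {U′} {U ⊠ U′} right Y∈)))))
        y∈)) x∈))
    where
    UU′ L : FI
    UU′ = Fit U · Fit U′
    L   = Fit (U ⊠ U′)
    ideal : IsIdeal (λ r → ι r ∈ₛ UU′)
    ideal = ι-ideal UU′
    open IsIdeal ideal

    All-++ : ∀ {l l′} {X : Vec (V n) l} {Y : Vec (V n) l′} {P : V n → Set} → All P X → All P Y → All P (X ++ Y)
    All-++ []       qs = qs
    All-++ (p ∷ ps) qs = p ∷ All-++ ps qs

    left : ∀ {u} → u ∈ₛ U → inl ▹ u ∈ₛ U ⊠ U′
    left {u} u∈ = resp U (λ i → R.sym (pr₁-⊕ u (𝟎 {c}) i)) u∈ , resp U′ (λ i → R.sym (pr₂-⊕ u (𝟎 {c}) i)) (0-closed U′)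

    right : ∀ {u} → u ∈ₛ U′ → inr k ▹ u ∈ₛ U ⊠ U′
    right {u} u∈ = resp U (λ i → R.sym (pr₁-⊕ (𝟎 {k}) u i)) (0-closed U) , resp U′ (λ i → R.sym (pr₂-⊕ (𝟎 {k}) u i)) u∈

    vanishing : ∀ {l l′} (F : Form l l′) → Alt F → l ℕ.< l′ → ∀ X → ι (F X) ∈ₛ UU′
    vanishing F altF l<l′ X = J-resp (R.sym (Alt-vanish F altF l<l′ X)) J-0

    sorted : ∀ {p q} (eq : p ℕ.+ q ≡ k ℕ.+ c) {X : Vec (V k) p} {Y : Vec (V c) q} →
             All (_∈ₛ U) X → All (_∈ₛ U′) Y → ι (det (cast eq (map (inl ▹_) X ++ map (inr k ▹_) Y))) ∈ₛ UU′
    sorted {p} {q} eq {X} {Y} X∈ Y∈ with ℕ.<-cmp k p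
    ... | tri< k<p _ _ = vanishing _
            (Alt-pull inl (Alt-fix-last (det-Alt (k ℕ.+ c)) (map (inr k ▹_) Y) eq)) k<p X
    -- As p + q = k + c, fewer than k vectors in the first block force more than c in the second.
    ... | tri> _ _ p<k = vanishing _
            (Alt-pull (inr k) (Alt-fix-first (det-Alt (k ℕ.+ c)) (map (inl ▹_) X) eq))
            (ℕ.+-cancelˡ-< p c q (≡.subst (p ℕ.+ c ℕ.<_) (≡.sym eq) (ℕ.+-monoˡ-< c p<k))) Y
    ... | tri≈ _ ≡.refl _ with ℕ.+-cancelˡ-≡ k q c eq
    ... | ≡.refl = J-resp
            (R.trans (R.sym (det-block X Y)) (R.reflexive (≡.cong (det {k ℕ.+ c}) (≡.sym (Vec.cast-is-id eq _)))))
            (resp UU′ (sym (ι-* _ _)) (·-gen (Fit U) (Fit U′) (Fit-gen U X∈) (Fit-gen U′ Y∈)))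

  Fit-full : ∀ n → Fit (full n) ≐ 𝟙
  Fit-full n = mk≐
    (Fit-⊆ (full n) 𝟙 λ {X} _ → resp 𝟙 (*-identityʳ _) (*ₗ-closed 𝟙 (det X) (span-gen refl)))
    (span-⊆ {I = Fit (full n)} λ x≈1 → resp (Fit (full n)) (trans (trans (ι-cong (det-basis n)) ι-1) (sym x≈1))
      (Fit-gen (full n) {basisVec n} (All.universal {P = λ _ → ⊤} (λ _ → _) (basisVec n))))

  Fit-scaled : ∀ d n → Fit (scaled d n) ≐ span M (λ x → x ≈ ι (d ^ n))
  Fit-scaled d n = mk≐
    (Fit-⊆ (scaled d n) L λ X∈ → let Y , p = divide X∈ in
      resp L (ι-cong (R.trans (R.*-comm _ _) (R.trans (R.sym (form-scale d {det {n}} (det-Alt n) Y)) (Alt-cong {F = det {n}} (det-Alt n) p))))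
        (resp L (sym (ι-* _ _)) (*ₗ-closed L (det Y) (span-gen refl))))
    (span-⊆ {I = Fit (scaled d n)} λ x≈ → resp (Fit (scaled d n))
      (trans (ι-cong (R.trans (form-scale d {det {n}} (det-Alt n) (basisVec n))
         (R.trans (R.*-congˡ {d ^ n} (det-basis n)) (R.*-identityʳ (d ^ n))))) (sym x≈))
      (Fit-gen (scaled d n) {map (d ⊡_) (basisVec n)} (multiples (basisVec n))))
    where
    L : FI
    L = span M (λ x → x ≈ ι (d ^ n))

    divide : ∀ {l} {X : Vec (V n) l} → All (_∈ₛ scaled d n) X → Σ[ Y ∈ Vec (V n) l ] Pointwise _≋_ (map (d ⊡_) Y) X
    divide []             = [] , []
    divide ((w , p) ∷ ps) = let Y , qs = divide ps in w ∷ Y , p ∷ qs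

    multiples : ∀ {l} (Y : Vec (V n) l) → All (_∈ₛ scaled d n) (map (d ⊡_) Y)
    multiples []      = []
    multiples (w ∷ Y) = (w , λ _ → R.refl) ∷ multiples Y

  transform : ∀ {P Q : V n → Set} {Rel : V n → V n → Set} → (∀ {z} → P z → ∃[ z′ ] Q z′ × Rel z z′) →
              ∀ {l} {Z : Vec (V n) l} → All P Z → Σ[ Z′ ∈ Vec (V n) l ] All Q Z′ × Pointwise Rel Z Z′
  transform f []       = [] , [] , []
  transform {P = P} {Q} {Rel} f (p ∷ ps) = let z′ , q , r = f p ; Z′ , qs , rs = transform {P = P} {Q} {Rel} f ps in z′ ∷ Z′ , q ∷ qs , r ∷ rs

  -- For 0 → M′ → M → P → 0 with M′ = Rᵏ / K, M = Rᵏ⁺ᵃ / W and P = coker h.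
  Fit-extension : ∀ {d} → IsRegular d → (W : Sub (k ℕ.+ a)) (K : Sub k) (G : Good d a) →
    (∀ {x} → x ∈ₛ K → inl ▹ x ∈ₛ W) → (∀ {x} → inl ▹ x ∈ₛ W → x ∈ₛ K) →
    (∀ {z} → z ∈ₛ W → pr₂ k ▹ z ∈ₛ relations G) → (∀ w → ∃[ x ] x ⊕ (h G ▹ w) ∈ₛ W) →
    Fit W ≐ Fit K · Fit (relations G)
  Fit-extension {k} {a} {d} d-reg W K G K⊆W W⊆K W→P lifts = 𝓜.trans (mk≐
      (Fit-⊆ W (Fit (K ⊠ U)) λ Z∈ →
        let Z′ , Z′∈ , rel = transform {P = _∈ₛ W} {Q = _∈ₛ (K ⊠ U)} {Rel = RowRelated d (β ∘ᴸ S G)} (λ {z} → split {z}) Z∈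
            _ , eq = det-row-operation d-reg (β ∘ᴸ S G) rel
        in Fit-multiple (K ⊠ U) Z′∈ eq)
      (Fit-⊆ (K ⊠ U) (Fit W) λ Z∈ →
        let Z′ , Z′∈ , rel = transform {P = _∈ₛ (K ⊠ U)} {Q = _∈ₛ W} {Rel = RowRelated d (-ᴸ (β ∘ᴸ S G))} (λ {z} → merge {z}) Z∈
            _ , eq = det-row-operation d-reg (-ᴸ (β ∘ᴸ S G)) rel
        in Fit-multiple W Z′∈ eq))
      (Fit-⊠ K U)
    where
    U : Sub a
    U = relations G
    open Solver R using (solve; :0; _:+_; _:*_; _:-_; :-_; _:=_)

    add-back : ∀ r x y → r R.* (x R.- y) R.+ r R.* y R.≈ r R.* x
    add-back = solve 3 (λ r x y → r :* (x :- y) :+ r :* y := r :* x) R.refl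

    take-away : ∀ r x y → r R.* (x R.+ y) R.- r R.* y R.≈ r R.* x
    take-away = solve 3 (λ r x y → r :* (x :+ y) :- r :* y := r :* x) R.refl

    -- The lift (β w , h w) of h w to W is linear in w. A relation u of P is thus lifted by β (S u /
    -- d), whose numerator β S is a matrix over R.
    β : Lin (cols G) k
    β = proj₁ (lift-linear W (h G) (λ j → lifts (e j)))

    β∈ : ∀ w → (β ▹ w) ⊕ (h G ▹ w) ∈ₛ W
    β∈ = proj₂ (lift-linear W (h G) (λ j → lifts (e j)))

    dβ : ∀ {u w} → S G ▹ u ≋ d ⊡ w → d ⊡ (β ▹ w) ≋ β ▹ (S G ▹ u)
    dβ p i = R.sym (R.trans (▹-cong β p i) (▹-* β d _ i))

    -- Subtract from z = (x , u) the lift of u: the remainder has second block 0, so it comes from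
    -- K. `merge` adds the lift back, which is the opposite row operation.
    split : ∀ {z} → z ∈ₛ W → ∃[ z′ ] z′ ∈ₛ (K ⊠ U) × RowRelated d (β ∘ᴸ S G) z z′
    split {z} z∈ = x ⊕ u
        , (resp K (λ i → R.sym (pr₁-⊕ x u i)) (W⊆K (resp W
             (⊕-ext k
               (λ i → R.trans (R.+-congˡ (R.-‿cong (pr₁-⊕ _ _ i))) (R.sym (pr₁-⊕ x (𝟎 {a}) i)))
               (λ i → R.trans (R.+-congˡ (R.-‿cong (R.trans (pr₂-⊕ {k} _ _ i) (hw i))))
                        (R.trans (R.-‿inverseʳ _) (R.sym (pr₂-⊕ x (𝟎 {a}) i)))))
             (-closed W z∈ (β∈ w))))
          , resp U (λ i → R.sym (pr₂-⊕ x u i)) (W→P z∈))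
        , (λ i → R.sym (pr₂-⊕ x u i))
        , λ i → R.sym (R.trans (R.+-cong (R.*-congˡ (pr₁-⊕ x u i))
            (R.trans (▹-cong (β ∘ᴸ S G) (pr₂-⊕ x u) i) (R.sym (dβ Su i))))
            (add-back d ((pr₁ k ▹ z) i) ((β ▹ w) i)))
      where
      u : V a
      u = pr₂ k ▹ z
      w : V (cols G)
      w = proj₁ (section d-reg G (W→P {z} z∈))
      Su : S G ▹ u ≋ d ⊡ w
      Su = proj₁ (proj₂ (section d-reg G (W→P {z} z∈)))
      hw : h G ▹ w ≋ u
      hw = proj₂ (proj₂ (section d-reg G (W→P {z} z∈)))
      x : V k
      x i = (pr₁ k ▹ z) i R.- (β ▹ w) i

    merge : ∀ {z} → z ∈ₛ (K ⊠ U) → ∃[ z′ ] z′ ∈ₛ W × RowRelated d (-ᴸ (β ∘ᴸ S G)) z z′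
    merge {z} (x∈ , u∈) = x ⊕ u
        , resp W (⊕-ext k
             (λ i → R.trans (R.+-cong (pr₁-⊕ _ _ i) (pr₁-⊕ _ _ i)) (R.sym (pr₁-⊕ x u i)))
             (λ i → R.trans (R.+-cong (pr₂-⊕ {k} _ (𝟎 {a}) i) (R.trans (pr₂-⊕ {k} _ _ i) (hw i)))
                      (R.trans (R.+-identityˡ _) (R.sym (pr₂-⊕ x u i)))))
           (+-closed W (K⊆W x∈) (β∈ w))
        , (λ i → R.sym (pr₂-⊕ x u i))
        , λ i → R.sym (R.trans (R.+-cong (R.*-congˡ (pr₁-⊕ x u i))
            (R.-‿cong (R.trans (▹-cong (β ∘ᴸ S G) (pr₂-⊕ x u) i) (R.sym (dβ Su i)))))
            (take-away d ((pr₁ k ▹ z) i) ((β ▹ w) i)))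
      where
      u : V a
      u = pr₂ k ▹ z
      w : V (cols G)
      w = proj₁ (section d-reg G u∈)
      Su : S G ▹ u ≋ d ⊡ w
      Su = proj₁ (proj₂ (section d-reg G u∈))
      hw : h G ▹ w ≋ u
      hw = proj₂ (proj₂ (section d-reg G u∈))
      x : V k
      x = pr₁ k ▹ z ⊹ β ▹ w

-- The kernel P̃ and its matrix factorisation

module Syzygies (R : CommutativeRing 0ℓ 0ℓ) where
  open CommutativeRing R hiding (zero)
  open RingProperties ring
  open Linear R
  open Blocks R
  open Regular R
  open Factorisations R
  open Solver R using (solve; :0; _:+_; _:*_; _:-_; :-_; _:=_)
  private
    variable
      a b c k m n : ℕ

  scaled⊆relations : ∀ {d} (G : Good d n) {v} → v ∈ₛ scaled d n → v ∈ₛ relations G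
  scaled⊆relations G (w , p) = S G ▹ w , λ i → trans (hS G w i) (p i)

  -- The module P = Rᵏ⁺ᶜ / relations G is an extension of Rᶜ / V by Rᵏ / K, with
  -- V = pr₂ (relations G) and K = relations G ∩ Rᵏ, and X ⊆ Rᵏ′⁺ᵏ lies over K.
  -- Since ζ maps Rᵐ onto V, Rᵐ generates Z = V / dRᶜ, and X̃ consists of the
  -- relations of the kernel of Rᵏ′⁺ᵏ / X ⊕ Rᶜ / dRᶜ → P, which covers Z.
  record Covering {d} (G : Good d (k ℕ.+ c)) (k′ m : ℕ) : Set₁ where
    field
      X    : Sub (k′ ℕ.+ k)
      η    : Lin m k
      ζ    : Lin m c
      ηζ∈  : ∀ w → (η ▹ w) ⊕ (ζ ▹ w) ∈ₛ relations G
      onto : ∀ {u} → u ∈ₛ relations G → ∃[ w ] ζ ▹ w ≋ pr₂ k ▹ u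
      X→K  : ∀ {z} → z ∈ₛ X → inl {k} {c} ▹ (pr₂ k′ ▹ z) ∈ₛ relations G
      K→X  : ∀ {y} → inl {k} {c} ▹ y ∈ₛ relations G → ∃[ x ] x ⊕ y ∈ₛ X

  module Cover {d} (d-reg : IsRegular d) {k′} (G : Good d (k ℕ.+ c)) (cov : Covering {k} {c} G k′ m) where
    open Covering cov

    Z : Sub m
    Z = preimage ζ (scaled d c)

    T̃ : Lin (k′ ℕ.+ m) ((k′ ℕ.+ k) ℕ.+ c)
    T̃ = (pr₁ k′ ⊕ᴸ η ∘ᴸ pr₂ k′) ⊕ᴸ (ζ ∘ᴸ pr₂ k′)

    X̃ : Sub (k′ ℕ.+ m)
    X̃ = preimage T̃ (X ⊠ scaled d c)

    private
      p₁ : Lin ((k′ ℕ.+ m) ℕ.+ (k ℕ.+ c)) k′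
      p₁ = pr₁ k′ ∘ᴸ pr₁ (k′ ℕ.+ m)
      p₂ : Lin ((k′ ℕ.+ m) ℕ.+ (k ℕ.+ c)) m
      p₂ = pr₂ k′ ∘ᴸ pr₁ (k′ ℕ.+ m)
      p₃ : Lin ((k′ ℕ.+ m) ℕ.+ (k ℕ.+ c)) k
      p₃ = pr₁ k ∘ᴸ pr₂ (k′ ℕ.+ m)
      p₄ : Lin ((k′ ℕ.+ m) ℕ.+ (k ℕ.+ c)) c
      p₄ = pr₂ k ∘ᴸ pr₂ (k′ ℕ.+ m)

    T : Lin ((k′ ℕ.+ m) ℕ.+ (k ℕ.+ c)) ((k′ ℕ.+ k) ℕ.+ c)
    T = (p₁ ⊕ᴸ (p₃ +ᴸ η ∘ᴸ p₂)) ⊕ᴸ (p₄ +ᴸ ζ ∘ᴸ p₂)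

    -- With P′ = Rᵏ′⁺ᵏ / X, these are the relations of P′ ⊕ (R/d)ᶜ on a redundant generating set:
    -- the generators of the kernel P̃ followed by lifts of the generators of P. This is the shape
    -- required by `Fit-extension`.
    W : Sub ((k′ ℕ.+ m) ℕ.+ (k ℕ.+ c))
    W = preimage T (X ⊠ scaled d c)

    T-inl : ∀ u → T ▹ (inl ▹ u) ≋ T̃ ▹ u
    T-inl u = ⊕-cong
      (⊕-cong (λ i → pr₁-⊕ u 𝟎 _)
        (λ i → trans (+-cong (pr₂-⊕ {k′ ℕ.+ m} u (𝟎 {k ℕ.+ c}) _) (▹-cong η (λ j → pr₁-⊕ u (𝟎 {k ℕ.+ c}) _) i)) (+-identityˡ _)))
      (λ i → trans (+-cong (pr₂-⊕ {k′ ℕ.+ m} u (𝟎 {k ℕ.+ c}) _) (▹-cong ζ (λ j → pr₁-⊕ u (𝟎 {k ℕ.+ c}) _) i)) (+-identityˡ _))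

    X̃⇒W : ∀ {u} → u ∈ₛ X̃ → inl ▹ u ∈ₛ W
    X̃⇒W {u} = resp (X ⊠ scaled d c) {T̃ ▹ u} {T ▹ (inl ▹ u)} (λ i → sym (T-inl u i))

    W⇒X̃ : ∀ {u} → inl ▹ u ∈ₛ W → u ∈ₛ X̃
    W⇒X̃ {u} = resp (X ⊠ scaled d c) {T ▹ (inl ▹ u)} {T̃ ▹ u} (T-inl u)

    -- Write w, y, t for the blocks `p₂`, `p₃`, `p₄` of z. Then y + η w lies in K and t + ζ w in
    -- dRᶜ, so (y + η w , t + ζ w) is a relation of P; subtract the relation (η w , ζ w).
    W⇒relations : ∀ {z} → z ∈ₛ W → pr₂ (k′ ℕ.+ m) ▹ z ∈ₛ relations G
    W⇒relations {z} (x∈ , y∈) = resp (relations G)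
      (⊕-ext k
        (λ i → trans (+-cong (trans (+-congʳ (pr₁-⊕ y (𝟎 {c}) i)) (+-congˡ (pr₁-⊕ {k} 𝟎 t i))) (-‿cong (pr₁-⊕ _ (ζ ▹ w) i)))
                 (cancel₁ ((p₃ ▹ z) i) ((η ▹ w) i)))
        (λ i → trans (+-cong (trans (+-congʳ (pr₂-⊕ y (𝟎 {c}) i)) (+-congˡ (pr₂-⊕ {k} 𝟎 t i))) (-‿cong (pr₂-⊕ (η ▹ w) _ i)))
                 (cancel₂ ((p₄ ▹ z) i) ((ζ ▹ w) i))))
      (-closed (relations G)
        (+-closed (relations G)
          (resp (relations G) (▹-cong inl (pr₂-⊕ {k′} (p₁ ▹ z) y)) (X→K x∈₁))
          (scaled⊆relations G (inr-scaled y∈₁)))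
        (ηζ∈ w))
      where
      w : V m
      w = p₂ ▹ z
      y : V k
      y = (p₃ +ᴸ η ∘ᴸ p₂) ▹ z
      t : V c
      t = (p₄ +ᴸ ζ ∘ᴸ p₂) ▹ z
      x∈₁ : (p₁ ▹ z) ⊕ y ∈ₛ X
      x∈₁ = resp X (pr₁-⊕ ((p₁ ▹ z) ⊕ y) t) x∈
      y∈₁ : t ∈ₛ scaled d c
      y∈₁ = resp (scaled d c) (pr₂-⊕ ((p₁ ▹ z) ⊕ y) t) y∈
      inr-scaled : ∀ {t} → t ∈ₛ scaled d c → inr k ▹ t ∈ₛ scaled d (k ℕ.+ c)
      inr-scaled {t} (s , p) = inr k ▹ s , λ i → trans (sym (▹-* (inr k) d s i)) (▹-cong (inr k) p i)
      cancel₁ : ∀ a b → ((a + b) + 0#) - b ≈ a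
      cancel₁ = solve 2 (λ a b → ((a :+ b) :+ :0) :- b := a) refl
      cancel₂ : ∀ a b → (0# + (a + b)) - b ≈ a
      cancel₂ = solve 2 (λ a b → (:0 :+ (a :+ b)) :- b := a) refl

    -- For v = (v₁ , v₂) choose w with ζ w = v₂. Then v₁ - η w lies in K and lifts to X through some
    -- x; the witness is (x , -w), whose sign cancels the last block.
    relations⇒W : ∀ {v} → v ∈ₛ relations G → ∃[ u ] u ⊕ v ∈ₛ W
    relations⇒W {v} v∈ = u
      , resp X {x ⊕ y} (λ i → sym (trans (pr₁-⊕ {k′ ℕ.+ k} ((p₁ ▹ z) ⊕ ((p₃ +ᴸ η ∘ᴸ p₂) ▹ z)) _ i)
          (⊕-cong {x = p₁ ▹ z} {x′ = x} first second i))) (proj₂ (K→X Ky))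
      , (𝟎 , λ i → trans (zeroʳ d) (sym (trans (pr₂-⊕ {k′ ℕ.+ k} ((p₁ ▹ z) ⊕ ((p₃ +ᴸ η ∘ᴸ p₂) ▹ z)) _ i)
          (trans (+-cong (pr₂-⊕ {k′ ℕ.+ m} u v _) (trans (▹-cong ζ w≋ i) (trans (▹-neg ζ w i) (-‿cong (ζw i))))) (-‿inverseʳ _)))))
      where
      w : V m
      w = proj₁ (onto v∈)
      ζw : ζ ▹ w ≋ pr₂ k ▹ v
      ζw = proj₂ (onto v∈)
      y : V k
      y i = (pr₁ k ▹ v) i - (η ▹ w) i
      Ky : inl ▹ y ∈ₛ relations G
      Ky = resp (relations G)
        (⊕-ext k (λ i → trans (+-congˡ (-‿cong (pr₁-⊕ (η ▹ w) (ζ ▹ w) i))) (sym (pr₁-⊕ y (𝟎 {c}) i)))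
                 (λ i → trans (+-congˡ (-‿cong (trans (pr₂-⊕ (η ▹ w) (ζ ▹ w) i) (ζw i))))
                          (trans (-‿inverseʳ _) (sym (pr₂-⊕ y (𝟎 {c}) i)))))
        (-closed (relations G) v∈ (ηζ∈ w))
      x : V k′
      x = proj₁ (K→X Ky)
      u : V (k′ ℕ.+ m)
      u = x ⊕ (λ j → - w j)
      z : V ((k′ ℕ.+ m) ℕ.+ (k ℕ.+ c))
      z = u ⊕ v
      w≋ : p₂ ▹ z ≋ (λ j → - w j)
      w≋ j = trans (pr₁-⊕ u v _) (pr₂-⊕ x (λ j → - w j) j)
      first : p₁ ▹ z ≋ x
      first j = trans (pr₁-⊕ u v _) (pr₁-⊕ x (λ j → - w j) j)
      second : (p₃ +ᴸ η ∘ᴸ p₂) ▹ z ≋ y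
      second i = +-cong (pr₂-⊕ {k′ ℕ.+ m} u v _)
        (trans (▹-cong η w≋ i) (▹-neg η w i))

    private
      λ̂ : Σ[ f ∈ Lin (cols G) (k′ ℕ.+ m) ] (∀ w → (f ▹ w) ⊕ (h G ▹ w) ∈ₛ W)
      λ̂ = lift-linear W (h G) (λ j → relations⇒W (e j , λ _ → refl))

    -- If Rᵏ′⁺ᵏ / X has a factorisation (g , T), then so has Rᵏ′⁺ᵐ / X̃: the
    -- relations of Rᵏ′⁺ᵏ / X ⊕ Rᶜ / dRᶜ map onto those of P, which are projective.
    module Factorise (Xg : Good d (k′ ℕ.+ k)) (X⊆ : ∀ {v} → v ∈ₛ X → v ∈ₛ relations Xg)
                     (X⊇ : ∀ {v} → v ∈ₛ relations Xg → v ∈ₛ X) where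

      private
        B : ℕ
        B = m ℕ.+ (cols Xg ℕ.+ c)

        q₁ : Lin B m
        q₁ = pr₁ m
        q₂ : Lin B (cols Xg)
        q₂ = pr₁ (cols Xg) ∘ᴸ pr₂ m
        q₃ : Lin B c
        q₃ = pr₂ (cols Xg) ∘ᴸ pr₂ m

        g₁ : Lin (cols Xg) k′
        g₁ = pr₁ k′ ∘ᴸ h Xg
        g₂ : Lin (cols Xg) k
        g₂ = pr₂ k′ ∘ᴸ h Xg

        -- Together with `Ψ₂` this parametrises W by a free module: (w , v , s) goes to the element
        -- with w-block w whose image under `T` is (h v , d s).
        Ψ₁ : Lin B (k′ ℕ.+ m)
        Ψ₁ = (g₁ ∘ᴸ q₂) ⊕ᴸ q₁
        Ψ₂ : Lin B (k ℕ.+ c)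
        Ψ₂ = (g₂ ∘ᴸ q₂ +ᴸ -ᴸ (η ∘ᴸ q₁)) ⊕ᴸ (scaleᴸ d ∘ᴸ q₃ +ᴸ -ᴸ (ζ ∘ᴸ q₁))

        Ψ∈W : ∀ b → (Ψ₁ ▹ b) ⊕ (Ψ₂ ▹ b) ∈ₛ W
        Ψ∈W b = resp X {h Xg ▹ (q₂ ▹ b)}
            (λ i → sym (trans (pr₁-⊕ {k′ ℕ.+ k} ((p₁ ▹ z) ⊕ ((p₃ +ᴸ η ∘ᴸ p₂) ▹ z)) _ i)
              (trans (⊕-cong first second i) (⊕-η k′ (h Xg ▹ (q₂ ▹ b)) i))))
            (X⊇ (q₂ ▹ b , λ _ → refl))
          , q₃ ▹ b , λ i → sym (trans (pr₂-⊕ {k′ ℕ.+ k} ((p₁ ▹ z) ⊕ ((p₃ +ᴸ η ∘ᴸ p₂) ▹ z)) _ i) (third i))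
          where
          z : V ((k′ ℕ.+ m) ℕ.+ (k ℕ.+ c))
          z = (Ψ₁ ▹ b) ⊕ (Ψ₂ ▹ b)
          w≋ : p₂ ▹ z ≋ q₁ ▹ b
          w≋ j = trans (pr₁-⊕ (Ψ₁ ▹ b) (Ψ₂ ▹ b) _) (pr₂-⊕ {k′} (g₁ ▹ (q₂ ▹ b)) (q₁ ▹ b) j)
          first : p₁ ▹ z ≋ pr₁ k′ ▹ (h Xg ▹ (q₂ ▹ b))
          first j = trans (pr₁-⊕ (Ψ₁ ▹ b) (Ψ₂ ▹ b) _) (pr₁-⊕ {k′} (g₁ ▹ (q₂ ▹ b)) (q₁ ▹ b) j)
          add-back : ∀ x y → (x - y) + y ≈ x
          add-back = solve 2 (λ x y → (x :- y) :+ y := x) refl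
          second : (p₃ +ᴸ η ∘ᴸ p₂) ▹ z ≋ pr₂ k′ ▹ (h Xg ▹ (q₂ ▹ b))
          second i = trans (+-cong (trans (pr₂-⊕ {k′ ℕ.+ m} (Ψ₁ ▹ b) (Ψ₂ ▹ b) _) (pr₁-⊕ {k} _ _ i)) (▹-cong η w≋ i))
                       (add-back _ _)
          third : (p₄ +ᴸ ζ ∘ᴸ p₂) ▹ z ≋ d ⊡ (q₃ ▹ b)
          third i = trans (+-cong (trans (pr₂-⊕ {k′ ℕ.+ m} (Ψ₁ ▹ b) (Ψ₂ ▹ b) _) (pr₂-⊕ {k} _ _ i)) (▹-cong ζ w≋ i))
                      (add-back _ _)

        -- The graph of S / d, so that `lift-linear` can perform the division by d linearly in b.
        quotients : Sub (cols G ℕ.+ (k ℕ.+ c))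
        quotients = record
          { Member    = λ z → S G ▹ (pr₂ (cols G) ▹ z) ≋ d ⊡ (pr₁ (cols G) ▹ z)
          ; resp      = λ z≋ p i → trans (▹-cong (S G) (λ j → sym (z≋ _)) i) (trans (p i) (*-congˡ (z≋ _)))
          ; 0-closed  = λ i → trans (▹-𝟎 (S G) i) (sym (zeroʳ d))
          ; +-closed  = λ p q i → trans (▹-+ (S G) _ _ i) (trans (+-cong (p i) (q i)) (sym (distribˡ d _ _)))
          ; *ₗ-closed = λ r p i → trans (▹-* (S G) r _ i) (trans (*-congˡ (p i)) (swap r d _))
          }
          where
          swap : ∀ r d x → r * (d * x) ≈ d * (r * x)
          swap = solve 3 (λ r d x → r :* (d :* x) := d :* (r :* x)) refl

        quotient-of : ∀ {v} → v ∈ₛ relations G → ∃[ s ] s ⊕ v ∈ₛ quotients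
        quotient-of {v} v∈ = s , λ i → trans (▹-cong (S G) (pr₂-⊕ s v) i)
            (trans (proj₁ (proj₂ (section d-reg G v∈)) i) (*-congˡ (sym (pr₁-⊕ s v i))))
          where
          s : V (cols G)
          s = proj₁ (section d-reg G v∈)

        Ψ₂∈ : ∀ b → Ψ₂ ▹ b ∈ₛ relations G
        Ψ₂∈ b = resp (relations G) (pr₂-⊕ (Ψ₁ ▹ b) (Ψ₂ ▹ b)) (W⇒relations {(Ψ₁ ▹ b) ⊕ (Ψ₂ ▹ b)} (Ψ∈W b))

        σ̂ : Σ[ f ∈ Lin B (cols G) ] (∀ b → (f ▹ b) ⊕ (Ψ₂ ▹ b) ∈ₛ quotients)
        σ̂ = lift-linear quotients Ψ₂ (λ j → quotient-of (Ψ₂∈ (e j)))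

        σ : Lin B (cols G)
        σ = proj₁ σ̂

        SΨ₂ : ∀ b → S G ▹ (Ψ₂ ▹ b) ≋ d ⊡ (σ ▹ b)
        SΨ₂ b i = trans (▹-cong (S G) (λ j → sym (pr₂-⊕ (σ ▹ b) (Ψ₂ ▹ b) j)) i)
                    (trans (proj₂ σ̂ b i) (*-congˡ (pr₁-⊕ (σ ▹ b) (Ψ₂ ▹ b) i)))

        hσ : ∀ b → h G ▹ (σ ▹ b) ≋ Ψ₂ ▹ b
        hσ b = ⊡-cancel d-reg λ i → trans (sym (▹-* (h G) d (σ ▹ b) i))
          (trans (▹-cong (h G) (λ j → sym (SΨ₂ b j)) i) (hS G (Ψ₂ ▹ b) i))

        -- Subtracts from Ψ the linear lift of its component Ψ₂ = h σ. This projects W onto X̃ along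
        -- the splitting over `relations G`.
        h̃ : Lin B (k′ ℕ.+ m)
        h̃ = Ψ₁ +ᴸ -ᴸ (proj₁ λ̂ ∘ᴸ σ)

        h̃∈X̃ : ∀ b → h̃ ▹ b ∈ₛ X̃
        h̃∈X̃ b = W⇒X̃ {h̃ ▹ b} (resp W
          {λ i → ((Ψ₁ ▹ b) ⊕ (Ψ₂ ▹ b)) i - ((proj₁ λ̂ ▹ (σ ▹ b)) ⊕ (h G ▹ (σ ▹ b))) i} {inl ▹ (h̃ ▹ b)}
          (⊕-ext (k′ ℕ.+ m)
            (λ i → trans (+-cong (pr₁-⊕ (Ψ₁ ▹ b) (Ψ₂ ▹ b) i) (-‿cong (pr₁-⊕ (proj₁ λ̂ ▹ (σ ▹ b)) (h G ▹ (σ ▹ b)) i)))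
                     (sym (pr₁-⊕ (h̃ ▹ b) (𝟎 {k ℕ.+ c}) i)))
            (λ i → trans (+-cong (pr₂-⊕ (Ψ₁ ▹ b) (Ψ₂ ▹ b) i)
                       (-‿cong (trans (pr₂-⊕ (proj₁ λ̂ ▹ (σ ▹ b)) (h G ▹ (σ ▹ b)) i) (hσ b i))))
                     (trans (-‿inverseʳ _) (sym (pr₂-⊕ (h̃ ▹ b) (𝟎 {k ℕ.+ c}) i)))))
          (-closed W {(Ψ₁ ▹ b) ⊕ (Ψ₂ ▹ b)} {(proj₁ λ̂ ▹ (σ ▹ b)) ⊕ (h G ▹ (σ ▹ b))}
            (Ψ∈W b) (proj₂ λ̂ (σ ▹ b))))

        T₁ : Lin (k′ ℕ.+ m) (k′ ℕ.+ k)
        T₁ = pr₁ k′ ⊕ᴸ η ∘ᴸ pr₂ k′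

        -- Chosen so that Ψ₁ S̃ = d and Ψ₂ S̃ = 0: for u = (x , w), the factorisation of X returns d
        -- (x , η w), and the terms d η w and d ζ w cancel against η (d w) and ζ (d w).
        S̃ : Lin (k′ ℕ.+ m) B
        S̃ = (scaleᴸ d ∘ᴸ pr₂ k′) ⊕ᴸ (S Xg ∘ᴸ T₁) ⊕ᴸ (ζ ∘ᴸ pr₂ k′)

        -- The first block is a multiple of d by construction, the second by `section` for the
        -- factorisation of X, the third because u ∈ X̃ puts ζ w into dRᶜ.
        S̃-divisible : ∀ {u} → u ∈ₛ X̃ → ∃[ b ] S̃ ▹ u ≋ d ⊡ b
        S̃-divisible {u} (x∈ , y∈) = (pr₂ k′ ▹ u) ⊕ s ⊕ t , λ i → trans
            (⊕-cong {m} {x = d ⊡ (pr₂ k′ ▹ u)} {d ⊡ (pr₂ k′ ▹ u)} {y = (S Xg ▹ (T₁ ▹ u)) ⊕ (ζ ▹ (pr₂ k′ ▹ u))} {d ⊡ (s ⊕ t)} (λ j → refl)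
              (λ j → trans (⊕-cong {x = S Xg ▹ (T₁ ▹ u)} {d ⊡ s} Ss ζt j) (⊕-* d s t j)) i)
            (⊕-* d (pr₂ k′ ▹ u) (s ⊕ t) i)
          where
          x∈₁ : T₁ ▹ u ∈ₛ relations Xg
          x∈₁ = resp (relations Xg) (pr₁-⊕ (T₁ ▹ u) (ζ ▹ (pr₂ k′ ▹ u))) (X⊆ x∈)
          y∈₁ : ζ ▹ (pr₂ k′ ▹ u) ∈ₛ scaled d c
          y∈₁ = resp (scaled d c) (pr₂-⊕ (T₁ ▹ u) (ζ ▹ (pr₂ k′ ▹ u))) y∈
          s : V (cols Xg)
          s = proj₁ (section d-reg Xg x∈₁)
          t : V c
          t = proj₁ y∈₁
          Ss : S Xg ▹ (T₁ ▹ u) ≋ d ⊡ s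
          Ss = proj₁ (proj₂ (section d-reg Xg x∈₁))
          ζt : ζ ▹ (pr₂ k′ ▹ u) ≋ d ⊡ t
          ζt i = sym (proj₂ y∈₁ i)

        h̃S̃ : ∀ u → h̃ ▹ (S̃ ▹ u) ≋ d ⊡ u
        h̃S̃ u i = trans (+-cong (Ψ₁S̃ i) (-‿cong (trans (▹-cong (proj₁ λ̂) σS̃ i) (▹-𝟎 (proj₁ λ̂) i)))) (lemma _)
          where
          lemma : ∀ x → x - 0# ≈ x
          lemma = solve 1 (λ x → x :- :0 := x) refl
          w≋ : q₁ ▹ (S̃ ▹ u) ≋ d ⊡ (pr₂ k′ ▹ u)
          w≋ = pr₁-⊕ (d ⊡ (pr₂ k′ ▹ u)) ((S Xg ▹ (T₁ ▹ u)) ⊕ (ζ ▹ (pr₂ k′ ▹ u)))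
          v≋ : q₂ ▹ (S̃ ▹ u) ≋ S Xg ▹ (T₁ ▹ u)
          v≋ j = trans (pr₂-⊕ (d ⊡ (pr₂ k′ ▹ u)) ((S Xg ▹ (T₁ ▹ u)) ⊕ (ζ ▹ (pr₂ k′ ▹ u))) _)
                   (pr₁-⊕ (S Xg ▹ (T₁ ▹ u)) (ζ ▹ (pr₂ k′ ▹ u)) j)
          t≋ : q₃ ▹ (S̃ ▹ u) ≋ ζ ▹ (pr₂ k′ ▹ u)
          t≋ j = trans (pr₂-⊕ (d ⊡ (pr₂ k′ ▹ u)) ((S Xg ▹ (T₁ ▹ u)) ⊕ (ζ ▹ (pr₂ k′ ▹ u))) _)
                   (pr₂-⊕ (S Xg ▹ (T₁ ▹ u)) (ζ ▹ (pr₂ k′ ▹ u)) j)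
          gS : h Xg ▹ (q₂ ▹ (S̃ ▹ u)) ≋ d ⊡ (T₁ ▹ u)
          gS j = trans (▹-cong (h Xg) v≋ j) (hS Xg (T₁ ▹ u) j)
          Ψ₁S̃ : Ψ₁ ▹ (S̃ ▹ u) ≋ d ⊡ u
          Ψ₁S̃ = ⊕-ext k′
            (λ j → trans (pr₁-⊕ {k′} _ _ j) (trans (gS _) (*-congˡ (pr₁-⊕ {k′} (pr₁ k′ ▹ u) _ j))))
            (λ j → trans (pr₂-⊕ {k′} _ _ j) (w≋ j))
          Ψ₂S̃ : Ψ₂ ▹ (S̃ ▹ u) ≋ 𝟎
          Ψ₂S̃ = ⊕-ext k
            (λ j → trans (pr₁-⊕ {k} _ _ j) (trans (+-cong
               (trans (gS _) (*-congˡ (pr₂-⊕ {k′} (pr₁ k′ ▹ u) _ j)))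
               (-‿cong (trans (▹-cong η w≋ j) (▹-* η d _ j)))) (-‿inverseʳ _)))
            (λ j → trans (pr₂-⊕ {k} _ _ j) (trans (+-cong (*-congˡ (t≋ j))
               (-‿cong (trans (▹-cong ζ w≋ j) (▹-* ζ d _ j)))) (-‿inverseʳ _)))
          σS̃ : σ ▹ (S̃ ▹ u) ≋ 𝟎
          σS̃ = ⊡-cancel d-reg λ j → trans (sym (SΨ₂ (S̃ ▹ u) j))
            (trans (▹-cong (S G) Ψ₂S̃ j) (trans (▹-𝟎 (S G) j) (sym (zeroʳ d))))

      X̃-good : Good d (k′ ℕ.+ m)
      X̃-good = record { h = h̃ ; S = S̃ ; hS = h̃S̃ ; Sh = λ b → S̃-divisible {h̃ ▹ b} (h̃∈X̃ b) }

      good⊆X̃ : ∀ {u} → u ∈ₛ relations X̃-good → u ∈ₛ X̃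
      good⊆X̃ {u} (b , p) = resp X̃ {h̃ ▹ b} {u} p (h̃∈X̃ b)

      X̃⊆good : ∀ {u} → u ∈ₛ X̃ → u ∈ₛ relations X̃-good
      X̃⊆good {u} u∈ = proj₁ quot , ⊡-cancel d-reg λ i → trans (sym (▹-* h̃ d (proj₁ quot) i))
          (trans (▹-cong h̃ (λ j → sym (proj₂ quot j)) i) (h̃S̃ u i))
        where
        quot : ∃[ b ] S̃ ▹ u ≋ d ⊡ b
        quot = S̃-divisible {u} u∈

    private
      r₁ : Lin (m ℕ.+ ((k′ ℕ.+ k) ℕ.+ c)) m
      r₁ = pr₁ m
      r₂ : Lin (m ℕ.+ ((k′ ℕ.+ k) ℕ.+ c)) k′
      r₂ = pr₁ k′ ∘ᴸ pr₁ (k′ ℕ.+ k) ∘ᴸ pr₂ m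
      r₃ : Lin (m ℕ.+ ((k′ ℕ.+ k) ℕ.+ c)) k
      r₃ = pr₂ k′ ∘ᴸ pr₁ (k′ ℕ.+ k) ∘ᴸ pr₂ m
      r₄ : Lin (m ℕ.+ ((k′ ℕ.+ k) ℕ.+ c)) c
      r₄ = pr₂ (k′ ℕ.+ k) ∘ᴸ pr₂ m

    -- Keeping the redundant coordinate w beside `T` makes the map invertible. In the new
    -- coordinates W is a product, so its Fitting ideal can be read off.
    Φ : Lin ((k′ ℕ.+ m) ℕ.+ (k ℕ.+ c)) (m ℕ.+ ((k′ ℕ.+ k) ℕ.+ c))
    Φ = p₂ ⊕ᴸ T

    Φ⁻¹ : Lin (m ℕ.+ ((k′ ℕ.+ k) ℕ.+ c)) ((k′ ℕ.+ m) ℕ.+ (k ℕ.+ c))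
    Φ⁻¹ = (r₂ ⊕ᴸ r₁) ⊕ᴸ ((r₃ +ᴸ -ᴸ (η ∘ᴸ r₁)) ⊕ᴸ (r₄ +ᴸ -ᴸ (ζ ∘ᴸ r₁)))

    private
      add-back : ∀ x y → (x - y) + y ≈ x
      add-back = solve 2 (λ x y → (x :- y) :+ y := x) refl
      take-away : ∀ x y → (x + y) - y ≈ x
      take-away = solve 2 (λ x y → (x :+ y) :- y := x) refl

      module _ (z : V ((k′ ℕ.+ m) ℕ.+ (k ℕ.+ c))) where
        pr₂Φ : pr₂ m ▹ (Φ ▹ z) ≋ T ▹ z
        pr₂Φ = pr₂-⊕ (p₂ ▹ z) (T ▹ z)
        pr₁T : pr₁ (k′ ℕ.+ k) ▹ (T ▹ z) ≋ (p₁ ▹ z) ⊕ ((p₃ +ᴸ η ∘ᴸ p₂) ▹ z)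
        pr₁T = pr₁-⊕ ((p₁ ▹ z) ⊕ ((p₃ +ᴸ η ∘ᴸ p₂) ▹ z)) ((p₄ +ᴸ ζ ∘ᴸ p₂) ▹ z)
        r₁Φ : r₁ ▹ (Φ ▹ z) ≋ p₂ ▹ z
        r₁Φ = pr₁-⊕ (p₂ ▹ z) (T ▹ z)
        r₂Φ : r₂ ▹ (Φ ▹ z) ≋ p₁ ▹ z
        r₂Φ i = trans (pr₂Φ _) (trans (pr₁T _) (pr₁-⊕ (p₁ ▹ z) ((p₃ +ᴸ η ∘ᴸ p₂) ▹ z) i))
        r₃Φ : r₃ ▹ (Φ ▹ z) ≋ (p₃ +ᴸ η ∘ᴸ p₂) ▹ z
        r₃Φ i = trans (pr₂Φ _) (trans (pr₁T _) (pr₂-⊕ (p₁ ▹ z) ((p₃ +ᴸ η ∘ᴸ p₂) ▹ z) i))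
        r₄Φ : r₄ ▹ (Φ ▹ z) ≋ (p₄ +ᴸ ζ ∘ᴸ p₂) ▹ z
        r₄Φ i = trans (pr₂Φ _) (pr₂-⊕ ((p₁ ▹ z) ⊕ ((p₃ +ᴸ η ∘ᴸ p₂) ▹ z)) ((p₄ +ᴸ ζ ∘ᴸ p₂) ▹ z) i)

      module _ (y : V (m ℕ.+ ((k′ ℕ.+ k) ℕ.+ c))) where
        x₁ : V (k′ ℕ.+ m)
        x₁ = (r₂ ▹ y) ⊕ (r₁ ▹ y)
        y₃ : V k
        y₃ = (r₃ +ᴸ -ᴸ (η ∘ᴸ r₁)) ▹ y
        y₄ : V c
        y₄ = (r₄ +ᴸ -ᴸ (ζ ∘ᴸ r₁)) ▹ y
        p₁Φ⁻¹ : p₁ ▹ (Φ⁻¹ ▹ y) ≋ r₂ ▹ y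
        p₁Φ⁻¹ i = trans (pr₁-⊕ x₁ (y₃ ⊕ y₄) _) (pr₁-⊕ (r₂ ▹ y) (r₁ ▹ y) i)
        p₂Φ⁻¹ : p₂ ▹ (Φ⁻¹ ▹ y) ≋ r₁ ▹ y
        p₂Φ⁻¹ i = trans (pr₁-⊕ x₁ (y₃ ⊕ y₄) _) (pr₂-⊕ (r₂ ▹ y) (r₁ ▹ y) i)
        p₃Φ⁻¹ : p₃ ▹ (Φ⁻¹ ▹ y) ≋ y₃
        p₃Φ⁻¹ i = trans (pr₂-⊕ x₁ (y₃ ⊕ y₄) _) (pr₁-⊕ y₃ y₄ i)
        p₄Φ⁻¹ : p₄ ▹ (Φ⁻¹ ▹ y) ≋ y₄
        p₄Φ⁻¹ i = trans (pr₂-⊕ x₁ (y₃ ⊕ y₄) _) (pr₂-⊕ y₃ y₄ i)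

    Φ⁻¹Φ : ∀ z → Φ⁻¹ ▹ (Φ ▹ z) ≋ z
    Φ⁻¹Φ z = ⊕-ext (k′ ℕ.+ m)
      (⊕-ext k′ (λ i → trans (p₁Φ⁻¹ (Φ ▹ z) i) (r₂Φ z i)) (λ i → trans (p₂Φ⁻¹ (Φ ▹ z) i) (r₁Φ z i)))
      (⊕-ext k
        (λ i → trans (p₃Φ⁻¹ (Φ ▹ z) i) (trans (+-cong (r₃Φ z i) (-‿cong (▹-cong η (r₁Φ z) i)))
                 (take-away ((p₃ ▹ z) i) ((η ▹ (p₂ ▹ z)) i))))
        (λ i → trans (p₄Φ⁻¹ (Φ ▹ z) i) (trans (+-cong (r₄Φ z i) (-‿cong (▹-cong ζ (r₁Φ z) i)))
                 (take-away ((p₄ ▹ z) i) ((ζ ▹ (p₂ ▹ z)) i)))))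

    ΦΦ⁻¹ : ∀ y → Φ ▹ (Φ⁻¹ ▹ y) ≋ y
    ΦΦ⁻¹ y = ⊕-ext m
      (λ i → trans (r₁Φ (Φ⁻¹ ▹ y) i) (p₂Φ⁻¹ y i))
      (⊕-ext (k′ ℕ.+ k)
        (⊕-ext k′ (λ i → trans (r₂Φ (Φ⁻¹ ▹ y) i) (p₁Φ⁻¹ y i))
          (λ i → trans (r₃Φ (Φ⁻¹ ▹ y) i) (trans (+-cong (p₃Φ⁻¹ y i) (▹-cong η (p₂Φ⁻¹ y) i))
                   (add-back ((r₃ ▹ y) i) ((η ▹ (r₁ ▹ y)) i)))))
        (λ i → trans (r₄Φ (Φ⁻¹ ▹ y) i) (trans (+-cong (p₄Φ⁻¹ y i) (▹-cong ζ (p₂Φ⁻¹ y) i))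
                 (add-back ((r₄ ▹ y) i) ((ζ ▹ (r₁ ▹ y)) i)))))

    Φ-W : ∀ {z} → z ∈ₛ W → Φ ▹ z ∈ₛ full m ⊠ (X ⊠ scaled d c)
    Φ-W {z} z∈ = _ , resp (X ⊠ scaled d c) {T ▹ z} {pr₂ m ▹ (Φ ▹ z)} (λ i → sym (pr₂Φ z i)) z∈

    Φ⁻¹-W : ∀ {y} → y ∈ₛ full m ⊠ (X ⊠ scaled d c) → Φ⁻¹ ▹ y ∈ₛ W
    Φ⁻¹-W {y} (_ , y∈) = resp (X ⊠ scaled d c) {pr₂ m ▹ y} {T ▹ (Φ⁻¹ ▹ y)}
      (λ i → trans (sym (ΦΦ⁻¹ y _)) (pr₂Φ (Φ⁻¹ ▹ y) i)) y∈

    X̃⇒Z : ∀ {u} → u ∈ₛ X̃ → pr₂ k′ ▹ u ∈ₛ Z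
    X̃⇒Z {u} (_ , z∈) = resp (scaled d c) (pr₂-⊕ ((pr₁ k′ ⊕ᴸ η ∘ᴸ pr₂ k′) ▹ u) (ζ ▹ (pr₂ k′ ▹ u))) z∈

    -- Since ζ w = d t, subtracting the relation d (0 , t) from (η w , ζ w) leaves (η w , 0). Hence
    -- η w lies in K and lifts to X.
    Z⇒X̃ : ∀ {w} → w ∈ₛ Z → ∃[ x ] x ⊕ w ∈ₛ X̃
    Z⇒X̃ {w} w∈ = x
        , resp X (λ i → sym (trans (pr₁-⊕ (T₁ ▹ (x ⊕ w)) (ζ ▹ (pr₂ k′ ▹ (x ⊕ w))) i)
            (⊕-cong (pr₁-⊕ x w) (▹-cong η (pr₂-⊕ x w)) i))) (proj₂ (K→X Kη))
        , resp (scaled d c) (λ i → sym (trans (pr₂-⊕ (T₁ ▹ (x ⊕ w)) (ζ ▹ (pr₂ k′ ▹ (x ⊕ w))) i)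
            (▹-cong ζ (pr₂-⊕ x w) i))) w∈
      where
      T₁ : Lin (k′ ℕ.+ m) (k′ ℕ.+ k)
      T₁ = pr₁ k′ ⊕ᴸ η ∘ᴸ pr₂ k′
      t : V c
      t = proj₁ w∈
      Kη : inl {k} {c} ▹ (η ▹ w) ∈ₛ relations G
      Kη = resp (relations G)
        (⊕-ext k
          (λ i → trans (+-cong (pr₁-⊕ (η ▹ w) (ζ ▹ w) i) (-‿cong (trans (*-congˡ (pr₁-⊕ (𝟎 {k}) t i)) (zeroʳ d))))
                   (trans (lemma _) (sym (pr₁-⊕ (η ▹ w) (𝟎 {c}) i))))
          (λ i → trans (+-cong (pr₂-⊕ (η ▹ w) (ζ ▹ w) i) (-‿cong (trans (*-congˡ (pr₂-⊕ (𝟎 {k}) t i)) (proj₂ w∈ i))))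
                   (trans (-‿inverseʳ _) (sym (pr₂-⊕ (η ▹ w) (𝟎 {c}) i)))))
        (-closed (relations G) (ηζ∈ w) (scaled⊆relations G {d ⊡ (inr k ▹ t)} (inr k ▹ t , λ _ → refl)))
        where
        lemma : ∀ x → x - 0# ≈ x
        lemma = solve 1 (λ x → x :- :0 := x) refl
      x : V k′
      x = proj₁ (K→X Kη)

    X̃-inl : ∀ {x} → inl {k′} {m} ▹ x ∈ₛ X̃ → inl {k′} {k} ▹ x ∈ₛ X
    X̃-inl {x} (x∈ , _) = resp X (λ i → trans (pr₁-⊕ ((pr₁ k′ ⊕ᴸ η ∘ᴸ pr₂ k′) ▹ (inl ▹ x)) (ζ ▹ (pr₂ k′ ▹ (inl ▹ x))) i)
      (⊕-cong (pr₁-⊕ x (𝟎 {m})) (λ j → trans (▹-cong η (pr₂-⊕ x (𝟎 {m})) j) (▹-𝟎 η j)) i)) x∈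

    X-inl : ∀ {x} → inl {k′} {k} ▹ x ∈ₛ X → inl {k′} {m} ▹ x ∈ₛ X̃
    X-inl {x} x∈ = resp X (λ i → sym (trans (pr₁-⊕ ((pr₁ k′ ⊕ᴸ η ∘ᴸ pr₂ k′) ▹ (inl ▹ x)) (ζ ▹ (pr₂ k′ ▹ (inl ▹ x))) i)
        (⊕-cong (pr₁-⊕ x (𝟎 {m})) (λ j → trans (▹-cong η (pr₂-⊕ x (𝟎 {m})) j) (▹-𝟎 η j)) i))) x∈
      , 𝟎 , λ i → trans (zeroʳ d) (sym (trans (pr₂-⊕ ((pr₁ k′ ⊕ᴸ η ∘ᴸ pr₂ k′) ▹ (inl ▹ x)) (ζ ▹ (pr₂ k′ ▹ (inl ▹ x))) i)
          (trans (▹-cong ζ (pr₂-⊕ x (𝟎 {m})) i) (▹-𝟎 ζ i))))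

-- Independence of the resolution by matrix factorisations

module Units (𝓜 : CommutativeMonoid (lsuc 0ℓ) 0ℓ) where
  open CommutativeMonoid 𝓜
  open CommutativeMonoidSolver 𝓜 using (solve; _⊜_; id) renaming (_⊕_ to _:∙_)
  open SetoidReasoning setoid

  record Unit : Set₁ where
    constructor unit
    field
      value   : Carrier
      inverse : Carrier
      isUnit  : value ∙ inverse ≈ ε
  open Unit public

  inverse-unique : ∀ (u : Unit) {x} → value u ∙ x ≈ ε → x ≈ inverse u
  inverse-unique (unit u u⁻ uu⁻) {x} ux≈ε = begin
    x               ≈⟨ identityˡ x ⟨
    ε ∙ x           ≈⟨ ∙-congʳ uu⁻ ⟨
    (u ∙ u⁻) ∙ x    ≈⟨ solve 3 (λ u v x → (u :∙ v) :∙ x ⊜ (u :∙ x) :∙ v) refl u u⁻ x ⟩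
    (u ∙ x) ∙ u⁻    ≈⟨ ∙-congʳ ux≈ε ⟩
    ε ∙ u⁻          ≈⟨ identityˡ u⁻ ⟩
    u⁻              ∎

  -- Equality compares values only; `inverse-unique` makes inversion respect it.
  unitGroup : AbelianGroup (lsuc 0ℓ) 0ℓ
  unitGroup = record
    { Carrier = Unit
    ; _≈_ = λ u v → value u ≈ value v
    ; _∙_ = λ (unit u u⁻ p) (unit v v⁻ q) → unit (u ∙ v) (u⁻ ∙ v⁻)
        (trans (solve 4 (λ a b c d → (a :∙ b) :∙ (c :∙ d) ⊜ (a :∙ c) :∙ (b :∙ d)) refl u v u⁻ v⁻)
               (trans (∙-cong p q) (identityˡ ε)))
    ; ε = unit ε ε (identityˡ ε)
    ; _⁻¹ = λ (unit u u⁻ p) → unit u⁻ u (trans (comm u⁻ u) p)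
    ; isAbelianGroup = record
      { isGroup = record
        { isMonoid = record
          { isSemigroup = record
            { isMagma = record
              { isEquivalence = record { refl = refl ; sym = sym ; trans = trans }
              ; ∙-cong = ∙-cong
              }
            ; assoc = λ u v w → assoc (value u) (value v) (value w)
            }
          ; identity = (λ u → identityˡ (value u)) , (λ u → identityʳ (value u))
          }
        ; inverse = (λ u → trans (comm _ _) (isUnit u)) , isUnit
        ; ⁻¹-cong = λ {u} {v} u≈v → inverse-unique v (trans (∙-congʳ (sym u≈v)) (isUnit u))
        }
      ; comm = λ u v → comm (value u) (value v)
      }
    }

module GroupIdentities {c ℓ : Level} (𝓖 : AbelianGroup c ℓ) where
  open AbelianGroup 𝓖
  open AbelianGroupProperties 𝓖 using (⁻¹-involutive; ⁻¹-∙-comm; ⁻¹-anti-homo-∙)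
  open SetoidReasoning setoid

  -- Read a, b, j, δ as the Fitting ideals of Pₙ₋₁, Pₙ, P̃ and (R/d)ᶜ: a two-term alternating
  -- product becomes a one-term product times a correction.
  merge-identity : ∀ a b j δ → j ∙ b ≈ a ∙ δ → (a ∙ (b ∙ ε) ⁻¹) ⁻¹ ≈ (j ∙ ε) ⁻¹ ∙ (δ ⁻¹) ⁻¹
  merge-identity a b j δ jb≈aδ = begin
    (a ∙ (b ∙ ε) ⁻¹) ⁻¹        ≈⟨ ⁻¹-∙-comm a _ ⟨
    a ⁻¹ ∙ ((b ∙ ε) ⁻¹) ⁻¹     ≈⟨ ∙-congˡ (trans (⁻¹-involutive _) (identityʳ b)) ⟩
    a ⁻¹ ∙ b                   ≈⟨ ∙-congˡ (sym (trans (∙-congʳ (inverseˡ j)) (identityˡ b))) ⟩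
    a ⁻¹ ∙ ((j ⁻¹ ∙ j) ∙ b)    ≈⟨ ∙-congˡ (trans (assoc _ j b) (∙-congˡ jb≈aδ)) ⟩
    a ⁻¹ ∙ (j ⁻¹ ∙ (a ∙ δ))    ≈⟨ assoc _ _ _ ⟨
    (a ⁻¹ ∙ j ⁻¹) ∙ (a ∙ δ)    ≈⟨ ∙-congʳ (comm _ _) ⟩
    (j ⁻¹ ∙ a ⁻¹) ∙ (a ∙ δ)    ≈⟨ assoc _ _ _ ⟩
    j ⁻¹ ∙ (a ⁻¹ ∙ (a ∙ δ))    ≈⟨ ∙-congˡ (trans (sym (assoc _ a δ)) (trans (∙-congʳ (inverseˡ a)) (identityˡ δ))) ⟩
    j ⁻¹ ∙ δ                   ≈⟨ ∙-cong (⁻¹-cong (sym (identityʳ j))) (sym (⁻¹-involutive δ)) ⟩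
    (j ∙ ε) ⁻¹ ∙ (δ ⁻¹) ⁻¹     ∎

  -- A further term on the left inverts the whole product, and the correction with it.
  cons-identity : ∀ i r r′ δ → r ≈ r′ ∙ δ → (i ∙ r) ⁻¹ ≈ (i ∙ r′) ⁻¹ ∙ δ ⁻¹
  cons-identity i r r′ δ r≈r′δ = begin
    (i ∙ r) ⁻¹           ≈⟨ ⁻¹-cong (trans (∙-congˡ r≈r′δ) (sym (assoc i r′ δ))) ⟩
    ((i ∙ r′) ∙ δ) ⁻¹    ≈⟨ ⁻¹-∙-comm _ δ ⟨
    (i ∙ r′) ⁻¹ ∙ δ ⁻¹   ∎

module Resolutions (R : CommutativeRing 0ℓ 0ℓ) (𝓐 : RAlgebra R) (ι-inverse : RAlgebra.InvertsRegular 𝓐)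
  {d : CommutativeRing.Carrier R} (d-reg : Fractions.IsRegular R d) where
  open RAlgebra 𝓐 using (A; ι)
  open CommutativeRing A hiding (zero)

  private
    module R = CommutativeRing R
    variable
      a b c k k′ m n : ℕ
      v : Level
  open Linear R
  open Blocks R
  open Regular R
  open Factorisations R
  open Syzygies R
  open Fitting R 𝓐 public
  open Units commutativeMonoid public
  open Exp R.semiring using (_^_)
  private
    module 𝓜 = CommutativeMonoid commutativeMonoid
    module 𝓤 = AbelianGroup unitGroup
    module 𝓤ₚ = AbelianGroupProperties unitGroup

  -- Both sides compute Fit W: as an extension of P by P̃, and, after the change of coordinates `Φ`,
  -- as P′ ⊕ (R/d)ᶜ.
  Fit-cover : (G : Good d (k ℕ.+ c)) (cov : Covering {k} {c} G k′ m) →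
    Fit (Cover.X̃ d-reg G cov) · Fit (relations G) ≐ Fit (Covering.X cov) · Fit (scaled d c)
  Fit-cover {k} {c} {k′} {m} G cov = begin
    Fit X̃ · Fit (relations G)
      ≈⟨ Fit-extension d-reg W X̃ G X̃⇒W W⇒X̃ (λ {z} → W⇒relations {z}) (λ w → relations⇒W (w , λ _ → R.refl)) ⟨
    Fit W
      ≈⟨ Fit-iso {U = W} {full m ⊠ (X ⊠ scaled d c)} sizes Φ Φ⁻¹ Φ⁻¹Φ ΦΦ⁻¹ (λ {z} → Φ-W {z}) (λ {y} → Φ⁻¹-W {y}) ⟩
    Fit (full m ⊠ (X ⊠ scaled d c))
      ≈⟨ 𝓜.trans (Fit-⊠ (full m) (X ⊠ scaled d c)) (𝓜.∙-cong (Fit-full m) (Fit-⊠ X (scaled d c))) ⟩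
    𝟙 · (Fit X · Fit (scaled d c))
      ≈⟨ 𝓜.identityˡ _ ⟩
    Fit X · Fit (scaled d c)  ∎
    where
    open SetoidReasoning 𝓜.setoid
    open Covering cov
    open Cover d-reg G cov
    sizes : (k′ ℕ.+ m) ℕ.+ (k ℕ.+ c) ≡ m ℕ.+ ((k′ ℕ.+ k) ℕ.+ c)
    sizes = solve 4 (λ k′ m k c → (k′ :+ m) :+ (k :+ c) := m :+ ((k′ :+ k) :+ c)) ≡.refl k′ m k c
      where open ℕSolver.+-*-Solver using (solve; _:+_; _:=_)

  -- The case P′ = 0, where P̃ is the kernel of (R/d)ⁿ → P. `Fit-cover` then yields the
  -- complementary factor that makes Fit(P) invertible.
  freeCovering : (G : Good d n) → Covering {0} {n} G 0 (cols G)
  freeCovering G = record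
    { X    = full 0
    ; η    = 0ᴸ
    ; ζ    = h G
    ; ηζ∈  = λ w → w , λ _ → R.refl
    ; onto = λ u∈ → u∈
    ; X→K  = λ _ → 0-closed (relations G)
    ; K→X  = λ _ → 𝟎 , _
    }

  fitting : Good d n → Unit
  fitting {n} G = unit (Fit (relations G)) (Fit (relations G) ⁻)
    (invertible (Fit (relations G)) (Fit (Cover.X̃ d-reg G (freeCovering G))) (proj₂ (ι-inverse (regular-^ d-reg n)))
      (begin
        Fit (relations G) · Fit (Cover.X̃ d-reg G (freeCovering G))  ≈⟨ 𝓜.comm (Fit (relations G)) (Fit (Cover.X̃ d-reg G (freeCovering G))) ⟩
        Fit (Cover.X̃ d-reg G (freeCovering G)) · Fit (relations G)  ≈⟨ Fit-cover G (freeCovering G) ⟩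
        Fit (full 0) · Fit (scaled d n)                             ≈⟨ 𝓜.∙-cong (Fit-full 0) (Fit-scaled d n) ⟩
        𝟙 · span M (λ x → x ≈ ι (d ^ n))                            ≈⟨ 𝓜.identityˡ _ ⟩
        span M (λ x → x ≈ ι (d ^ n))                                ∎))
    where open SetoidReasoning 𝓜.setoid

  scalarGood : ∀ n → Good d n
  scalarGood n = record
    { h = scaleᴸ d ; S = idᴸ ; hS = λ _ _ → R.refl ; Sh = λ w → w , λ _ → R.refl }

  infix 4 _≑_
  _≑_ : ∀ {i j} → (V n → Set i) → (V n → Set j) → Set (i ⊔ j)
  P ≑ Q = (∀ {x} → P x → Q x) × (∀ {x} → Q x → P x)

  quotient : ∀ k {c} → Good d (k ℕ.+ c) → Sub c
  quotient k G = im (pr₂ k ∘ᴸ h G)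

  kernel : ∀ k {c} → Good d (k ℕ.+ c) → Sub k
  kernel k G = preimage inl (relations G)

  -- Exact sequences 0 → Rᵏ / X → P₁ → ⋯ → Pₙ → Rᶜ / V → 0 whose Pᵢ are presented
  -- on the generators of the image of Pᵢ₋₁ together with those of the image of Pᵢ.
  data Res {c} (Q : V c → Set v) : ℕ → ∀ {k} → Sub k → Set (lsuc 0ℓ ⊔ v) where
    nil  : {X : Sub c} → (_∈ₛ X) ≑ Q → Res Q 0 X
    cons : {X : Sub k} (G : Good d (k ℕ.+ m)) → (_∈ₛ kernel k G) ≑ (_∈ₛ X) →
           Res Q n (quotient k G) → Res Q (suc n) X

  -- Fit(P₁)⁻¹ Fit(P₂) Fit(P₃)⁻¹ ⋯
  alternating : {Q : V c → Set v} {X : Sub k} → Res Q n X → Unit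
  alternating (nil _)      = 𝓤.ε
  alternating (cons G _ r) = (fitting G 𝓤.∙ alternating r) 𝓤.⁻¹

  𝓕ʳ : {Q : V c → Set v} {X : Sub k} → Res Q n X → FI
  𝓕ʳ {X = X} r = Fit X · value (alternating r)

  record Generators (Q : V c → Set v) : Set v where
    field
      {size} : ℕ
      gens   : Lin size c
      gens-∈ : ∀ w → Q (gens ▹ w)
      gens-⇒ : ∀ {x} → Q x → ∃[ w ] gens ▹ w ≋ x
  open Generators

  -- The relations of the last module on Rᶜ are the image of the relations of Pₙ, so any sequence of
  -- positive length generates them finitely.
  generators : {Q : V c → Set v} {X : Sub k} → Res Q (suc n) X → Generators Q
  generators (cons {k = k} G _ (nil (to , from))) = record
    { gens = pr₂ k ∘ᴸ h G ; gens-∈ = λ w → to (w , λ _ → R.refl) ; gens-⇒ = from }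
  generators (cons G _ r@(cons _ _ _)) = generators r

  module _ {Q : V c → Set v} (γ : Generators Q) where

    -- The relations of Z, the kernel of (R/d)ᶜ → Rᶜ / Q, on the generators `gens γ`.
    syzygies : Sub (size γ)
    syzygies = preimage (gens γ) (scaled d c)

    private
      ζ : Lin (size γ) c
      ζ = gens γ

      pr₂-relations : (G : Good d (k ℕ.+ m)) → ∀ {u} → u ∈ₛ relations G → pr₂ k ▹ u ∈ₛ quotient k G
      pr₂-relations G (w , p) = w , λ i → p _

      quotient-relations : (G : Good d (k ℕ.+ m)) → ∀ {y} → y ∈ₛ quotient k G → ∃[ x ] x ⊕ y ∈ₛ relations G
      quotient-relations {k} G (w , p) = pr₁ k ▹ (h G ▹ w) , w , λ i →
        R.trans (R.sym (⊕-η k (h G ▹ w) i)) (⊕-cong (λ _ → R.refl) p i)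

    covering : (G : Good d (k ℕ.+ c)) → (_∈ₛ quotient k G) ≑ Q → (X : Sub (k′ ℕ.+ k)) →
      (∀ {z} → z ∈ₛ X → pr₂ k′ ▹ z ∈ₛ kernel k G) → (∀ {y} → y ∈ₛ kernel k G → ∃[ x ] x ⊕ y ∈ₛ X) →
      Covering {k} {c} G k′ (size γ)
    covering {k} G (to , from) X X→K K→X = record
      { X    = X
      ; η    = proj₁ lifted
      ; ζ    = ζ
      ; ηζ∈  = proj₂ lifted
      ; onto = λ u∈ → gens-⇒ γ (to (pr₂-relations {k} G u∈))
      ; X→K  = X→K
      ; K→X  = K→X
      }
      where
      lifted : Σ[ f ∈ Lin (size γ) k ] (∀ w → (f ▹ w) ⊕ (ζ ▹ w) ∈ₛ relations G)
      lifted = lift-linear (relations G) ζ (λ j → quotient-relations {k} G (from (gens-∈ γ (e j))))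

    scalarUnit : Unit
    scalarUnit = fitting (scalarGood c)

    -- Fitt((R/d)ᶜ) to the power (-1)ⁿ⁺¹: the sign flips with every further term on the left.
    correction : ℕ → Unit
    correction zero    = scalarUnit 𝓤.⁻¹
    correction (suc n) = correction n 𝓤.⁻¹

    private

      -- Passing from Pₙ₋₁ → Pₙ to P̃ → Z, where P̃ is the kernel of Pₙ₋₁ ⊕ (R / d)ᶜ → Pₙ.
      merge : {X : Sub k} (G₁ : Good d (k ℕ.+ m)) → (_∈ₛ kernel k G₁) ≑ (_∈ₛ X) →
              (G₂ : Good d (m ℕ.+ c)) → (_∈ₛ kernel m G₂) ≑ (_∈ₛ quotient k G₁) → (_∈ₛ quotient m G₂) ≑ Q →
              Σ[ r ∈ Res (_∈ₛ syzygies) 1 X ]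
                (fitting G₁ 𝓤.∙ (fitting G₂ 𝓤.∙ 𝓤.ε) 𝓤.⁻¹) 𝓤.⁻¹ 𝓤.≈ alternating r 𝓤.∙ correction 1
      merge {k} {m} {X} G₁ K₁ G₂ (K⇒ , ⇒K) end =
          cons X̃-good
            ((λ {x} x∈ → proj₁ K₁ (X̃-inl {x} (good⊆X̃ {inl ▹ x} x∈))) , (λ {x} x∈ → X̃⊆good {inl ▹ x} (X-inl {x} (proj₂ K₁ x∈))))
            (nil ((λ {w} (b , p) → resp syzygies p (X̃⇒Z {h X̃-good ▹ b} (good⊆X̃ {h X̃-good ▹ b} (b , λ _ → R.refl))))
               , λ {w} w∈ → let x , x∈ = Z⇒X̃ w∈ ; b , p = X̃⊆good {x ⊕ w} x∈ in
                   b , λ i → R.trans (p _) (pr₂-⊕ x w i)))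
        , GroupIdentities.merge-identity unitGroup (fitting G₁) (fitting G₂) (fitting X̃-good) scalarUnit
            (𝓜.trans (𝓜.∙-congʳ {Fit (relations G₂)} (Fit-cong {U = relations X̃-good} {X̃} (λ {u} → good⊆X̃ {u}) (λ {u} → X̃⊆good {u})))
              (Fit-cover G₂ cov))
        where
        cov : Covering {m} {c} G₂ k (size γ)
        cov = covering G₂ end (relations G₁) (λ z∈ → ⇒K (pr₂-relations {k} G₁ z∈)) (λ y∈ → quotient-relations {k} G₁ (K⇒ y∈))
        open Cover d-reg G₂ cov
        open Factorise G₁ (λ p → p) (λ p → p)

      -- Only the last two terms are merged; the terms to their left, and X itself, are kept.
      descend : {X : Sub k} (r : Res Q (suc (suc n)) X) →
                Σ[ r′ ∈ Res (_∈ₛ syzygies) (suc n) X ] alternating r 𝓤.≈ alternating r′ 𝓤.∙ correction (suc n)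
      descend (cons G₁ K₁ (cons G₂ K₂ (nil end))) = merge G₁ K₁ G₂ K₂ end
      descend {n = suc n} (cons G₁ K₁ r@(cons _ _ (cons _ _ _))) =
        let r′ , eq = descend r in
        cons G₁ K₁ r′ , GroupIdentities.cons-identity unitGroup (fitting G₁) (alternating r) (alternating r′) (correction (suc n)) eq

      -- With a single term, N = Rᵏ / X takes the part of Pₙ₋₁. As N injects into P₁, the kernel of
      -- N ⊕ (R/d)ᶜ → P₁ is Z itself, and the change shows in Fit X and not in the alternating
      -- product.
      descend₁ : {X : Sub k} (r : Res Q 1 X) → ∃[ X̃ ] Σ[ r′ ∈ Res (_∈ₛ syzygies) 0 {size γ} X̃ ] 𝓕ʳ r ≐ 𝓕ʳ r′ · value (correction 0)
      descend₁ {k} {X} (cons G (K⇒ , ⇒K) (nil end)) = X̃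
        , nil ((λ {w} → X̃⇒Z {w})
             , λ {w} w∈ → let x , x∈ = Z⇒X̃ w∈ in resp X̃ {x ⊕ w} {w} (pr₂-⊕ x w) x∈)
        , identity (Fit X) (Fit X̃) (fitting G) (Fit-cover G cov)
        where
        cov : Covering {k} {c} G 0 (size γ)
        cov = covering G end X ⇒K (λ {y} y∈ → 𝟎 {0} , resp X (λ _ → R.refl) (K⇒ y∈))
        open Cover d-reg G cov

        open CommutativeMonoidSolver commutativeMonoid using (solve; _⊜_; id) renaming (_⊕_ to _:∙_)
        open SetoidReasoning 𝓜.setoid
        identity : ∀ x j (i : Unit) → j · value i ≐ x · value scalarUnit →
                   x · (inverse i · 𝟙) ≐ (j · 𝟙) · inverse scalarUnit
        identity x j i ji≐xδ = begin
          x · (inverse i · 𝟙)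
            ≈⟨ 𝓜.∙-cong (𝓜.sym (𝓜.trans (𝓜.∙-congˡ {x} (isUnit scalarUnit)) (𝓜.identityʳ x))) (𝓜.identityʳ (inverse i)) ⟩
          (x · (value scalarUnit · inverse scalarUnit)) · inverse i
            ≈⟨ solve 4 (λ x δ δ⁻ i⁻ → (x :∙ (δ :∙ δ⁻)) :∙ i⁻ ⊜ (x :∙ δ) :∙ (δ⁻ :∙ i⁻)) 𝓜.refl x (value scalarUnit) (inverse scalarUnit) (inverse i) ⟩
          (x · value scalarUnit) · (inverse scalarUnit · inverse i)
            ≈⟨ 𝓜.∙-congʳ {inverse scalarUnit · inverse i} ji≐xδ ⟨
          (j · value i) · (inverse scalarUnit · inverse i)
            ≈⟨ solve 4 (λ j i δ⁻ i⁻ → (j :∙ i) :∙ (δ⁻ :∙ i⁻) ⊜ (j :∙ (i :∙ i⁻)) :∙ δ⁻) 𝓜.refl j (value i) (inverse scalarUnit) (inverse i) ⟩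
          (j · (value i · inverse i)) · inverse scalarUnit
            ≈⟨ 𝓜.∙-congʳ {inverse scalarUnit} (𝓜.∙-congˡ {j} (isUnit i)) ⟩
          (j · 𝟙) · inverse scalarUnit  ∎

    Res-syzygies : {X : Sub k} (r : Res Q (suc n) X) →
      Σ[ k′ ∈ ℕ ] Σ[ X′ ∈ Sub k′ ] Σ[ r′ ∈ Res (_∈ₛ syzygies) n X′ ] 𝓕ʳ r ≐ 𝓕ʳ r′ · value (correction n)
    Res-syzygies {n = zero} r = _ , descend₁ r
    Res-syzygies {n = suc n} {X = X} r = let r′ , eq = descend r in _ , X , r′ ,
      𝓜.trans (𝓜.∙-congˡ {Fit X} eq) (𝓜.sym (𝓜.assoc (Fit X) (value (alternating r′)) (value (correction (suc n)))))

  -- The generators of Q are read off from `r` but serve `r′` as well, so both descents arrive at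
  -- the same Z and the same correction.
  𝓕ʳ-unique : {Q : V c → Set v} {X : Sub k} {X′ : Sub k′} (r : Res Q n X) (r′ : Res Q n X′) → 𝓕ʳ r ≐ 𝓕ʳ r′
  𝓕ʳ-unique (nil {X = X} (to , from)) (nil {X = X′} (to′ , from′)) =
    𝓜.∙-congʳ {𝟙} (Fit-cong {U = X} {X′} (λ p → from′ (to p)) (λ p → from (to′ p)))
  𝓕ʳ-unique {n = suc n} r@(cons _ _ _) r′ =
    let γ = generators r
        _ , _ , s  , eq  = Res-syzygies γ r
        _ , _ , s′ , eq′ = Res-syzygies γ r′
    in 𝓜.trans eq (𝓜.trans (𝓜.∙-congʳ {value (correction γ n)} (𝓕ʳ-unique s s′)) (𝓜.sym eq′))

-- From modules to matrix factorisations

module Homs (R : CommutativeRing 0ℓ 0ℓ) where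
  open CommutativeRing R hiding (zero)
  open Linear R
  open Blocks R
  private
    module R = CommutativeRing R
    variable
      a b n : ℕ
      m₁ m₂ ℓ₁ ℓ₂ ℓ : Level

  module HomProperties {A : Module R m₁ ℓ₁} {B : Module R m₂ ℓ₂} (f : Hom A B) where
    open IsModuleHomomorphism (Hom.isHomomorphism f) public
      using () renaming (⟦⟧-cong to hom-cong; +ᴹ-homo to hom-+; *ₗ-homo to hom-*; 0ᴹ-homo to hom-0; -ᴹ-homo to hom-neg)
  open HomProperties public

  module _ {A : Module R m₁ ℓ₁} {B : Module R m₂ ℓ₂} where
    private
      module A = Module A
      module B = Module B

    mkHom : (f : A.Carrierᴹ → B.Carrierᴹ) → (∀ {x y} → x A.≈ᴹ y → f x B.≈ᴹ f y) →
            (∀ x y → f (x A.+ᴹ y) B.≈ᴹ f x B.+ᴹ f y) → (∀ r x → f (r A.*ₗ x) B.≈ᴹ r B.*ₗ f x) → Hom A B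
    mkHom f f-cong f-+ f-* = record
      { ⟦_⟧ = f
      ; isHomomorphism = record
        { isBimoduleHomomorphism = record
          { +ᴹ-isGroupHomomorphism = record
            { isMonoidHomomorphism = record
              { isMagmaHomomorphism = record
                { isRelHomomorphism = record { cong = f-cong } ; homo = f-+ }
              ; ε-homo = f-0 }
            ; ⁻¹-homo = λ x → AbelianGroupProperties.inverseˡ-unique B.+ᴹ-abelianGroup _ _
                (B.≈ᴹ-trans (B.≈ᴹ-sym (f-+ (A.-ᴹ x) x)) (B.≈ᴹ-trans (f-cong (A.-ᴹ‿inverseˡ x)) f-0))
            }
          ; *ₗ-homo = f-*
          ; *ᵣ-homo = λ r x → B.≈ᴹ-trans (f-cong (A.≈ᴹ-sym (A.*ₗ-*ᵣ-coincident r x)))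
              (B.≈ᴹ-trans (f-* r x) (B.*ₗ-*ᵣ-coincident r (f x)))
          }
        }
      }
      where
      f-0 : f A.0ᴹ B.≈ᴹ B.0ᴹ
      f-0 = B.≈ᴹ-trans (f-cong (A.≈ᴹ-sym (A.*ₗ-zeroˡ A.0ᴹ))) (B.≈ᴹ-trans (f-* 0# A.0ᴹ) (B.*ₗ-zeroˡ _))

  idᴴ : (A : Module R m₁ ℓ₁) → Hom A A
  idᴴ A = mkHom {A = A} {A} (λ x → x) (λ p → p) (λ _ _ → A.≈ᴹ-refl) (λ _ _ → A.≈ᴹ-refl)
    where module A = Module A

  toHom : Lin a b → Hom (R ^ᴹ a) (R ^ᴹ b)
  toHom {a} {b} f = mkHom {A = R ^ᴹ a} {R ^ᴹ b} (f ▹_) (▹-cong f) (▹-+ f) (▹-* f)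

  toLin : Hom (R ^ᴹ a) (R ^ᴹ b) → Lin a b
  toLin {a} {b} f = record { _▹_ = ⟦ f ⟧ ; ▹-cong = hom-cong f ; ▹-+ = hom-+ f ; ▹-* = hom-* f }

  -- The image of f, on the carrier of A with equality pulled back along f.
  Coimage : ∀ ℓ {A : Module R m₁ ℓ₁} {B : Module R m₂ ℓ₂} → Hom A B → Module R (m₁ ⊔ ℓ) (ℓ₂ ⊔ ℓ)
  Coimage {m₁ = m₁} {ℓ₂ = ℓ₂} ℓ {A} {B} f = record
    { isModule = ModuleMonomorphism.isModule monomorphism R.isCommutativeRing B.isModule }
    where
    module A = Module A
    module B = Module B
    raw : RawModule R.Carrier (m₁ ⊔ ℓ) (ℓ₂ ⊔ ℓ)
    raw = record
      { Carrierᴹ = Lift ℓ A.Carrierᴹ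
      ; _≈ᴹ_ = λ x y → Lift ℓ (⟦ f ⟧ (lower x) B.≈ᴹ ⟦ f ⟧ (lower y))
      ; _+ᴹ_ = λ x y → lift (lower x A.+ᴹ lower y)
      ; _*ₗ_ = λ r x → lift (r A.*ₗ lower x)
      ; _*ᵣ_ = λ x r → lift (lower x A.*ᵣ r)
      ; 0ᴹ = lift A.0ᴹ
      ; -ᴹ_ = λ x → lift (A.-ᴹ lower x)
      }
    monomorphism : IsModuleMonomorphism raw B.rawModule (λ x → ⟦ f ⟧ (lower x))
    monomorphism = record
      { isModuleHomomorphism = record
        { isBimoduleHomomorphism = record
          { +ᴹ-isGroupHomomorphism = record
            { isMonoidHomomorphism = record
              { isMagmaHomomorphism = record
                { isRelHomomorphism = record { cong = lower } ; homo = λ _ _ → hom-+ f _ _ }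
              ; ε-homo = hom-0 f }
            ; ⁻¹-homo = λ _ → hom-neg f _ }
          ; *ₗ-homo = λ r _ → hom-* f r _
          ; *ᵣ-homo = λ r _ → IsModuleHomomorphism.*ᵣ-homo (Hom.isHomomorphism f) r _
          }
        }
      ; injective = lift
      }

  Lifted : ∀ ℓ → Module R m₁ ℓ₁ → Module R (m₁ ⊔ ℓ) (ℓ₁ ⊔ ℓ)
  Lifted ℓ A = Coimage ℓ (idᴴ A)

  module _ (M : Module R m₁ ℓ₁) where
    private
      module M = Module M
      module G = AbelianGroupProperties M.+ᴹ-abelianGroup

    combineᴹ : (Fin n → M.Carrierᴹ) → V n → M.Carrierᴹ
    combineᴹ {zero}  x v = M.0ᴹ
    combineᴹ {suc n} x v = v zero M.*ₗ x zero M.+ᴹ combineᴹ (x ∘ suc) (v ∘ suc)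

    combineᴹ-cong : {x y : Fin n → M.Carrierᴹ} → (∀ i → x i M.≈ᴹ y i) → ∀ v → combineᴹ x v M.≈ᴹ combineᴹ y v
    combineᴹ-cong {zero}  x≈y v = M.≈ᴹ-refl
    combineᴹ-cong {suc n} x≈y v = M.+ᴹ-cong (M.*ₗ-congˡ (x≈y zero)) (combineᴹ-cong (x≈y ∘ suc) (v ∘ suc))

    private
      interchange : ∀ a b c d → (a M.+ᴹ b) M.+ᴹ (c M.+ᴹ d) M.≈ᴹ (a M.+ᴹ c) M.+ᴹ (b M.+ᴹ d)
      interchange = CommutativeSemigroupProperties.interchange (AbelianGroup.commutativeSemigroup M.+ᴹ-abelianGroup)

    freeHom : (Fin n → M.Carrierᴹ) → Hom (R ^ᴹ n) M
    freeHom {n} x = mkHom {A = R ^ᴹ n} {M} (combineᴹ x) (go-cong x) (go-+ x) (go-* x)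
      where
      go-cong : ∀ {n} (x : Fin n → M.Carrierᴹ) {u v} → u ≋ v → combineᴹ x u M.≈ᴹ combineᴹ x v
      go-cong {zero}  x u≋v = M.≈ᴹ-refl
      go-cong {suc n} x u≋v = M.+ᴹ-cong (M.*ₗ-congʳ (u≋v zero)) (go-cong (x ∘ suc) (u≋v ∘ suc))
      go-+ : ∀ {n} (x : Fin n → M.Carrierᴹ) u v → combineᴹ x (u ⊹ v) M.≈ᴹ combineᴹ x u M.+ᴹ combineᴹ x v
      go-+ {zero}  x u v = M.≈ᴹ-sym (M.+ᴹ-identityˡ _)
      go-+ {suc n} x u v = M.≈ᴹ-trans (M.+ᴹ-cong (M.*ₗ-distribʳ _ _ _) (go-+ (x ∘ suc) (u ∘ suc) (v ∘ suc)))
        (interchange _ _ _ _)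
      go-* : ∀ {n} (x : Fin n → M.Carrierᴹ) r v → combineᴹ x (r ⊡ v) M.≈ᴹ r M.*ₗ combineᴹ x v
      go-* {zero}  x r v = M.≈ᴹ-sym (M.*ₗ-zeroʳ r)
      go-* {suc n} x r v = M.≈ᴹ-trans (M.+ᴹ-cong (M.*ₗ-assoc _ _ _) (go-* (x ∘ suc) r (v ∘ suc)))
        (M.≈ᴹ-sym (M.*ₗ-distribˡ r _ _))

    hom-basis : (f : Hom (R ^ᴹ n) M) → ∀ v → ⟦ f ⟧ v M.≈ᴹ combineᴹ (λ i → ⟦ f ⟧ (e i)) v
    hom-basis f v = M.≈ᴹ-trans (hom-cong f (λ i → R.sym (combine-basis v i))) (go f e v)
      where
      go : ∀ {l n} (f : Hom (R ^ᴹ n) M) (u : Fin l → V n) v → ⟦ f ⟧ (combine u v) M.≈ᴹ combineᴹ (λ i → ⟦ f ⟧ (u i)) v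
      go {zero}  f u v = hom-0 f
      go {suc l} f u v = M.≈ᴹ-trans (hom-+ f _ _) (M.+ᴹ-cong (hom-* f _ _) (go f (u ∘ suc) (v ∘ suc)))

  hom-combine : {A : Module R m₁ ℓ₁} {B : Module R m₂ ℓ₂} (f : Hom A B) (x : Fin n → Module.Carrierᴹ A) (v : V n) →
                Module._≈ᴹ_ B (⟦ f ⟧ (combineᴹ A x v)) (combineᴹ B (⟦ f ⟧ ∘ x) v)
  hom-combine {n = zero}  f x v = hom-0 f
  hom-combine {n = suc n} {B = B} f x v =
    Module.≈ᴹ-trans B (hom-+ f _ _) (Module.+ᴹ-cong B (hom-* f _ _) (hom-combine f (x ∘ suc) (v ∘ suc)))

  lift-free : {A : Module R m₁ ℓ₁} {B : Module R m₂ ℓ₂} (g : Hom A B) → IsSurjective g → (f : Hom (R ^ᴹ n) B) →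
              Σ[ f̂ ∈ Hom (R ^ᴹ n) A ] (∀ x → Module._≈ᴹ_ B (⟦ g ⟧ (⟦ f̂ ⟧ x)) (⟦ f ⟧ x))
  lift-free {A = A} {B} g g-surj f = freeHom A (λ i → proj₁ (g-surj (⟦ f ⟧ (e i)))) , λ x →
    B.≈ᴹ-trans (hom-combine g _ x) (B.≈ᴹ-trans
      (combineᴹ-cong B (λ i → proj₂ (g-surj (⟦ f ⟧ (e i))) A.≈ᴹ-refl) x) (B.≈ᴹ-sym (hom-basis B f x)))
    where
    module A = Module A
    module B = Module B

  infix 4 _presents_
  _presents_ : {P : Module R m₁ ℓ₁} → Sub n → Hom (R ^ᴹ n) P → Set ℓ₁
  _presents_ {P = P} U α = (∀ {x} → x ∈ₛ U → ⟦ α ⟧ x ≈ᴹ 0ᴹ) × (∀ {x} → ⟦ α ⟧ x ≈ᴹ 0ᴹ → x ∈ₛ U)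
    where open Module P

-- From projective dimension at most one to a factorisation

module Schanuel (R : CommutativeRing 0ℓ 0ℓ) where
  open CommutativeRing R hiding (zero)
  open RingProperties ring
  open Solver R using (solve; :0; _:+_; _:*_; _:-_; :-_; _:=_)
  open Linear R
  open Blocks R
  open Homs R
  open Factorisations R
  private
    module R = CommutativeRing R
    variable
      a b n : ℕ
      ℓ : Level

  factor : ∀ {c} (h : Lin b a) (τ : Lin c a) → (∀ j → τ ▹ e j ∈ₛ im h) → Σ[ θ ∈ Lin c b ] (∀ v → h ▹ (θ ▹ v) ≋ τ ▹ v)
  factor h τ τ∈ = fromBasis (proj₁ ∘ τ∈) , λ v i →
    trans (▹-combine h (proj₁ ∘ τ∈) v i) (trans (combine-cong (proj₂ ∘ τ∈) v i) (sym (▹-basis τ v i)))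

  module _ {P : Module R ℓ ℓ} (pd : ProjectiveDimension≤ 1 P) {d : Carrier}
           (dP≈0 : ∀ x → Module._≈ᴹ_ P (Module._*ₗ_ P d x) (Module.0ᴹ P))
           (α : Hom (R ^ᴹ a) P) (α-surj : IsSurjective α) (h : Lin b a) (h-presents : im h presents α) where

    private
      module P = Module P
      K : Module R ℓ ℓ
      K = proj₁ pd
      Q : Module R ℓ ℓ
      Q = proj₁ (proj₂ pd) zero
      module K = Module K
      module Q = Module Q
      K-proj : IsProjective K
      K-proj {A} {B} = proj₁ (proj₂ (proj₂ pd)) {A} {B}
      Q-proj : IsProjective Q
      Q-proj {A} {B} = proj₁ (proj₂ (proj₂ (proj₂ pd))) zero {A} {B}
      module E = ExactSequence (proj₂ (proj₂ (proj₂ (proj₂ pd))))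
      j : Hom K Q
      j = E.d zero
      ρ : Hom Q P
      ρ = E.d (suc zero)
      Rᵃ Rᵇ B : Module R ℓ ℓ
      Rᵃ = Lifted ℓ (R ^ᴹ a)
      Rᵇ = Lifted ℓ (R ^ᴹ b)
      B  = Coimage ℓ (toHom h)

      α↑ : Hom Rᵃ P
      α↑ = mkHom {A = Rᵃ} {P} (λ x → ⟦ α ⟧ (lower x)) (λ p → hom-cong α (lower p))
        (λ _ _ → hom-+ α _ _) (λ _ _ → hom-* α _ _)

      s : Σ[ f ∈ Hom Q Rᵃ ] (∀ q → ⟦ α ⟧ (lower (⟦ f ⟧ q)) P.≈ᴹ ⟦ ρ ⟧ q)
      s = Q-proj {Rᵃ} {P} α↑ (λ y → lift (proj₁ (α-surj y)) , λ p → proj₂ (α-surj y) (lower p)) ρ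

      φ : Σ[ f ∈ Hom (R ^ᴹ a) Q ] (∀ x → ⟦ ρ ⟧ (⟦ f ⟧ x) P.≈ᴹ ⟦ α ⟧ x)
      φ = lift-free ρ E.surjective α

      σ : Q.Carrierᴹ → V a
      σ q = lower (⟦ proj₁ s ⟧ q)

      σφ : Lin a a
      σφ = record
        { _▹_ = λ x → σ (⟦ proj₁ φ ⟧ x)
        ; ▹-cong = λ p → lower (hom-cong (proj₁ s) (hom-cong (proj₁ φ) p))
        ; ▹-+ = λ u v i → trans (lower (hom-cong (proj₁ s) (hom-+ (proj₁ φ) u v)) i) (lower (hom-+ (proj₁ s) _ _) i)
        ; ▹-* = λ r v i → trans (lower (hom-cong (proj₁ s) (hom-* (proj₁ φ) r v)) i) (lower (hom-* (proj₁ s) _ _) i)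
        }

      -- For u ∈ ker α, u = (u − σφ u) + σφ u with φ u ∈ K; both summands lift to Rᵇ.
      θ : Σ[ f ∈ Lin a b ] (∀ v → h ▹ (f ▹ v) ≋ (idᴸ +ᴸ -ᴸ σφ) ▹ v)
      θ = factor h (idᴸ +ᴸ -ᴸ σφ) (λ i → proj₂ h-presents (P.≈ᴹ-trans (hom-+ α _ _)
        (P.≈ᴹ-trans (P.+ᴹ-congˡ (P.≈ᴹ-trans (hom-neg α _) (P.-ᴹ‿cong (P.≈ᴹ-trans (proj₂ s _) (proj₂ φ _)))))
          (P.-ᴹ‿inverseʳ _))))

      σj∈ : ∀ k → σ (⟦ j ⟧ k) ∈ₛ im h
      σj∈ k = proj₂ h-presents (P.≈ᴹ-trans (proj₂ s _) (Equivalence.from (E.exact zero _) (k , Q.≈ᴹ-refl)))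

      -- K is projective and Rᵇ maps onto im h, which is realised as the coimage `B`; so σ j, which
      -- lands in im h, lifts along h.
      f̂ : Σ[ f ∈ Hom K Rᵇ ] (∀ k → Lift ℓ (h ▹ lower (⟦ f ⟧ k) ≋ h ▹ proj₁ (σj∈ k)))
      f̂ = K-proj {Rᵇ} {B} (mkHom {A = Rᵇ} {B} (λ x → x) (λ p → lift (▹-cong h (lower p))) (λ _ _ → lift (λ _ → refl)) (λ _ _ → lift (λ _ → refl)))
            (λ y → y , λ p → lift (▹-cong h (lower p)))
            (mkHom {A = K} {B} (λ k → lift (proj₁ (σj∈ k)))
              (λ {k} {k′} p → lift (λ i → trans (proj₂ (σj∈ k) i)
                (trans (lower (hom-cong (proj₁ s) (hom-cong j p)) i) (sym (proj₂ (σj∈ k′) i)))))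
              (λ k k′ → lift (λ i → trans (proj₂ (σj∈ (k K.+ᴹ k′)) i) (trans
                (trans (lower (hom-cong (proj₁ s) (hom-+ j k k′)) i) (lower (hom-+ (proj₁ s) _ _) i))
                (sym (trans (▹-+ h _ _ i) (+-cong (proj₂ (σj∈ k) i) (proj₂ (σj∈ k′) i)))))))
              (λ r k → lift (λ i → trans (proj₂ (σj∈ (r K.*ₗ k)) i) (trans
                (trans (lower (hom-cong (proj₁ s) (hom-* j r k)) i) (lower (hom-* (proj₁ s) _ _) i))
                (sym (trans (▹-* h _ _ i) (*-congˡ (proj₂ (σj∈ k) i))))))))

      f̃ : K.Carrierᴹ → V b
      f̃ k = lower (⟦ proj₁ f̂ ⟧ k)

      hf̃ : ∀ k → h ▹ f̃ k ≋ σ (⟦ j ⟧ k)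
      hf̃ k i = trans (lower (proj₂ f̂ k) i) (proj₂ (σj∈ k) i)

      ker⇒K : ∀ {u} → ⟦ α ⟧ u P.≈ᴹ P.0ᴹ → ∃[ k ] ⟦ j ⟧ k Q.≈ᴹ ⟦ proj₁ φ ⟧ u
      ker⇒K p = Equivalence.to (E.exact zero _) (P.≈ᴹ-trans (proj₂ φ _) p)

      -- As d kills P, the element φ (d x) comes from K. Injectivity of j makes the choice unique,
      -- hence linear in x.
      κ : ∀ x → ∃[ k ] ⟦ j ⟧ k Q.≈ᴹ ⟦ proj₁ φ ⟧ (d ⊡ x)
      κ x = ker⇒K (P.≈ᴹ-trans (hom-* α d x) (dP≈0 _))

      κ-unique : ∀ x {k} → ⟦ j ⟧ k Q.≈ᴹ ⟦ proj₁ φ ⟧ (d ⊡ x) → proj₁ (κ x) K.≈ᴹ k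
      κ-unique x p = E.injective (Q.≈ᴹ-trans (proj₂ (κ x)) (Q.≈ᴹ-sym p))

      f̃-cong : ∀ {k k′} → k K.≈ᴹ k′ → f̃ k ≋ f̃ k′
      f̃-cong p = lower (hom-cong (proj₁ f̂) p)

      -- A section of h over im h, evaluated at d x: θ lifts d x - σ φ (d x) and f̃ lifts σ φ (d x).
      Ŝ : Lin a b
      Ŝ = record
        { _▹_    = λ x → proj₁ θ ▹ (d ⊡ x) ⊹ f̃ (proj₁ (κ x))
        ; ▹-cong = λ {x} {y} p i → +-cong (▹-cong (proj₁ θ) (λ i → *-congˡ (p i)) i)
            (f̃-cong (κ-unique x (Q.≈ᴹ-trans (proj₂ (κ y)) (hom-cong (proj₁ φ) (λ i → *-congˡ (sym (p i)))))) i)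
        ; ▹-+    = λ x y i → trans (+-cong
              (trans (▹-cong (proj₁ θ) (λ i → distribˡ d _ _) i) (▹-+ (proj₁ θ) _ _ i))
              (trans (f̃-cong (κ-unique (x ⊹ y) (Q.≈ᴹ-trans (hom-+ j _ _) (Q.≈ᴹ-trans
                 (Q.+ᴹ-cong (proj₂ (κ x)) (proj₂ (κ y))) (Q.≈ᴹ-trans (Q.≈ᴹ-sym (hom-+ (proj₁ φ) _ _))
                 (hom-cong (proj₁ φ) (λ i → sym (distribˡ d _ _))))))) i)
                (lower (hom-+ (proj₁ f̂) _ _) i)))
            (interchange _ _ _ _)
        ; ▹-*    = λ r x i → trans (+-cong
              (trans (▹-cong (proj₁ θ) (λ i → swap d r (x i)) i) (▹-* (proj₁ θ) r _ i))
              (trans (f̃-cong (κ-unique (r ⊡ x) (Q.≈ᴹ-trans (hom-* j _ _) (Q.≈ᴹ-trans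
                 (Q.*ₗ-congˡ (proj₂ (κ x))) (Q.≈ᴹ-trans (Q.≈ᴹ-sym (hom-* (proj₁ φ) _ _))
                 (hom-cong (proj₁ φ) (λ i → swap r d (x i))))))) i)
                (lower (hom-* (proj₁ f̂) _ _) i)))
            (sym (distribˡ r _ _))
        }
        where
        interchange : ∀ x y z w → (x + y) + (z + w) ≈ (x + z) + (y + w)
        interchange = solve 4 (λ x y z w → (x :+ y) :+ (z :+ w) := (x :+ z) :+ (y :+ w)) refl
        swap : ∀ x y z → x * (y * z) ≈ y * (x * z)
        swap = solve 3 (λ x y z → x :* (y :* z) := y :* (x :* z)) refl

    pd≤1⇒good : Σ[ G ∈ Good d a ] (relations G presents α)
    pd≤1⇒good = record
        { h  = h
        ; S  = Ŝ
        ; hS = λ x i → trans (▹-+ h _ _ i) (trans (+-cong (proj₂ θ (d ⊡ x) i)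
                 (trans (hf̃ (proj₁ (κ x)) i) (lower (hom-cong (proj₁ s) (proj₂ (κ x))) i))) (add-back _ _))
        -- For u = h w the section is already defined at u, and Ŝ u is d times its value there.
        ; Sh = λ w → let k , p = ker⇒K {h ▹ w} (proj₁ h-presents (w , λ _ → refl)) in
            proj₁ θ ▹ (h ▹ w) ⊹ f̃ k , λ i → trans (+-cong
              (▹-* (proj₁ θ) d _ i)
              (trans (f̃-cong (κ-unique (h ▹ w) (Q.≈ᴹ-trans (hom-* j d k) (Q.≈ᴹ-trans (Q.*ₗ-congˡ p)
                (Q.≈ᴹ-sym (hom-* (proj₁ φ) d (h ▹ w)))))) i) (lower (hom-* (proj₁ f̂) d k) i)))
              (sym (distribˡ d _ _))
        }
      , h-presents
      where
      add-back : ∀ x y → (x - y) + y ≈ x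
      add-back = solve 2 (λ x y → (x :- y) :+ y := x) refl

  module _ {P : Module R ℓ ℓ} (pres : Presentation P) (γ : Hom (R ^ᴹ n) P) (γ-surj : IsSurjective γ) where
    private
      module P = Module P
      open Presentation pres using (π) renaming (a to a₀; b to b₀; surjective to π-surj)
      module G = AbelianGroupProperties P.+ᴹ-abelianGroup

    matrix : Lin b₀ a₀
    matrix = toLin (Presentation.h pres)

    matrix-presents : im matrix presents π
    matrix-presents = (λ { {x} (w , p) → Equivalence.from (Presentation.exact pres x) (w , p) })
                    , (λ {x} p → Equivalence.to (Presentation.exact pres x) p)

    γ-via-π : Lin n a₀
    γ-via-π = toLin (proj₁ (lift-free π π-surj γ))

    γ-via-π-correct : ∀ x → ⟦ π ⟧ (γ-via-π ▹ x) P.≈ᴹ ⟦ γ ⟧ x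
    γ-via-π-correct = proj₂ (lift-free π π-surj γ)

    π-via-γ : Lin a₀ n
    π-via-γ = toLin (proj₁ (lift-free γ γ-surj π))

    π-via-γ-correct : ∀ x → ⟦ γ ⟧ (π-via-γ ▹ x) P.≈ᴹ ⟦ π ⟧ x
    π-via-γ-correct = proj₂ (lift-free γ γ-surj π)

    hom-− : {α : Hom (R ^ᴹ a) P} (u v : V a) → ⟦ α ⟧ (λ i → u i - v i) P.≈ᴹ ⟦ α ⟧ u P.+ᴹ P.-ᴹ ⟦ α ⟧ v
    hom-− {α = α} u v = P.≈ᴹ-trans (hom-+ α u _) (P.+ᴹ-congˡ (hom-neg α v))

    -- With C = `γ-via-π` and D = `π-via-γ`, a relation x of γ is (x - D C x) + D (C x), where C x
    -- is a relation of π. Conversely all x - D C x and all D-images of relations of π are relations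
    -- of γ.
    kernelMap : Lin (n ℕ.+ b₀) n
    kernelMap = (pr₁ n +ᴸ -ᴸ (π-via-γ ∘ᴸ γ-via-π ∘ᴸ pr₁ n)) +ᴸ π-via-γ ∘ᴸ matrix ∘ᴸ pr₂ n

    kernelMap-presents : im kernelMap presents γ
    kernelMap-presents = (λ {x} (w , p) → P.≈ᴹ-trans (hom-cong γ (λ i → sym (p i))) (P.≈ᴹ-trans (hom-+ γ _ _)
        (P.≈ᴹ-trans (P.+ᴹ-cong
          (P.≈ᴹ-trans (hom-− {α = γ} _ _) (P.≈ᴹ-trans (P.+ᴹ-congˡ (P.-ᴹ‿cong (P.≈ᴹ-trans (π-via-γ-correct _) (γ-via-π-correct _)))) (P.-ᴹ‿inverseʳ _)))
          (P.≈ᴹ-trans (π-via-γ-correct _) (proj₁ matrix-presents (pr₂ n ▹ w , λ _ → refl)))) (P.+ᴹ-identityˡ _))))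
      , λ {x} γx≈0 → let v , p = proj₂ matrix-presents {γ-via-π ▹ x} (P.≈ᴹ-trans (γ-via-π-correct x) γx≈0) in
          x ⊕ v , λ i → trans (+-cong (+-cong (pr₁-⊕ x v i) (-‿cong (▹-cong (π-via-γ ∘ᴸ γ-via-π) (pr₁-⊕ x v) i)))
            (trans (▹-cong (π-via-γ ∘ᴸ matrix) (pr₂-⊕ x v) i) (▹-cong π-via-γ p i))) (add-back _ _)
      where
      add-back : ∀ x y → (x - y) + y ≈ x
      add-back = solve 2 (λ x y → (x :- y) :+ y := x) refl

    good-presentation : ProjectiveDimension≤ 1 P → ∀ {d} → (∀ x → d P.*ₗ x P.≈ᴹ P.0ᴹ) →
                        Σ[ G ∈ Good d n ] (relations G presents γ)
    good-presentation pd dP≈0 = pd≤1⇒good pd dP≈0 γ γ-surj kernelMap kernelMap-presents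

module Signs {c ℓ : Level} (𝓖 : AbelianGroup c ℓ) where
  open AbelianGroup 𝓖
  open AbelianGroupProperties 𝓖 using (⁻¹-involutive; ⁻¹-∙-comm; ε⁻¹≈ε)
  open SetoidReasoning setoid

  -- u to the power (−1)ˢ
  flip : ℕ → Carrier → Carrier
  flip zero    u = u
  flip (suc s) u = flip s u ⁻¹

  -- The integer exponent (-1)ˢ of the statement is matched with iterated inversion through its two
  -- possible values.
  sign-parity : ∀ s → ((-1ℤ ℤ.^ s ≡ 1ℤ) × (∀ u → flip s u ≈ u)) ⊎ ((-1ℤ ℤ.^ s ≡ -1ℤ) × (∀ u → flip s u ≈ u ⁻¹))
  sign-parity zero    = inj₁ (≡.refl , λ _ → refl)
  sign-parity (suc s) with sign-parity s
  ... | inj₁ (p , q) = inj₂ (≡.cong (-1ℤ ℤ.*_) p , λ u → ⁻¹-cong (q u))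
  ... | inj₂ (p , q) = inj₁ (≡.cong (-1ℤ ℤ.*_) p , λ u → trans (⁻¹-cong (q u)) (⁻¹-involutive u))

  flip-∙ : ∀ s u w → flip s (u ∙ w) ≈ flip s u ∙ flip s w
  flip-∙ zero    u w = refl
  flip-∙ (suc s) u w = trans (⁻¹-cong (flip-∙ s u w)) (sym (⁻¹-∙-comm (flip s u) (flip s w)))

  flip-ε : ∀ s → ε ≈ flip s ε
  flip-ε zero    = refl
  flip-ε (suc s) = trans (sym ε⁻¹≈ε) (⁻¹-cong (flip-ε s))

  flip-⁻¹ : ∀ s u → flip s (u ⁻¹) ≈ flip s u ⁻¹
  flip-⁻¹ zero    u = refl
  flip-⁻¹ (suc s) u = ⁻¹-cong (flip-⁻¹ s u)

  flip-cons : ∀ s u w → flip s u ∙ flip (suc (suc s)) w ≈ flip (suc s) ((u ∙ w) ⁻¹)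
  flip-cons s u w = begin
    flip s u ∙ flip s w ⁻¹ ⁻¹  ≈⟨ ∙-congˡ (⁻¹-involutive (flip s w)) ⟩
    flip s u ∙ flip s w        ≈⟨ flip-∙ s u w ⟨
    flip s (u ∙ w)             ≈⟨ ⁻¹-involutive _ ⟨
    flip s (u ∙ w) ⁻¹ ⁻¹       ≈⟨ ⁻¹-cong (flip-⁻¹ s (u ∙ w)) ⟨
    flip s ((u ∙ w) ⁻¹) ⁻¹     ∎

module Comparison (R : CommutativeRing 0ℓ 0ℓ) (𝓐 : RAlgebra R) (ι-inverse : RAlgebra.InvertsRegular 𝓐)
  {d : CommutativeRing.Carrier R} (d-reg : Fractions.IsRegular R d) where
  open RAlgebra 𝓐 using (A; ι)
  open CommutativeRing A hiding (zero)

  private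
    module R = CommutativeRing R
    variable
      a b c k k′ m n : ℕ
      v ℓ : Level
  open Linear R
  open Alternating R
  open Minors R
  open Blocks R
  open Factorisations R
  open Homs R
  open Schanuel R
  open Resolutions R 𝓐 ι-inverse d-reg public
  private
    module 𝓜 = CommutativeMonoid commutativeMonoid
    module 𝓤 = AbelianGroup unitGroup
    module 𝓤ₚ = AbelianGroupProperties unitGroup

  -- Independence of the generators. The automorphism (x , y) ↦ (x - C y , y + D (x - C y))
  -- satisfies γ(second block) = π x, so it carries H ⊠ Rⁿ to Rᵃ ⊠ U with a the number of generators
  -- in `pres`; full summands do not change Fit.
  Fit-presentation : {P : Module R ℓ ℓ} (pres : Presentation P) (γ : Hom (R ^ᴹ n) P) (γ-surj : IsSurjective γ) →
    (U : Sub n) → U presents γ → Fit U ≐ Fit (im (matrix pres γ γ-surj))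
  Fit-presentation {n = n} {P} pres γ γ-surj U U-presents = begin
    Fit U              ≈⟨ 𝓜.trans (𝓜.∙-congʳ {Fit U} (Fit-full a₀)) (𝓜.identityˡ _) ⟨
    Fit (full a₀) · Fit U  ≈⟨ Fit-⊠ (full a₀) U ⟨
    Fit (full a₀ ⊠ U)      ≈⟨ Fit-iso {U = H ⊠ full n} {full a₀ ⊠ U} ≡.refl T T⁻¹ T⁻¹T TT⁻¹ (λ {z} → T∈ {z}) (λ {z} → T⁻¹∈ {z}) ⟨
    Fit (H ⊠ full n)       ≈⟨ Fit-⊠ H (full n) ⟩
    Fit H · Fit (full n)   ≈⟨ 𝓜.trans (𝓜.∙-congˡ {Fit H} (Fit-full n)) (𝓜.identityʳ _) ⟩
    Fit H                  ∎
    where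
    open SetoidReasoning 𝓜.setoid
    open Presentation pres using (π) renaming (a to a₀)
    module P = Module P
    open Solver R using (solve; :0; _:+_; _:*_; _:-_; :-_; _:=_)
    C : Lin n a₀
    C = γ-via-π pres γ γ-surj
    D : Lin a₀ n
    D = π-via-γ pres γ γ-surj
    H : Sub a₀
    H = im (matrix pres γ γ-surj)
    T T⁻¹ : Lin (a₀ ℕ.+ n) (a₀ ℕ.+ n)
    T = (pr₁ a₀ +ᴸ -ᴸ (C ∘ᴸ pr₂ a₀)) ⊕ᴸ (pr₂ a₀ +ᴸ D ∘ᴸ (pr₁ a₀ +ᴸ -ᴸ (C ∘ᴸ pr₂ a₀)))
    T⁻¹ = (pr₁ a₀ +ᴸ C ∘ᴸ (pr₂ a₀ +ᴸ -ᴸ (D ∘ᴸ pr₁ a₀))) ⊕ᴸ (pr₂ a₀ +ᴸ -ᴸ (D ∘ᴸ pr₁ a₀))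

    add-back : ∀ x y → (x R.- y) R.+ y R.≈ x
    add-back = solve 2 (λ x y → (x :- y) :+ y := x) R.refl
    take-away : ∀ x y → (x R.+ y) R.- y R.≈ x
    take-away = solve 2 (λ x y → (x :+ y) :- y := x) R.refl

    T₁ : ∀ z → pr₁ a₀ ▹ (T ▹ z) ≋ (pr₁ a₀ +ᴸ -ᴸ (C ∘ᴸ pr₂ a₀)) ▹ z
    T₁ z = pr₁-⊕ {a₀} _ _
    T₂ : ∀ z → pr₂ a₀ ▹ (T ▹ z) ≋ (pr₂ a₀ +ᴸ D ∘ᴸ (pr₁ a₀ +ᴸ -ᴸ (C ∘ᴸ pr₂ a₀))) ▹ z
    T₂ z = pr₂-⊕ {a₀} _ _
    T⁻¹₁ : ∀ z → pr₁ a₀ ▹ (T⁻¹ ▹ z) ≋ (pr₁ a₀ +ᴸ C ∘ᴸ (pr₂ a₀ +ᴸ -ᴸ (D ∘ᴸ pr₁ a₀))) ▹ z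
    T⁻¹₁ z = pr₁-⊕ {a₀} _ _
    T⁻¹₂ : ∀ z → pr₂ a₀ ▹ (T⁻¹ ▹ z) ≋ (pr₂ a₀ +ᴸ -ᴸ (D ∘ᴸ pr₁ a₀)) ▹ z
    T⁻¹₂ z = pr₂-⊕ {a₀} _ _

    T⁻¹T : ∀ z → T⁻¹ ▹ (T ▹ z) ≋ z
    T⁻¹T z = ⊕-ext a₀
        (λ i → R.trans (T⁻¹₁ (T ▹ z) i) (R.trans (R.+-cong (T₁ z i) (▹-cong C second i)) (add-back _ _)))
        (λ i → R.trans (T⁻¹₂ (T ▹ z) i) (second i))
      where
      second : (pr₂ a₀ +ᴸ -ᴸ (D ∘ᴸ pr₁ a₀)) ▹ (T ▹ z) ≋ pr₂ a₀ ▹ z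
      second i = R.trans (R.+-cong (T₂ z i) (R.-‿cong (▹-cong D (T₁ z) i))) (take-away _ _)

    TT⁻¹ : ∀ z → T ▹ (T⁻¹ ▹ z) ≋ z
    TT⁻¹ z = ⊕-ext a₀
        (λ i → R.trans (T₁ (T⁻¹ ▹ z) i) (first i))
        (λ i → R.trans (T₂ (T⁻¹ ▹ z) i) (R.trans (R.+-cong (T⁻¹₂ z i) (▹-cong D first i)) (add-back _ _)))
      where
      first : (pr₁ a₀ +ᴸ -ᴸ (C ∘ᴸ pr₂ a₀)) ▹ (T⁻¹ ▹ z) ≋ pr₁ a₀ ▹ z
      first i = R.trans (R.+-cong (T⁻¹₁ z i) (R.-‿cong (▹-cong C (T⁻¹₂ z) i))) (take-away _ _)

    πC₀ : ∀ x → ⟦ π ⟧ (C ▹ x) P.≈ᴹ ⟦ γ ⟧ x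
    πC₀ = γ-via-π-correct pres γ γ-surj
    γD₀ : ∀ x → ⟦ γ ⟧ (D ▹ x) P.≈ᴹ ⟦ π ⟧ x
    γD₀ = π-via-γ-correct pres γ γ-surj

    T∈ : ∀ {z} → z ∈ₛ H ⊠ full n → T ▹ z ∈ₛ full a₀ ⊠ U
    T∈ {z} (x∈ , _) = _ , proj₂ U-presents (P.≈ᴹ-trans (hom-cong γ (T₂ z)) (P.≈ᴹ-trans (hom-+ γ _ _)
      (P.≈ᴹ-trans (P.+ᴹ-congˡ (P.≈ᴹ-trans (γD₀ _) (P.≈ᴹ-trans (hom-+ π _ _)
        (P.≈ᴹ-trans (P.+ᴹ-cong (proj₁ (matrix-presents pres γ γ-surj) x∈) (P.≈ᴹ-trans (hom-neg π _) (P.-ᴹ‿cong (πC₀ _))))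
          (P.+ᴹ-identityˡ _))))) (P.-ᴹ‿inverseʳ _))))

    T⁻¹∈ : ∀ {z} → z ∈ₛ full a₀ ⊠ U → T⁻¹ ▹ z ∈ₛ H ⊠ full n
    T⁻¹∈ {z} (_ , y∈) = proj₂ (matrix-presents pres γ γ-surj) (P.≈ᴹ-trans (hom-cong π (T⁻¹₁ z)) (P.≈ᴹ-trans (hom-+ π _ _)
      (P.≈ᴹ-trans (P.+ᴹ-congˡ (P.≈ᴹ-trans (πC₀ _) (P.≈ᴹ-trans (hom-+ γ _ _)
        (P.≈ᴹ-trans (P.+ᴹ-cong (proj₁ U-presents y∈) (P.≈ᴹ-trans (hom-neg γ _) (P.-ᴹ‿cong (γD₀ _))))
          (P.+ᴹ-identityˡ _))))) (P.-ᴹ‿inverseʳ _)))) , _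

  extendᴬ : Ideal R → FI
  extendᴬ I = span M (λ x → ∃[ r ] (r ∈ₛ I) × x ≈ ι r)

  -- The Fitting ideal of the statement uses increasing choices of columns, whereas `Fit` uses
  -- arbitrary tuples of relations; `increasing-minors` bridges the gap.
  Fit-FittingIdeal : {P : Module R ℓ ℓ} (pres : Presentation P) →
                     extendᴬ (FittingIdeal pres) ≐ Fit (im (toLin (Presentation.h pres)))
  Fit-FittingIdeal pres = mk≐
      (span-⊆ {I = Fit U} λ (r , r∈ , x≈) → resp (Fit U) (sym x≈) (minors r∈))
      (Fit-⊆ U E λ {X} X∈ → let W , W≋ = preimages X∈ in
        resp E (ι-cong (Alt-cong (det-Alt a₀) W≋))
          (increasing-minors (ι-ideal E) (λ W → det (map (H ▹_) W)) (Alt-pull H (det-Alt a₀))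
            (λ c c↗ → span-gen (_ , span-gen (c , c↗ , R.refl) ,
               ι-cong (R.sym (R.trans (det-Laplace (λ i j → toMatrix (Presentation.h pres) i (c j)))
                 (R.reflexive (≡.cong (det {a₀}) (Vec.tabulate-∘ (H ▹_) (e ∘ c))))))))
            W))
    where
    open Presentation pres using () renaming (a to a₀; b to b₀)
    H : Lin b₀ a₀
    H = toLin (Presentation.h pres)
    U : Sub a₀
    U = im H
    E : FI
    E = extendᴬ (FittingIdeal pres)
    open IsIdeal (ι-ideal (Fit U))

    columns∈ : ∀ {l} (c : Fin l → Fin b₀) → All (_∈ₛ U) (tabulate (λ j → H ▹ e (c j)))
    columns∈ {zero}  c = []
    columns∈ {suc l} c = (e (c zero) , λ _ → R.refl) ∷ columns∈ (c ∘ suc)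

    minors : ∀ {r} → r ∈ₛ FittingIdeal pres → ι r ∈ₛ Fit U
    minors (span-gen (c , _ , r≈)) = J-resp (R.sym (R.trans r≈ (det-Laplace (λ i j → toMatrix (Presentation.h pres) i (c j)))))
      (Fit-gen U (columns∈ c))
    minors (span-resp r≈s p) = J-resp r≈s (minors p)
    minors span-0            = J-0
    minors (span-+ p q)      = J-+ (minors p) (minors q)
    minors (span-*ₗ r p)     = J-* r (minors p)

    preimages : ∀ {l} {X : Vec (V a₀) l} → All (_∈ₛ U) X → Σ[ W ∈ Vec (V b₀) l ] Pointwise _≋_ (map (H ▹_) W) X
    preimages []             = [] , []
    preimages ((w , p) ∷ ps) = let W , qs = preimages ps in w ∷ W , p ∷ qs

  ∏ᴬ : Vector FI n → FI
  ∏ᴬ = foldr _·_ 𝟙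

  _^ⁿ_ : FI → ℕ → FI
  I ^ⁿ zero  = 𝟙
  I ^ⁿ suc k = I · (I ^ⁿ k)

  _^ᶻ_ : FI → ℤ → FI
  I ^ᶻ (+ k)      = I ^ⁿ k
  I ^ᶻ (-[1+ k ]) = (I ⁻) ^ⁿ suc k

  ⁻-cong : ∀ {I J} → I ≐ J → I ⁻ ≐ J ⁻
  ⁻-cong I≐J = mk≐ (λ p y y∈ → p y (⊆⃖ I≐J y∈)) (λ p y y∈ → p y (⊆⃗ I≐J y∈))

  ∏ᴬ-cong : {I J : Vector FI n} → (∀ i → I i ≐ J i) → ∏ᴬ I ≐ ∏ᴬ J
  ∏ᴬ-cong {zero}  I≐J = 𝓜.refl
  ∏ᴬ-cong {suc n} I≐J = 𝓜.∙-cong (I≐J zero) (∏ᴬ-cong (I≐J ∘ suc))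

  Tracks : {Q : V c → Set v} {X : Sub k} → Res Q n X → (Fin n → FI) → Set
  Tracks (nil _)                _ = ⊤
  Tracks (cons G _ r) I = (Fit (relations G) ≐ I zero) × Tracks r (I ∘ suc)

  open Signs unitGroup

  private
    power-flip : ∀ s (G : Good d n) {I} → Fit (relations G) ≐ I → I ^ᶻ (-1ℤ ℤ.^ s) ≐ value (flip s (fitting G))
    power-flip s G {I} p = [ positive , negative ]′ (sign-parity s)
      where
      positive : (-1ℤ ℤ.^ s ≡ 1ℤ) × (∀ u → flip s u 𝓤.≈ u) → I ^ᶻ (-1ℤ ℤ.^ s) ≐ value (flip s (fitting G))
      positive (eq , q) = 𝓜.trans (𝓜.reflexive (≡.cong (I ^ᶻ_) eq))
        (𝓜.trans (𝓜.identityʳ I) (𝓜.trans (𝓜.sym p) (𝓜.sym (q (fitting G)))))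
      negative : (-1ℤ ℤ.^ s ≡ -1ℤ) × (∀ u → flip s u 𝓤.≈ u 𝓤.⁻¹) → I ^ᶻ (-1ℤ ℤ.^ s) ≐ value (flip s (fitting G))
      negative (eq , q) = 𝓜.trans (𝓜.reflexive (≡.cong (I ^ᶻ_) eq))
        (𝓜.trans (𝓜.identityʳ (I ⁻)) (𝓜.trans (⁻-cong (𝓜.sym p)) (𝓜.sym (q (fitting G)))))

  -- The starting exponent s is free because passing to the tail raises it by one. The extra
  -- inversion in `flip (suc s)` accounts for `alternating` beginning with exponent -1.
  ∏-flip : {Q : V c → Set v} {X : Sub k} (r : Res Q n X) {I : Fin n → FI} → Tracks r I → ∀ s →
           ∏ᴬ (λ i → I i ^ᶻ (-1ℤ ℤ.^ (s ℕ.+ toℕ i))) ≐ value (flip (suc s) (alternating r))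
  ∏-flip (nil _) _ s = flip-ε (suc s)
  ∏-flip {n = suc n} (cons G _ r) {I} (p , tr) s = 𝓜.trans
    (𝓜.∙-cong
      (𝓜.trans (𝓜.reflexive (≡.cong (λ t → I zero ^ᶻ (-1ℤ ℤ.^ t)) (ℕ.+-identityʳ s))) (power-flip s G p))
      (𝓜.trans (∏ᴬ-cong (λ i → 𝓜.reflexive (≡.cong (λ t → I (suc i) ^ᶻ (-1ℤ ℤ.^ t)) (ℕ.+-suc s (toℕ i)))))
        (∏-flip r tr (suc s))))
    (flip-cons s (fitting G) (alternating r))

  ∏-alternating : {Q : V c → Set v} {X : Sub k} (r : Res Q n X) {I : Fin n → FI} → Tracks r I →
                  ∏ᴬ (λ i → I i ^ᶻ (-1ℤ ℤ.^ suc (toℕ i))) ≐ value (alternating r)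
  ∏-alternating r tr = 𝓜.trans (∏-flip r tr 1) (𝓤ₚ.⁻¹-involutive (alternating r))

  -- For 0 → N → P → L → 0, a presentation of P on generators of N and lifts of generators of L.
  record Adapted {L : Module R ℓ ℓ} (X : Sub k) (β : Hom (R ^ᴹ m) L) (I : FI) : Set ℓ where
    field
      G           : Good d (k ℕ.+ m)
      kernel-G    : (_∈ₛ kernel k G) ≑ (_∈ₛ X)
      quotient-G  : quotient k G presents β
      Fit-G       : Fit (relations G) ≐ I
  open Adapted

  module _ {N P L : Module R ℓ ℓ} (i : Hom N P) (q : Hom P L) (i-inj : IsInjective i) (i-q : IsExact i q)
           (q-surj : IsSurjective q) (pres : Presentation P) (pd : ProjectiveDimension≤ 1 P)
           (dP≈0 : ∀ x → Module._≈ᴹ_ P (Module._*ₗ_ P d x) (Module.0ᴹ P))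
           (α : Hom (R ^ᴹ k) N) (α-surj : IsSurjective α) (X : Sub k) (X-presents : X presents α)
           (β : Hom (R ^ᴹ m) L) (β-surj : IsSurjective β) where
    private
      module N = Module N
      module P = Module P
      module L = Module L

      β̂ : Hom (R ^ᴹ m) P
      β̂ = proj₁ (lift-free q q-surj β)
      qβ̂ : ∀ x → ⟦ q ⟧ (⟦ β̂ ⟧ x) L.≈ᴹ ⟦ β ⟧ x
      qβ̂ = proj₂ (lift-free q q-surj β)

      qi : ∀ x → ⟦ q ⟧ (⟦ i ⟧ x) L.≈ᴹ L.0ᴹ
      qi x = Equivalence.from (i-q _) (x , P.≈ᴹ-refl)

      interchange : ∀ x y z w → (x P.+ᴹ y) P.+ᴹ (z P.+ᴹ w) P.≈ᴹ (x P.+ᴹ z) P.+ᴹ (y P.+ᴹ w)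
      interchange = CommutativeSemigroupProperties.interchange (AbelianGroup.commutativeSemigroup P.+ᴹ-abelianGroup)

      γ : Hom (R ^ᴹ (k ℕ.+ m)) P
      γ = mkHom {A = R ^ᴹ (k ℕ.+ m)} {P} (λ z → ⟦ i ⟧ (⟦ α ⟧ (pr₁ k ▹ z)) P.+ᴹ ⟦ β̂ ⟧ (pr₂ k ▹ z))
        (λ p → P.+ᴹ-cong (hom-cong i (hom-cong α (λ j → p _))) (hom-cong β̂ (λ j → p _)))
        (λ u w → P.≈ᴹ-trans (P.+ᴹ-cong (P.≈ᴹ-trans (hom-cong i (hom-+ α _ _)) (hom-+ i _ _)) (hom-+ β̂ _ _)) (interchange _ _ _ _))
        (λ r u → P.≈ᴹ-trans (P.+ᴹ-cong (P.≈ᴹ-trans (hom-cong i (hom-* α _ _)) (hom-* i _ _)) (hom-* β̂ _ _)) (P.≈ᴹ-sym (P.*ₗ-distribˡ r _ _)))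

      γ-⊕ : ∀ x y → ⟦ γ ⟧ (x ⊕ y) P.≈ᴹ ⟦ i ⟧ (⟦ α ⟧ x) P.+ᴹ ⟦ β̂ ⟧ y
      γ-⊕ x y = P.+ᴹ-cong (hom-cong i (hom-cong α (pr₁-⊕ x y))) (hom-cong β̂ (pr₂-⊕ x y))

      preimage-α : ∀ {y} → ⟦ q ⟧ y L.≈ᴹ L.0ᴹ → ∃[ x ] ⟦ i ⟧ (⟦ α ⟧ x) P.≈ᴹ y
      preimage-α p = let n₀ , q₀ = Equivalence.to (i-q _) p ; x , q₁ = α-surj n₀ in
        x , P.≈ᴹ-trans (hom-cong i (q₁ (λ _ → R.refl))) q₀

      γ-surj : IsSurjective γ
      γ-surj y = let c , βc = β-surj (⟦ q ⟧ y)
                     x , p = preimage-α {y P.+ᴹ P.-ᴹ ⟦ β̂ ⟧ c} (L.≈ᴹ-trans (hom-+ q _ _) (L.≈ᴹ-trans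
                       (L.+ᴹ-congˡ (L.≈ᴹ-trans (hom-neg q _) (L.-ᴹ‿cong (L.≈ᴹ-trans (qβ̂ c) (βc (λ _ → R.refl))))))
                       (L.-ᴹ‿inverseʳ _)))
                 in x ⊕ c , λ z≋ → P.≈ᴹ-trans (hom-cong γ z≋) (P.≈ᴹ-trans (γ-⊕ x c)
                   (P.≈ᴹ-trans (P.+ᴹ-congʳ p) (P.≈ᴹ-trans (P.+ᴹ-assoc _ _ _)
                     (P.≈ᴹ-trans (P.+ᴹ-congˡ (P.-ᴹ‿inverseˡ _)) (P.+ᴹ-identityʳ _)))))

      Gγ : Σ[ G ∈ Good d (k ℕ.+ m) ] (relations G presents γ)
      Gγ = good-presentation pres γ γ-surj pd dP≈0

      adapted-Fit : Fit (relations (proj₁ Gγ)) ≐ extendᴬ (FittingIdeal pres)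
      adapted-Fit = 𝓜.trans (Fit-presentation pres γ γ-surj (relations (proj₁ Gγ)) (proj₂ Gγ)) (𝓜.sym (Fit-FittingIdeal pres))

      adapted-kernel : (_∈ₛ kernel k (proj₁ Gγ)) ≑ (_∈ₛ X)
      adapted-kernel = (λ {x} p → proj₂ X-presents (i-inj (P.≈ᴹ-trans (P.≈ᴹ-sym (γ-inl x)) (P.≈ᴹ-trans (proj₁ (proj₂ Gγ) p) (P.≈ᴹ-sym (hom-0 i))))))
                     , (λ {x} p → proj₂ (proj₂ Gγ) (P.≈ᴹ-trans (γ-inl x) (P.≈ᴹ-trans (hom-cong i (proj₁ X-presents p)) (hom-0 i))))
        where
        γ-inl : ∀ x → ⟦ γ ⟧ (inl ▹ x) P.≈ᴹ ⟦ i ⟧ (⟦ α ⟧ x)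
        γ-inl x = P.≈ᴹ-trans (γ-⊕ x 𝟎) (P.≈ᴹ-trans (P.+ᴹ-congˡ (hom-0 β̂)) (P.+ᴹ-identityʳ _))

      adapted-quotient : quotient k (proj₁ Gγ) presents β
      adapted-quotient =
          (λ {y} (w , p) → L.≈ᴹ-trans (L.≈ᴹ-sym (L.≈ᴹ-trans (qβ̂ _) (hom-cong β p)))
             (L.≈ᴹ-trans (L.≈ᴹ-sym (L.≈ᴹ-trans (hom-+ q _ _) (L.≈ᴹ-trans (L.+ᴹ-congʳ (qi _)) (L.+ᴹ-identityˡ _))))
               (L.≈ᴹ-trans (hom-cong q (proj₁ (proj₂ Gγ) (w , λ _ → R.refl))) (hom-0 q))))
        -- If β y = 0, then β̂ y = i α x for some x, so (-x , y) is a relation of P lying over y.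
        , (λ {y} p → let x , ix = preimage-α (L.≈ᴹ-trans (qβ̂ y) p)
                         w , hw = proj₂ (proj₂ Gγ) {(λ j → R.- x j) ⊕ y} (P.≈ᴹ-trans (γ-⊕ _ y) (P.≈ᴹ-trans
                           (P.+ᴹ-congʳ (P.≈ᴹ-trans (hom-cong i (hom-neg α x)) (P.≈ᴹ-trans (hom-neg i _) (P.-ᴹ‿cong ix))))
                           (P.-ᴹ‿inverseˡ _)))
                     in w , λ j → R.trans (hw _) (pr₂-⊕ (λ j → R.- x j) y j))

    adapted : Adapted X β (extendᴬ (FittingIdeal pres))
    adapted = record
      { G = proj₁ Gγ ; kernel-G = adapted-kernel ; quotient-G = adapted-quotient ; Fit-G = adapted-Fit }

  open ExactSequence renaming (d to ∂)

  module _ {ℓ : Level} {M : Module R ℓ ℓ} (γ : Hom (R ^ᴹ c) M) (γ-surj : IsSurjective γ) where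

    private
      Q : V c → Set _
      Q x = Module._≈ᴹ_ M (⟦ γ ⟧ x) (Module.0ᴹ M)

      -- The image of P₁ → P₂ takes the place of N. Taken as a coimage, it has an injective
      -- inclusion by the very definition of its equality, and the generators of P₁ generate it.
      truncate : {N : Module R ℓ ℓ} {P : Vector (Module R ℓ ℓ) (suc (suc n))} (seq : ExactSequence N P M) →
                 ExactSequence (Coimage ℓ (∂ seq (suc zero))) (P ∘ suc) M
      truncate {N = N} {P} seq = record
        { d          = λ { zero → mkHom {A = Coimage _ (∂ seq (suc zero))} {P (suc zero)} (λ x → ⟦ ∂ seq (suc zero) ⟧ (lower x)) lower
                             (λ _ _ → hom-+ (∂ seq (suc zero)) _ _) (λ _ _ → hom-* (∂ seq (suc zero)) _ _)
                         ; (suc i) → ∂ seq (suc (suc i)) }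
        ; injective  = lift
        ; exact      = λ { zero y → mk⇔
                             (λ p → let x , q = Equivalence.to (exact seq (suc zero) y) p in lift x , q)
                             (λ (x , q) → Equivalence.from (exact seq (suc zero) y) (lower x , q))
                         ; (suc i) → exact seq (suc (suc i)) }
        ; surjective = surjective seq
        }

      module _ {N : Module R ℓ ℓ} {P : Vector (Module R ℓ ℓ) (suc (suc n))} (seq : ExactSequence N P M) where
        private
          ∂₁ : Hom (P zero) (P (suc zero))
          ∂₁ = ∂ seq (suc zero)
          module P₁ = Module (P (suc zero))

        truncation : Hom (P zero) (Coimage ℓ ∂₁)
        truncation = mkHom {A = P zero} {Coimage ℓ ∂₁} lift (λ p → lift (hom-cong ∂₁ p))
          (λ _ _ → lift P₁.≈ᴹ-refl) (λ _ _ → lift P₁.≈ᴹ-refl)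

        truncation-exact : IsExact (∂ seq zero) truncation
        truncation-exact y = mk⇔
          (λ p → Equivalence.to (exact seq zero y) (P₁.≈ᴹ-trans (lower p) (hom-0 ∂₁)))
          (λ p → lift (P₁.≈ᴹ-trans (Equivalence.from (exact seq zero y) p) (P₁.≈ᴹ-sym (hom-0 ∂₁))))

        truncation-surj : IsSurjective truncation
        truncation-surj y = lower y , λ p → lift (hom-cong ∂₁ p)

        truncation-gens : (pres : Presentation (P zero)) → Hom (R ^ᴹ Presentation.a pres) (Coimage ℓ ∂₁)
        truncation-gens pres = mkHom {A = R ^ᴹ Presentation.a pres} {Coimage ℓ ∂₁} (λ x → lift (⟦ π ⟧ x)) (λ p → lift (hom-cong ∂₁ (hom-cong π p)))
            (λ _ _ → lift (hom-cong ∂₁ (hom-+ π _ _))) (λ _ _ → lift (hom-cong ∂₁ (hom-* π _ _)))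
          where open Presentation pres using (π)

        truncation-gens-surj : (pres : Presentation (P zero)) → IsSurjective (truncation-gens pres)
        truncation-gens-surj pres y = let x , p = Presentation.surjective pres (lower y) in x , λ q → lift (hom-cong ∂₁ (p q))

    cons-adapted : {L : Module R ℓ ℓ} {X : Sub k} {β : Hom (R ^ᴹ m) L} (I : Fin (suc n) → FI) →
      (E : Adapted X β (I zero)) → Σ[ r ∈ Res Q n (quotient k (G E)) ] Tracks r (I ∘ suc) →
      Σ[ r ∈ Res Q (suc n) X ] Tracks r I
    cons-adapted I E (r , tracks) = cons (G E) (kernel-G E) r , Fit-G E , tracks

    -- The relations found for the image at one step become the X of the next. Intermediate images
    -- are generated by the given generators of the preceding P, but the last module by γ, so that
    -- all sequences end in the same Q.
    resolve : ∀ n {N : Module R ℓ ℓ} {P : Vector (Module R ℓ ℓ) (suc n)} → ExactSequence N P M →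
              (pres : ∀ i → Presentation (P i)) → (∀ i → ProjectiveDimension≤ 1 (P i)) →
              (∀ i x → Module._≈ᴹ_ (P i) (Module._*ₗ_ (P i) d x) (Module.0ᴹ (P i))) →
              (α : Hom (R ^ᴹ k) N) → IsSurjective α → (X : Sub k) → X presents α →
              Σ[ r ∈ Res Q (suc n) X ] Tracks r (λ i → extendᴬ (FittingIdeal (pres i)))
    resolve zero seq pres pd dP≈0 α α-surj X X-presents =
        cons-adapted (λ i → extendᴬ (FittingIdeal (pres i))) step (nil (quotient-G step) , _)
      where
      step : Adapted X γ (extendᴬ (FittingIdeal (pres zero)))
      step = adapted (∂ seq zero) (∂ seq (suc zero)) (injective seq) (exact seq zero) (surjective seq)
        (pres zero) (pd zero) (dP≈0 zero) α α-surj X X-presents γ γ-surj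
    resolve {k = k} (suc n) seq pres pd dP≈0 α α-surj X X-presents =
        cons-adapted (λ i → extendᴬ (FittingIdeal (pres i))) step
          (resolve n (truncate seq) (pres ∘ suc) (pd ∘ suc) (dP≈0 ∘ suc) β (truncation-gens-surj seq (pres zero))
            (quotient k (G step)) (quotient-G step))
      where
      β : Hom (R ^ᴹ Presentation.a (pres zero)) (Coimage ℓ (∂ seq (suc zero)))
      β = truncation-gens seq (pres zero)
      step : Adapted X β (extendᴬ (FittingIdeal (pres zero)))
      step = adapted (∂ seq zero) (truncation seq) (injective seq) (truncation-exact seq) (truncation-surj seq)
        (pres zero) (pd zero) (dP≈0 zero) α α-surj X X-presents β (truncation-gens-surj seq (pres zero))

    -- For n = 0 the end must be given on the generators γ, so N ≅ M is presented anew on them; for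
    -- n > 0 the presentation of N is used as it stands.
    resolution : ∀ n {N : Module R ℓ ℓ} {P : Vector (Module R ℓ ℓ) n} → ExactSequence N P M →
      (presN : Presentation N) (pres : ∀ i → Presentation (P i)) → (∀ i → ProjectiveDimension≤ 1 (P i)) →
      (∀ i x → Module._≈ᴹ_ (P i) (Module._*ₗ_ (P i) d x) (Module.0ᴹ (P i))) →
      Σ[ k ∈ ℕ ] Σ[ X ∈ Sub k ] Σ[ r ∈ Res Q n X ]
        (Fit X ≐ extendᴬ (FittingIdeal presN)) × Tracks r (λ i → extendᴬ (FittingIdeal (pres i)))
    resolution zero {N = N} seq presN pres pd dP≈0 = c , X
        , nil ((λ {x} p → M.≈ᴹ-trans (M.≈ᴹ-sym (fγ̂ x)) (M.≈ᴹ-trans (hom-cong f (proj₁ X-presents p)) (hom-0 f)))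
             , (λ {x} p → proj₂ X-presents (injective seq (M.≈ᴹ-trans (fγ̂ x) (M.≈ᴹ-trans p (M.≈ᴹ-sym (hom-0 f)))))))
        , 𝓜.trans (Fit-presentation presN γ̂ γ̂-surj X X-presents) (𝓜.sym (Fit-FittingIdeal presN))
        , _
      where
      module M = Module M
      f : Hom N M
      f = ∂ seq zero
      γ̂ : Hom (R ^ᴹ c) N
      γ̂ = proj₁ (lift-free f (surjective seq) γ)
      fγ̂ : ∀ x → ⟦ f ⟧ (⟦ γ̂ ⟧ x) M.≈ᴹ ⟦ γ ⟧ x
      fγ̂ = proj₂ (lift-free f (surjective seq) γ)
      γ̂-surj : IsSurjective γ̂
      γ̂-surj y = let x , p = γ-surj (⟦ f ⟧ y) in x , λ q → injective seq (M.≈ᴹ-trans (fγ̂ _) (p q))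
      X : Sub c
      X = im (kernelMap presN γ̂ γ̂-surj)
      X-presents : X presents γ̂
      X-presents = kernelMap-presents presN γ̂ γ̂-surj
    resolution (suc n) seq presN pres pd dP≈0 =
      let r , tracks = resolve n seq pres pd dP≈0 π (Presentation.surjective presN) (im (toLin (Presentation.h presN))) π-presents
      in _ , _ , r , 𝓜.sym (Fit-FittingIdeal presN) , tracks
      where
      open Presentation presN using (π)
      π-presents : im (toLin (Presentation.h presN)) presents π
      π-presents = (λ { {x} p → Equivalence.from (Presentation.exact presN x) p })
                 , (λ {x} p → Equivalence.to (Presentation.exact presN x) p)

-- The ring ℤₚ⟦T⟧[Δ]

module _ {p : ℕ} (p-prime : Prime p) where
  private instance
    p≢0 : NonZero p
    p≢0 = prime⇒nonZero p-prime

  -- The hypotheses say that the p-adic valuation of a * b is at least k + n and that of a is below k.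
  prime-power-cancel : ∀ k n a b → p ℕ.^ (k ℕ.+ n) ℕ∣.∣ a ℕ.* b → ¬ p ℕ.^ k ℕ∣.∣ a → p ℕ.^ n ℕ∣.∣ b
  prime-power-cancel zero    n a b _ p^k∤a = contradiction (ℕ∣.1∣ a) p^k∤a
  prime-power-cancel (suc k) n a b p^∣ab p^k∤a with p ℕ∣.∣? a
  ... | yes (ℕ∣.divides-refl a′) = prime-power-cancel k n a′ b
          (ℕ∣.*-cancelˡ-∣ p (≡.subst (p ℕ.* p ℕ.^ (k ℕ.+ n) ℕ∣.∣_) eq p^∣ab))
          (λ q → p^k∤a (≡.subst (p ℕ.* p ℕ.^ k ℕ∣.∣_) (ℕ.*-comm p a′) (ℕ∣.*-monoʳ-∣ p q)))
    where
    eq : a′ ℕ.* p ℕ.* b ≡ p ℕ.* (a′ ℕ.* b)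
    eq = ≡.trans (≡.cong (ℕ._* b) (ℕ.*-comm a′ p)) (ℕ.*-assoc p a′ b)
  -- When p does not divide a, Euclid's lemma moves the whole power of p over to b.
  ... | no p∤a = ℕ∣.∣-trans (ℕ∣.∣-trans (ℕ∣.n∣m*n (p ℕ.^ suc k)) (ℕ∣.∣-reflexive (≡.sym (ℕ.^-distribˡ-+-* p (suc k) n))))
                   (coprime-part (suc k ℕ.+ n) b p^∣ab)
    where
    coprime-part : ∀ m b → p ℕ.^ m ℕ∣.∣ a ℕ.* b → p ℕ.^ m ℕ∣.∣ b
    coprime-part zero    b _ = ℕ∣.1∣ b
    coprime-part (suc m) b p^∣ab with euclidsLemma a b p-prime (ℕ∣.∣-trans (ℕ∣.m∣m*n (p ℕ.^ m)) p^∣ab)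
    ... | inj₁ p∣a = contradiction p∣a p∤a
    ... | inj₂ (ℕ∣.divides-refl b′) = ≡.subst (p ℕ.* p ℕ.^ m ℕ∣.∣_) (ℕ.*-comm p b′)
            (ℕ∣.*-monoʳ-∣ p (coprime-part m b′ (ℕ∣.*-cancelˡ-∣ p (≡.subst (p ℕ.* p ℕ.^ m ℕ∣.∣_) eq p^∣ab))))
      where
      eq : a ℕ.* (b′ ℕ.* p) ≡ p ℕ.* (a ℕ.* b′)
      eq = ≡.trans (≡.sym (ℕ.*-assoc a b′ p)) (ℕ.*-comm (a ℕ.* b′) p)

-- Equality with 0 is not decidable in ℤₚ⟦T⟧, but its stability admits classical reasoning.
record IsDomain (A : CommutativeRing 0ℓ 0ℓ) : Set where
  open CommutativeRing A
  field
    stable : ∀ {a} → ¬ ¬ (a ≈ 0#) → a ≈ 0#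
    cancel : ∀ {a b} → ¬ (a ≈ 0#) → a * b ≈ 0# → b ≈ 0#

module _ {p : ℕ} (p-prime : Prime p) where
  open PAdic p hiding (ℤₚ-ring)
  open CommutativeRing (ℤₚ-ring p) using (_≈_; 0#; _*_)

  private
    vanishes : ℤₚ → ℕ → Set
    vanishes x n = p ℕ.^ n ℕ∣.∣ ℤ.∣ approx x n ∣

    ≈0⇒vanishes : ∀ {x} → x ≈ 0# → ∀ n → vanishes x n
    ≈0⇒vanishes {x} x≈0 n = ≡.subst (λ z → p ℕ.^ n ℕ∣.∣ ℤ.∣ z ∣) (ℤ.+-identityʳ (approx x n)) (ℤ∣.∣⇒∣ᵤ (x≈0 n))

    vanishes⇒≈0 : ∀ {x} → (∀ n → vanishes x n) → x ≈ 0#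
    vanishes⇒≈0 {x} v n = ≡.subst (+ (p ℕ.^ n) ∣_) (≡.sym (ℤ.+-identityʳ (approx x n))) (ℤ∣.∣ᵤ⇒∣ (v n))

    coherent⁺ : ∀ x n j → + (p ℕ.^ n) ∣ approx x (j ℕ.+ n) ℤ.- approx x n
    coherent⁺ x n zero    = divides (+ 0) (ℤ.+-inverseʳ (approx x n))
    coherent⁺ x n (suc j) = ≡.subst (+ (p ℕ.^ n) ∣_) (telescope (approx x (suc (j ℕ.+ n))) (approx x (j ℕ.+ n)) (approx x n))
      (ℤ∣.∣m∣n⇒∣m+n (ℤ∣.∣-trans (ℤ∣.∣ᵤ⇒∣ p^n∣p^j+n) (coherent x (j ℕ.+ n))) (coherent⁺ x n j))
      where
      open ℤSolver.+-*-Solver using (solve; _:+_; _:-_; _:=_)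
      telescope : ∀ a b c → (a ℤ.- b) ℤ.+ (b ℤ.- c) ≡ a ℤ.- c
      telescope = solve 3 (λ a b c → (a :- b) :+ (b :- c) := a :- c) ≡.refl
      p^n∣p^j+n : p ℕ.^ n ℕ∣.∣ p ℕ.^ (j ℕ.+ n)
      p^n∣p^j+n = ℕ∣.∣-trans (ℕ∣.n∣m*n (p ℕ.^ j)) (ℕ∣.∣-reflexive (≡.sym (ℕ.^-distribˡ-+-* p j n)))

    -- A divisibility by pⁿ can be tested at any higher level, since the approximations agree modulo
    -- pⁿ.
    at : ∀ x n j → p ℕ.^ n ℕ∣.∣ ℤ.∣ approx x (j ℕ.+ n) ∣ → vanishes x n
    at x n j q = ℤ∣.∣⇒∣ᵤ (≡.subst (+ (p ℕ.^ n) ∣_) (difference (approx x (j ℕ.+ n)) (approx x n))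
      (ℤ∣.∣m∣n⇒∣m-n {m = approx x (j ℕ.+ n)} (ℤ∣.∣ᵤ⇒∣ q) (coherent⁺ x n j)))
      where
      open ℤSolver.+-*-Solver using (solve; _:-_; _:=_)
      difference : ∀ a b → a ℤ.- (a ℤ.- b) ≡ b
      difference = solve 2 (λ a b → a :- (a :- b) := b) ≡.refl

  -- Divisibility by pⁿ is decidable, which gives stability. For cancellation look at level k + n:
  -- there pᵏ⁺ⁿ divides x y, so if pᵏ does not divide x, then pⁿ divides y.
  ℤₚ-isDomain : IsDomain (ℤₚ-ring p)
  ℤₚ-isDomain = record
    { stable = λ {x} ¬¬x≈0 → vanishes⇒≈0 {x} λ n → decidable-stable (p ℕ.^ n ℕ∣.∣? _) λ ¬v → ¬¬x≈0 λ x≈0 → ¬v (≈0⇒vanishes {x} x≈0 n)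
    ; cancel = λ {x} {y} x≉0 xy≈0 → vanishes⇒≈0 {y} λ n → decidable-stable (p ℕ.^ n ℕ∣.∣? _) λ ¬v →
        x≉0 (vanishes⇒≈0 {x} λ k → decidable-stable (p ℕ.^ k ℕ∣.∣? _) λ ¬w → ¬v (at y n k
          (prime-power-cancel p-prime k n _ _
            (≡.subst (p ℕ.^ (k ℕ.+ n) ℕ∣.∣_) (ℤ.abs-* (approx x (k ℕ.+ n)) (approx y (k ℕ.+ n))) (≈0⇒vanishes {x * y} xy≈0 (k ℕ.+ n)))
            (λ q → ¬w (at x k n (≡.subst (λ t → p ℕ.^ k ℕ∣.∣ ℤ.∣ approx x t ∣) (ℕ.+-comm k n) q))))))
    }

module Sums (A : CommutativeRing 0ℓ 0ℓ) where
  open CommutativeRing A hiding (zero)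
  open Sum semiring using (sum)

  sum-zero : ∀ {n} (t : Vector Carrier n) → (∀ i → t i ≈ 0#) → sum t ≈ 0#
  sum-zero {zero}  t t≈0 = refl
  sum-zero {suc n} t t≈0 = trans (+-cong (t≈0 zero) (sum-zero (t ∘ suc) (t≈0 ∘ suc))) (+-identityʳ 0#)

  sum-single : ∀ {n} (t : Vector Carrier n) k → (∀ i → i ≢ k → t i ≈ 0#) → sum t ≈ t k
  sum-single {suc n} t zero    z = trans (+-congˡ (sum-zero (t ∘ suc) (λ i → z (suc i) λ ()))) (+-identityʳ _)
  sum-single {suc n} t (suc k) z =
    trans (+-cong (z zero λ ()) (sum-single (t ∘ suc) k (λ i i≢k → z (suc i) (i≢k ∘ Fin.suc-injective)))) (+-identityˡ _)

module _ {A : CommutativeRing 0ℓ 0ℓ} (A-isDomain : IsDomain A) where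
  open CommutativeRing A hiding (zero)
  open PowerSeries A
  open Sums A
  private
    module D = IsDomain A-isDomain

    Leading : Series → ℕ → Set
    Leading f i = ¬ (f i ≈ 0#) × (∀ {j} → j ℕ.< i → f j ≈ 0#)

    -- Strong induction on n: once g vanishes below n, the coefficient of Tⁱ⁺ⁿ in f g is fᵢ gₙ.
    leading-cancel : ∀ {f g i} → Leading f i → (∀ n → (f ⊛ g) n ≈ 0#) → ∀ n → g n ≈ 0#
    leading-cancel {f} {g} {i} (fi≉0 , f<i) fg≈0 = <-rec (λ n → g n ≈ 0#) λ n rec →
      D.cancel fi≉0 (trans (sym (coefficient n (λ j<n → rec j<n))) (fg≈0 (i ℕ.+ n)))
      where
      coefficient : ∀ n → (∀ {m} → m ℕ.< n → g m ≈ 0#) → (f ⊛ g) (i ℕ.+ n) ≈ f i * g n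
      coefficient n g<n = trans (sum-single {suc (i ℕ.+ n)} t k others)
          (reflexive (≡.cong₂ (λ a b → f a * g b) toℕ-k (≡.trans (≡.cong (i ℕ.+ n ℕ.∸_) toℕ-k) (ℕ.m+n∸m≡n i n))))
        where
        t : Fin (suc (i ℕ.+ n)) → Carrier
        t j = f (toℕ j) * g (i ℕ.+ n ℕ.∸ toℕ j)
        i< : i ℕ.< suc (i ℕ.+ n)
        i< = s≤s (ℕ.m≤m+n i n)
        k : Fin (suc (i ℕ.+ n))
        k = fromℕ< i<
        toℕ-k : toℕ k ≡ i
        toℕ-k = Fin.toℕ-fromℕ< i<
        others : ∀ j → j ≢ k → t j ≈ 0#
        others j j≢k with ℕ.<-cmp (toℕ j) i
        ... | tri< j<i _ _ = trans (*-congʳ (f<i j<i)) (zeroˡ _)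
        ... | tri≈ _ j≡i _ = contradiction (Fin.toℕ-injective (≡.trans j≡i (≡.sym toℕ-k))) j≢k
        ... | tri> _ _ i<j = trans (*-congˡ (g<n (≡.subst (i ℕ.+ n ℕ.∸ toℕ j ℕ.<_) (ℕ.m+n∸m≡n i n)
                (ℕ.∸-monoʳ-< i<j (ℕ.≤-pred (Fin.toℕ<n j)))))) (zeroʳ _)

  series-isDomain : IsDomain (A ⟦T⟧)
  series-isDomain = record
    { stable = λ ¬¬f≈0 n → D.stable λ fn≉0 → ¬¬f≈0 λ f≈0 → fn≉0 (f≈0 n)
    -- The order of f cannot be computed. Instead gₙ ≉ 0 is assumed, and strong induction shows that
    -- no fᵢ can be a leading coefficient, so f = 0.
    ; cancel = λ {f} {g} f≉0 fg≈0 n → D.stable λ gn≉0 →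
        f≉0 (<-rec (λ i → f i ≈ 0#) λ i rec → D.stable λ fi≉0 →
          gn≉0 (leading-cancel {f} {g} {i} (fi≉0 , λ j<i → rec j<i) fg≈0 n))
    }

module _ {A : CommutativeRing 0ℓ 0ℓ} (A-isDomain : IsDomain A) {p : ℕ} (Δ : FiniteAbelianPGroup p) where
  open CommutativeRing A hiding (zero)
  open GroupRing A Δ
  open Sums A
  private
    module D = IsDomain A-isDomain
    module Δ = FiniteAbelianPGroup Δ
    open Inverse Δ.enumeration using (to; from; to-cong; strictlyInverseˡ; strictlyInverseʳ)
    open Func renaming (to to infixl 20 _⟨_⟩)
    module ΔP = AbelianGroupProperties Δ.abelianGroup

    scalar-ε : ∀ a {δ} → to δ ≡ to Δ.ε → scalar a ⟨ δ ⟩ ≈ a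
    scalar-ε a {δ} q with to δ Fin.≟ to Δ.ε
    ... | yes _ = refl
    ... | no ¬q = contradiction q ¬q

    scalar-≢ε : ∀ a {δ} → to δ ≢ to Δ.ε → scalar a ⟨ δ ⟩ ≈ 0#
    scalar-≢ε a {δ} ¬q with to δ Fin.≟ to Δ.ε
    ... | yes q = contradiction q ¬q
    ... | no _  = refl

    scalar-* : ∀ a f δ → (scalar a *ᴳ f) ⟨ δ ⟩ ≈ a * f ⟨ δ ⟩
    scalar-* a f δ = trans
      (sum-single {Δ.order} (λ i → scalar a ⟨ from i ⟩ * f ⟨ from i Δ.⁻¹ Δ.∙ δ ⟩) (to Δ.ε)
        (λ i i≢ → trans (*-congʳ (scalar-≢ε a (i≢ ∘ ≡.trans (≡.sym (strictlyInverseˡ i))))) (zeroˡ _)))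
      (*-cong (scalar-ε a (strictlyInverseˡ (to Δ.ε)))
        (Func.cong f (Δ.trans (Δ.∙-congʳ (Δ.trans (Δ.⁻¹-cong (strictlyInverseʳ Δ.ε)) ΔP.ε⁻¹≈ε)) (Δ.identityˡ δ))))

  -- Multiplication by `scalar a` acts on each coefficient separately. This turns torsion over Λ
  -- into torsion by regular elements of Λ[Δ].
  scalar-regular : ∀ {a} → ¬ (a ≈ 0#) → Fractions.IsRegular (A [ Δ ]) (scalar a)
  scalar-regular {a} a≉0 f af≈0 δ = D.cancel a≉0 (trans (sym (scalar-* a f δ)) (af≈0 δ))

-- Common annihilators and the conclusion

module Annihilators (R : CommutativeRing 0ℓ 0ℓ) where
  open CommutativeRing R hiding (zero)
  open Regular R
  open Homs R
  open Linear R
  private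
    variable
      n : ℕ
      ℓ : Level

  Annihilates : Carrier → Module R ℓ ℓ → Set ℓ
  Annihilates d M = ∀ x → d *ₗ x ≈ᴹ 0ᴹ
    where open Module M

  annihilates-multiple : ∀ {M : Module R ℓ ℓ} {x} s t → Module._≈ᴹ_ M (Module._*ₗ_ M s x) (Module.0ᴹ M) →
                         Module._≈ᴹ_ M (Module._*ₗ_ M (s * t) x) (Module.0ᴹ M)
  annihilates-multiple {M = M} s t sx≈0 = ≈ᴹ-trans (*ₗ-congʳ (*-comm s t))
      (≈ᴹ-trans (*ₗ-assoc t s _) (≈ᴹ-trans (*ₗ-congˡ sx≈0) (*ₗ-zeroʳ t)))
    where open Module M

  -- The product of finitely many regular elements is regular, and the two closure hypotheses carry
  -- each property over to it.
  common : ∀ {i} {P : Fin n → Carrier → Set i} → (∀ j s t → P j s → P j (s * t)) → (∀ j s t → P j t → P j (s * t)) →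
           (∀ j → ∃[ s ] IsRegular s × P j s) → ∃[ s ] IsRegular s × (∀ j → P j s)
  common {zero}  _ _ _ = 1# , regular-1 , λ ()
  common {suc n} l r f =
    let s , s-reg , p  = f zero
        t , t-reg , ps = common (l ∘ suc) (r ∘ suc) (f ∘ suc)
    in s * t , regular-* s-reg t-reg , λ { zero → l zero s t p ; (suc j) → r (suc j) s t (ps j) }

  annihilates-multipleʳ : ∀ {M : Module R ℓ ℓ} {x} s t → Module._≈ᴹ_ M (Module._*ₗ_ M t x) (Module.0ᴹ M) →
                          Module._≈ᴹ_ M (Module._*ₗ_ M (s * t) x) (Module.0ᴹ M)
  annihilates-multipleʳ {M = M} s t tx≈0 = ≈ᴹ-trans (*ₗ-assoc s t _) (≈ᴹ-trans (*ₗ-congˡ tx≈0) (*ₗ-zeroʳ s))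
    where open Module M

  annihilator : (M : Module R ℓ ℓ) → IsFinitelyGenerated M →
    (∀ x → ∃[ s ] IsRegular s × Module._≈ᴹ_ M (Module._*ₗ_ M s x) (Module.0ᴹ M)) →
    ∃[ s ] IsRegular s × Annihilates s M
  annihilator M (a , π , π-surj) torsion = s , s-reg , λ x → let v , p = π-surj x in
      M.≈ᴹ-trans (M.*ₗ-congˡ (M.≈ᴹ-sym (p (λ _ → refl))))
        (M.≈ᴹ-trans (M.≈ᴹ-sym (hom-* π s v)) (M.≈ᴹ-trans (hom-basis M π (s ⊡ v)) (go v)))
    where
    module M = Module M
    killed : ∃[ s ] IsRegular s × (∀ j → s M.*ₗ ⟦ π ⟧ (e j) M.≈ᴹ M.0ᴹ)
    killed = common (λ j s t → annihilates-multiple {M = M} s t) (λ j s t → annihilates-multipleʳ {M = M} s t)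
               (λ j → torsion (⟦ π ⟧ (e j)))
    s : Carrier
    s = proj₁ killed
    s-reg : IsRegular s
    s-reg = proj₁ (proj₂ killed)
    go : ∀ v → combineᴹ M (λ j → ⟦ π ⟧ (e j)) (s ⊡ v) M.≈ᴹ M.0ᴹ
    go v = zeros (λ j → ⟦ π ⟧ (e j)) v (proj₂ (proj₂ killed))
      where
      zeros : ∀ {n} (x : Fin n → M.Carrierᴹ) (v : V n) → (∀ j → s M.*ₗ x j M.≈ᴹ M.0ᴹ) → combineᴹ M x (s ⊡ v) M.≈ᴹ M.0ᴹ
      zeros {zero}  x v p = M.≈ᴹ-refl
      zeros {suc n} x v p = M.≈ᴹ-trans (M.+ᴹ-cong (annihilates-multiple {M = M} s (v zero) (p zero))
        (zeros (x ∘ suc) (v ∘ suc) (p ∘ suc))) (M.+ᴹ-identityˡ _)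

module Independence (R : CommutativeRing 0ℓ 0ℓ) where
  open CommutativeRing R using (*-comm; *-identityˡ; *-identityʳ; trans; sym; 1#)
  module F = Fractions R
  open F using (IsRegular; Fraction; fraction; ι; _≈Q_; _*Q_; Q; Q-module)
  open Annihilators R
  private
    variable
      ℓ : Level
      n : ℕ

  fractions : RAlgebra R
  fractions = record { A = Q ; ι = ι ; isModule = Module.isModule Q-module }

  ι-inverse : ∀ {r} → IsRegular r → Σ[ s ∈ Fraction ] (ι r *Q s) ≈Q ι 1#
  ι-inverse {r} r-reg = fraction 1# r r-reg , trans (*-identityʳ _) (trans (*-comm r 1#) (sym (*-identityˡ _)))

  module _ {d} (d-reg : IsRegular d) where
    open Comparison R fractions ι-inverse d-reg
    private
      module 𝓜 = CommutativeMonoid commutativeMonoid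

    -- Products, inverses and the unit ideal coincide definitionally with those of the statement;
    -- operations defined by recursion are matched by induction.
    ^ⁿ-agrees : ∀ (I : FI) k → (I F.^ⁿ k) ≐ (I ^ⁿ k)
    ^ⁿ-agrees I zero    = 𝓜.refl
    ^ⁿ-agrees I (suc k) = 𝓜.∙-congˡ {I} (^ⁿ-agrees I k)

    ^ⁿ-cong : ∀ {I J} → I ≐ J → ∀ k → (I ^ⁿ k) ≐ (J ^ⁿ k)
    ^ⁿ-cong I≐J zero    = 𝓜.refl
    ^ⁿ-cong I≐J (suc k) = 𝓜.∙-cong I≐J (^ⁿ-cong I≐J k)

    ^ᶻ-agrees : ∀ (I : FI) z → (I F.^ z) ≐ (I ^ᶻ z)
    ^ᶻ-agrees I (+ k)    = ^ⁿ-agrees I k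
    ^ᶻ-agrees I -[1+ k ] = 𝓜.trans (^ⁿ-agrees (I F.⁻¹) (suc k)) (^ⁿ-cong (mk≐ (λ p → p) (λ p → p)) (suc k))

    ∏-agrees : {I J : Vector FI n} → (∀ i → I i ≐ J i) → F.∏ I ≐ ∏ᴬ J
    ∏-agrees {zero}  I≐J = 𝓜.refl
    ∏-agrees {suc n} I≐J = 𝓜.∙-cong (I≐J zero) (∏-agrees (I≐J ∘ suc))

    module _ {IsTorsion : Module R ℓ ℓ → Set ℓ} {M : Module R ℓ ℓ} (γ : IsFinitelyGenerated {R = R} M) where

      𝓕-resolution : (S : Resolution {R = R} IsTorsion n M) (pres : Presentations {R = R} S) →
        (∀ i → Annihilates d (Resolution.P S i)) →
        Σ[ k ∈ ℕ ] Σ[ X ∈ Blocks.Sub R k ] Σ[ r ∈ Res (λ x → Module._≈ᴹ_ M (⟦ proj₁ (proj₂ γ) ⟧ x) (Module.0ᴹ M)) n X ]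
          𝓕 {R = R} S pres ≐ 𝓕ʳ r
      𝓕-resolution {n} S pres dP≈0 = let k , X , r , FitX , tracks = resolution (proj₁ (proj₂ γ)) (proj₂ (proj₂ γ)) n S.sequence P.presN P.presP S.P-pd≤1 dP≈0
        in k , X , r , 𝓜.trans
          (𝓜.∙-cong (𝓜.trans (∏-agrees (λ i → ^ᶻ-agrees (extendᴬ (FittingIdeal (P.presP i))) (-1ℤ ℤ.^ suc (toℕ i))))
                       (∏-alternating r tracks))
                    (𝓜.sym FitX))
          (𝓜.comm (value (alternating r)) (Fit X))
        where
        module S = Resolution S
        module P = Presentations pres

      𝓕-independent : (S S′ : Resolution {R = R} IsTorsion n M)
        (pres : Presentations {R = R} S) (pres′ : Presentations {R = R} S′) →
        (∀ i → Annihilates d (Resolution.P S i)) → (∀ i → Annihilates d (Resolution.P S′ i)) →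
        𝓕 {R = R} S pres ≐ₛ 𝓕 {R = R} S′ pres′
      𝓕-independent S S′ pres pres′ dP≈0 dP′≈0 =
        let _ , _ , r  , eq  = 𝓕-resolution S pres dP≈0
            _ , _ , r′ , eq′ = 𝓕-resolution S′ pres′ dP′≈0
        in ≐⇒≐ₛ (𝓜.trans eq (𝓜.trans (𝓕ʳ-unique r r′) (𝓜.sym eq′)))

  private
    killing : ∀ {IsTorsion : Module R ℓ ℓ → Set ℓ} {M : Module R ℓ ℓ} →
      (∀ P → IsTorsion P → ∀ x → ∃[ s ] IsRegular s × Module._≈ᴹ_ P (Module._*ₗ_ P s x) (Module.0ᴹ P)) →
      (S : Resolution {R = R} IsTorsion n M) → ∃[ d ] IsRegular d × (∀ i → Annihilates d (Resolution.P S i))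
    killing torsion S = common
      (λ i s t sP≈0 x → annihilates-multiple {M = P i} s t (sP≈0 x))
      (λ i s t tP≈0 x → annihilates-multipleʳ {M = P i} s t (tP≈0 x))
      (λ i → annihilator (P i) (P-fg i) (torsion (P i) (P-torsion i)))
      where open Resolution S

  𝓕-unique : {IsTorsion : Module R ℓ ℓ → Set ℓ} {M : Module R ℓ ℓ} → IsFinitelyGenerated {R = R} M →
    (∀ P → IsTorsion P → ∀ x → ∃[ s ] IsRegular s × Module._≈ᴹ_ P (Module._*ₗ_ P s x) (Module.0ᴹ P)) →
    (S S′ : Resolution {R = R} IsTorsion n M) (pres : Presentations {R = R} S) (pres′ : Presentations {R = R} S′) →
    𝓕 {R = R} S pres ≐ₛ 𝓕 {R = R} S′ pres′
  𝓕-unique γ torsion S S′ pres pres′ =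
    let s , s-reg , sP≈0 = killing torsion S
        t , t-reg , tP≈0 = killing torsion S′
    -- The product s t is regular and kills the terms of both sequences, so it can serve as the
    -- common d.
    in 𝓕-independent (Regular.regular-* R s-reg t-reg) γ S S′ pres pres′
         (λ i x → annihilates-multiple {M = Resolution.P S i} s t (sP≈0 i x))
         (λ i x → annihilates-multipleʳ {M = Resolution.P S′ i} s t (tP≈0 i x))

torsion⇒killed : ∀ {A : CommutativeRing 0ℓ 0ℓ} → IsDomain A → ∀ {p} (Δ : FiniteAbelianPGroup p) {ℓ} (P : Module (A [ Δ ]) ℓ ℓ) →
  IsTorsionAlong {R = A [ Δ ]} A (GroupRing.scalar A Δ) P → ∀ x →
  Σ[ s ∈ CommutativeRing.Carrier (A [ Δ ]) ]
    Fractions.IsRegular (A [ Δ ]) s × Module._≈ᴹ_ P (Module._*ₗ_ P s x) (Module.0ᴹ P)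
torsion⇒killed {A} A-isDomain Δ P P-torsion x =
  let a , a≉0 , ax≈0 = P-torsion x
  in GroupRing.scalar A Δ a , scalar-regular A-isDomain Δ a≉0 , ax≈0

Λ-isDomain : ∀ {p} → Prime p → (Δ : FiniteAbelianPGroup p) → IsDomain (Iwasawa.Λ Δ)
Λ-isDomain {p} p-prime Δ = series-isDomain {A = ℤₚ-ring p} (ℤₚ-isDomain p-prime)

theorem1p2 : (p : ℕ) → Prime p → p ≢ 2 →
    (Δ : FiniteAbelianPGroup p) →
    (ℓ : Level) (M : Module (Iwasawa.R Δ) ℓ ℓ) →
    IsFinitelyGenerated {R = Iwasawa.R Δ} M → Iwasawa.IsTorsion Δ M →
    (n : ℕ) (S S′ : Resolution {R = Iwasawa.R Δ} (Iwasawa.IsTorsion Δ) n M)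
    (pres : Presentations {R = Iwasawa.R Δ} S) (pres′ : Presentations {R = Iwasawa.R Δ} S′) →
    𝓕 {R = Iwasawa.R Δ} S pres ≐ₛ 𝓕 {R = Iwasawa.R Δ} S′ pres′
theorem1p2 p p-prime _ Δ ℓ M M-fg _ n S S′ pres pres′ =
  Independence.𝓕-unique (Iwasawa.R Δ) {ℓ} {n} {Iwasawa.IsTorsion Δ} {M} M-fg 
    (torsion⇒killed {Iwasawa.Λ Δ} (Λ-isDomain p-prime Δ) Δ) S S′ pres pres′
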